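{- Let $n\ge 1$ and $w\in S_n$. Then $$\mathfrak G^{(\beta)}_w(\mathbf x;\mathbf y)=\sum_{(\mathcal P,\mathcal S)\in \mathsf{MPipes}(w)}\beta^{|D(\mathcal P)|+|\mathcal S|-\ell(w)}\Big(\prod_{(i,j)\in D(\mathcal P)\cup\mathcal S}(x_i\oplus y_j)\Big).$$
   Context: Permutations $w\in S_n$ are written in one-line notation $w=w_1\cdots w_n$; $s_i=(i\ i+1)$; $\ell(w)$ is the Coxeter length; $w_0=n\,(n-1)\cdots 1$; $x_i\oplus y_j=x_i+y_j+\beta x_iy_j$. Bumpless pipe dreams. Cells of the $n\times n$ grid are indexed $(i,j)$: row $i$ from the top, column $j$ from the left. There are six tiles: downward elbow (a pipe joining the bottom and right edges), upward elbow (a pipe joining the left and top edges), crossing (one pipe joining left and right edges and one joining bottom and top edges), blank (no pipe), horizontal (a pipe joining left and right edges), vertical (a pipe joining bottom and top edges). A bumpless pipe dream (BPD) of size $n$ is a tiling of the $n\times n$ grid by these tiles such that an edge shared by two cells is met by a pipe from both sides or from neither, every edge on the bottom boundary and every edge on the right boundary of the grid is met by a pipe, and no edge on the left or top boundary is met by a pipe. $D(\mathcal P)$ is the set of positions of blank tiles of $\mathcal P$ and $U(\mathcal P)$ is the set of positions of upward elbow tiles. Demazure product $\partial(\mathcal P)\in S_n$ of a BPD $\mathcal P$: label the bottom boundary edges $1,\dots,n$ from left to right and propagate labels along pipes north and east; at a crossing tile, of the two labels entering from the left and from below, the smaller one leaves through the right edge and the larger one through the top edge. Then $\partial(\mathcal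 P)(i)$ is the label arriving at the right boundary edge of row $i$. $\mathsf{Pipes}(w)$ is the set of BPDs $\mathcal P$ of size $n$ with $\partial(\mathcal P)=w$. $\mathsf{MPipes}(w)$ is the set of marked BPDs for $w$: pairs $(\mathcal P,\mathcal S)$ with $\mathcal P\in\mathsf{Pipes}(w)$ and $\mathcal S\subseteq U(\mathcal P)$. $\beta$-double Grothendieck polynomials: $S_n$ acts on $\mathbb Z[\beta][y_1,\dots,y_n][x_1,\dots,x_n]$ by $w\cdot f=f(x_{w_1},\dots,x_{w_n};\mathbf y)$. Let $\pi_i(f)=\dfrac{(1+\beta x_{i+1})f-(1+\beta x_i)\,s_i\cdot f}{x_i-x_{i+1}}$. Set $\mathfrak G^{(\beta)}_{w_0}(\mathbf x;\mathbf y)=\prod_{i,j\ge1,\ i+j\le n}(x_i\oplus y_j)$, and whenever $w_i>w_{i+1}$ set $\mathfrak G^{(\beta)}_{ws_i}(\mathbf x;\mathbf y)=\pi_i(\mathfrak G^{(\beta)}_w(\mathbf x;\mathbf y))$; this is well defined. -}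

module Defs where

open import Algebra.Bundles using (CommutativeRing)
import Algebra.Properties.Semiring.Exp as Exp
open import Data.Bool.Base using (Bool; true; false; if_then_else_)
import Data.Bool.Properties as Bool
open import Data.Fin.Base using (Fin; zero; suc; toℕ; fromℕ; inject₁; remQuot; _<_; _>_)
open import Data.Fin.Induction using (<-weakInduction; >-weakInduction)
open import Data.Fin.Permutation as Perm
  using (Permutation′; _⟨$⟩ʳ_; _∘ₚ_; transpose; reverse) renaming (_≈_ to _≈ₚ_)
import Data.Fin.Permutation.Components as PC
open import Data.Fin.Properties as Fin using (_≟_; _<?_; all?; any?)
open import Data.Fin.Subset using (Subset; _⊆_; _∪_; ∣_∣; inside; outside)
open import Data.Fin.Subset.Properties using (_⊆?_; _∈?_)
open import Data.List.Base
  using (List; []; _∷_; map; filter; foldr; allFin; cartesianProduct; cartesianProductWith)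
open import Data.List.Membership.Propositional using (_∈_)
open import Data.List.Membership.Propositional.Properties
  using (∈-filter⁺; ∈-filter⁻; ∈-cartesianProduct⁺; ∈-cartesianProductWith⁺)
open import Data.List.Relation.Unary.All using ([]; _∷_)
open import Data.List.Relation.Unary.AllPairs using ([]; _∷_)
open import Data.List.Relation.Unary.Any using (here; there)
open import Data.List.Relation.Unary.Unique.Propositional using (Unique)
open import Data.List.Relation.Unary.Unique.Propositional.Properties
  using (filter⁺; cartesianProduct⁺; cartesianProductWith⁺)
open import Data.Maybe.Base using (Maybe; just; nothing)
import Data.Maybe.Properties as Maybe
open import Data.Nat.Base as ℕ using (ℕ; _⊓_; _⊔_; z≤n; s≤s)
open import Data.Nat.Induction using (<-wellFounded)
import Data.Nat.Properties as ℕ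
import Data.Nat.Solver as ℕSolver
open import Data.Product.Base using (∃; ∃-syntax; _×_; _,_; proj₁; proj₂; uncurry)
open import Data.Vec.Base as Vec using (Vec; []; _∷_; lookup; tabulate)
open import Data.Vec.Properties using (∷-injective)
open import Function.Base using (_∘_; case_of_)
open import Induction.WellFounded using (Acc; acc)
open import Level using (0ℓ)
open import Relation.Binary.Core using (Rel)
open import Relation.Binary.PropositionalEquality as ≡
  using (_≡_; _≢_; refl; sym; trans; cong; cong₂; subst; subst₂)
open import Relation.Nullary.Decidable
  using (Dec; yes; no; does; map′; _×-dec_; _→-dec_; dec-true; dec-false)
open import Relation.Nullary.Negation using (¬_; contradiction)
open import Relation.Unary using (Pred; Decidable)
import Algebra.Solver.Ring.NaturalCoefficients.Default as RingSolver
import Relation.Binary.Reasoning.Setoid as SetoidReasoning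

private
  variable
    m n k : ℕ

-- The polynomial ring ℤ[β][y₁,…,yₙ][x₁,…,xₙ], presented as the free
-- commutative ring on β, the yⱼ and the xᵢ: terms modulo the congruence
-- generated by the commutative ring axioms.  Indices start at 0, so
-- x i stands for x_{i+1} when i is read as a number.

infixl 6 _+_ _-_
infixl 7 _*_
infix  8 -_

data Poly (n : ℕ) : Set where
  β   : Poly n
  x   : Fin n → Poly n
  y   : Fin n → Poly n
  0#  : Poly n
  1#  : Poly n
  _+_ : Poly n → Poly n → Poly n
  _*_ : Poly n → Poly n → Poly n
  -_  : Poly n → Poly n

_-_ : Poly n → Poly n → Poly n
p - q = p + - q

infix 4 _≈_

data _≈_ {n : ℕ} : Rel (Poly n) 0ℓ where
  ≈-refl      : ∀ {p} → p ≈ p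
  ≈-sym       : ∀ {p q} → p ≈ q → q ≈ p
  ≈-trans     : ∀ {p q r} → p ≈ q → q ≈ r → p ≈ r
  +-cong      : ∀ {p p′ q q′} → p ≈ p′ → q ≈ q′ → p + q ≈ p′ + q′
  *-cong      : ∀ {p p′ q q′} → p ≈ p′ → q ≈ q′ → p * q ≈ p′ * q′
  -‿cong      : ∀ {p p′} → p ≈ p′ → - p ≈ - p′
  +-assoc     : ∀ p q r → (p + q) + r ≈ p + (q + r)
  +-comm      : ∀ p q → p + q ≈ q + p
  +-identityˡ : ∀ p → 0# + p ≈ p
  -‿inverseˡ  : ∀ p → - p + p ≈ 0#
  *-assoc     : ∀ p q r → (p * q) * r ≈ p * (q * r)
  *-comm      : ∀ p q → p * q ≈ q * p
  *-identityˡ : ∀ p → 1# * p ≈ p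
  distribˡ    : ∀ p q r → p * (q + r) ≈ p * q + p * r

polyRing : ℕ → CommutativeRing 0ℓ 0ℓ
polyRing n = record
  { Carrier = Poly n ; _≈_ = _≈_ ; _+_ = _+_ ; _*_ = _*_ ; -_ = -_ ; 0# = 0# ; 1# = 1#
  ; isCommutativeRing = record
    { isRing = record
      { +-isAbelianGroup = record
        { isGroup = record
          { isMonoid = record
            { isSemigroup = record
              { isMagma = record
                { isEquivalence = record { refl = ≈-refl ; sym = ≈-sym ; trans = ≈-trans }
                ; ∙-cong = +-cong }
              ; assoc = +-assoc }
            ; identity = +-identityˡ
                       , λ p → ≈-trans (+-comm p 0#) (+-identityˡ p) }
          ; inverse = -‿inverseˡ
                    , λ p → ≈-trans (+-comm p (- p)) (-‿inverseˡ p)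
          ; ⁻¹-cong = -‿cong }
        ; comm = +-comm }
      ; *-cong = *-cong
      ; *-assoc = *-assoc
      ; *-identity = *-identityˡ
                   , λ p → ≈-trans (*-comm p 1#) (*-identityˡ p)
      ; distrib = distribˡ
                , λ p q r → ≈-trans (*-comm (q + r) p) (≈-trans (distribˡ p q r)
                              (+-cong (*-comm p q) (*-comm p r))) }
    ; *-comm = *-comm } }

infixr 8 _^_

_^_ : Poly n → ℕ → Poly n
_^_ {n} = Exp._^_ (CommutativeRing.semiring (polyRing n))

infixl 6 _⊕_

_⊕_ : Poly n → Poly n → Poly n
p ⊕ q = p + q + β * p * q

∑ ∏ : {A : Set} → List A → (A → Poly n) → Poly n
∑ as f = foldr (λ a → f a +_) 0# as
∏ as f = foldr (λ a → f a *_) 1# as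

substX : (Fin n → Fin n) → Poly n → Poly n
substX ρ β       = β
substX ρ (x i)   = x (ρ i)
substX ρ (y j)   = y j
substX ρ 0#      = 0#
substX ρ 1#      = 1#
substX ρ (p + q) = substX ρ p + substX ρ q
substX ρ (p * q) = substX ρ p * substX ρ q
substX ρ (- p)   = - substX ρ p

infixr 7 _•_

_•_ : Permutation′ n → Poly n → Poly n
w • f = substX (w ⟨$⟩ʳ_) f

substX-cong : (ρ : Fin n → Fin n) {p q : Poly n} → p ≈ q → substX ρ p ≈ substX ρ q
substX-cong ρ ≈-refl              = ≈-refl
substX-cong ρ (≈-sym e)           = ≈-sym (substX-cong ρ e)
substX-cong ρ (≈-trans e e′)      = ≈-trans (substX-cong ρ e) (substX-cong ρ e′)
substX-cong ρ (+-cong e e′)       = +-cong (substX-cong ρ e) (substX-cong ρ e′)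
substX-cong ρ (*-cong e e′)       = *-cong (substX-cong ρ e) (substX-cong ρ e′)
substX-cong ρ (-‿cong e)          = -‿cong (substX-cong ρ e)
substX-cong ρ (+-assoc _ _ _)     = +-assoc _ _ _
substX-cong ρ (+-comm _ _)        = +-comm _ _
substX-cong ρ (+-identityˡ _)     = +-identityˡ _
substX-cong ρ (-‿inverseˡ _)      = -‿inverseˡ _
substX-cong ρ (*-assoc _ _ _)     = *-assoc _ _ _
substX-cong ρ (*-comm _ _)        = *-comm _ _
substX-cong ρ (*-identityˡ _)     = *-identityˡ _
substX-cong ρ (distribˡ _ _ _)    = distribˡ _ _ _

substX-∘ : {ρ σ τ : Fin n → Fin n} → (∀ i → ρ (σ i) ≡ τ i) →
           ∀ p → substX ρ (substX σ p) ≡ substX τ p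
substX-∘ h β       = refl
substX-∘ h (x i)   = cong x (h i)
substX-∘ h (y j)   = refl
substX-∘ h 0#      = refl
substX-∘ h 1#      = refl
substX-∘ h (p + q) = cong₂ _+_ (substX-∘ h p) (substX-∘ h q)
substX-∘ h (p * q) = cong₂ _*_ (substX-∘ h p) (substX-∘ h q)
substX-∘ h (- p)   = cong -_ (substX-∘ h p)

merge : Fin n → Fin n → Fin n → Fin n
merge a b k = if does (k ≟ a) then b else k

-- The quotient of p on division by x a - x b; the remainder is
-- substX (merge a b) p, i.e. p with x a replaced by x b (see division).

quot : Fin n → Fin n → Poly n → Poly n
quot a b β       = 0#
quot a b (x k)   = if does (k ≟ a) then 1# else 0#
quot a b (y j)   = 0#
quot a b 0#      = 0#
quot a b 1#      = 0#
quot a b (p + q) = quot a b p + quot a b q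
quot a b (p * q) = quot a b p * q + substX (merge a b) p * quot a b q
quot a b (- p)   = - quot a b p

module _ {n : ℕ} where

  private
    module R = CommutativeRing (polyRing n)
    open RingSolver R.commutativeSemiring
    open SetoidReasoning R.setoid
    open import Algebra.Properties.Ring R.ring using (-‿distribʳ-*; -‿+-comm; -0#≈0#)

  module _ (a b : Fin n) where

    private
      d : Poly n
      d = x a - x b

      r : Poly n → Poly n
      r = substX (merge a b)

      q : Poly n → Poly n
      q = quot a b

      constant : ∀ p → d * 0# + p ≈ p
      constant p = ≈-trans (+-cong (R.zeroʳ d) ≈-refl) (+-identityˡ p)

    division : ∀ p → (x a - x b) * quot a b p + substX (merge a b) p ≈ p
    division β = constant β
    division (x k) with k ≟ a
    ... | yes refl = begin
      (x a - x b) * 1# + x b   ≈⟨ +-cong (R.*-identityʳ d) ≈-refl ⟩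
      x a + - x b + x b        ≈⟨ +-assoc _ _ _ ⟩
      x a + (- x b + x b)      ≈⟨ +-cong ≈-refl (-‿inverseˡ _) ⟩
      x a + 0#                 ≈⟨ R.+-identityʳ _ ⟩
      x a                      ∎
    ... | no _ = constant (x k)
    division (y j)   = constant (y j)
    division 0#      = constant 0#
    division 1#      = constant 1#
    division (f + g) = begin
      d * (q f + q g) + (r f + r g)
        ≈⟨ solve 5 (λ d f f′ g g′ → d :* (f :+ g) :+ (f′ :+ g′)
                                 := (d :* f :+ f′) :+ (d :* g :+ g′))
                 ≈-refl d (q f) (r f) (q g) (r g) ⟩
      (d * q f + r f) + (d * q g + r g)
        ≈⟨ +-cong (division f) (division g) ⟩
      f + g ∎
    division (f * g) = begin
      d * (q f * g + r f * q g) + r f * r g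
        ≈⟨ solve 6 (λ d f f′ g g₁ g′ → d :* (f :* g :+ f′ :* g₁) :+ f′ :* g′
                                 := d :* f :* g :+ f′ :* (d :* g₁ :+ g′))
                 ≈-refl d (q f) (r f) g (q g) (r g) ⟩
      d * q f * g + r f * (d * q g + r g)
        ≈⟨ +-cong ≈-refl (*-cong ≈-refl (division g)) ⟩
      d * q f * g + r f * g
        ≈⟨ R.distribʳ _ _ _ ⟨
      (d * q f + r f) * g
        ≈⟨ *-cong (division f) ≈-refl ⟩
      f * g ∎
    division (- f) = begin
      d * - q f + - r f        ≈⟨ +-cong (-‿distribʳ-* d (q f)) ≈-refl ⟨
      - (d * q f) + - r f      ≈⟨ -‿+-comm _ _ ⟩
      - (d * q f + r f)        ≈⟨ -‿cong (division f) ⟩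
      - f                      ∎

    quot-cong : ∀ {f g} → f ≈ g → quot a b f ≈ quot a b g
    quot-cong ≈-refl             = ≈-refl
    quot-cong (≈-sym e)          = ≈-sym (quot-cong e)
    quot-cong (≈-trans e e′)     = ≈-trans (quot-cong e) (quot-cong e′)
    quot-cong (+-cong e e′)      = +-cong (quot-cong e) (quot-cong e′)
    quot-cong (*-cong e e′)      =
      +-cong (*-cong (quot-cong e) e′) (*-cong (substX-cong _ e) (quot-cong e′))
    quot-cong (-‿cong e)         = -‿cong (quot-cong e)
    quot-cong (+-assoc f g h)    = +-assoc _ _ _
    quot-cong (+-comm f g)       = +-comm _ _
    quot-cong (+-identityˡ f)    = +-identityˡ _
    quot-cong (-‿inverseˡ f)     = -‿inverseˡ _
    quot-cong (*-assoc f g h)    =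
      solve 7 (λ f f′ g g′ g₁ h h₁ →
                 (f :* g :+ f′ :* g₁) :* h :+ (f′ :* g′) :* h₁
              := f :* (g :* h) :+ f′ :* (g₁ :* h :+ g′ :* h₁))
        ≈-refl (q f) (r f) g (r g) (q g) h (q h)
    quot-cong (*-comm f g)       = begin
      q f * g + r f * q g
        ≈⟨ +-cong (*-cong ≈-refl (division g)) ≈-refl ⟨
      q f * (d * q g + r g) + r f * q g
        ≈⟨ solve 5 (λ d f f′ g g′ → f :* (d :* g :+ g′) :+ f′ :* g
                                 := g :* (d :* f :+ f′) :+ g′ :* f)
                 ≈-refl d (q f) (r f) (q g) (r g) ⟩
      q g * (d * q f + r f) + r g * q f
        ≈⟨ +-cong (*-cong ≈-refl (division f)) ≈-refl ⟩
      q g * f + r g * q f ∎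
    quot-cong (*-identityˡ f)    = begin
      0# * f + 1# * q f  ≈⟨ +-cong (R.zeroˡ f) (*-identityˡ _) ⟩
      0# + q f           ≈⟨ +-identityˡ _ ⟩
      q f                ∎
    quot-cong (distribˡ f g h)   =
      solve 6 (λ f f′ g g₁ h h₁ →
                 f :* (g :+ h) :+ f′ :* (g₁ :+ h₁)
              := (f :* g :+ f′ :* g₁) :+ (f :* h :+ f′ :* h₁))
        ≈-refl (q f) (r f) g (q g) h (q h)

    quot-exact : a ≢ b → ∀ f → quot a b ((x a - x b) * f) ≈ f
    quot-exact a≢b f
      rewrite dec-true (a ≟ a) refl | dec-false (b ≟ a) (a≢b ∘ sym) = begin
      (1# + - 0#) * f + (x b + - x b) * q f
        ≈⟨ +-cong (*-cong (+-cong ≈-refl -0#≈0#) ≈-refl) (*-cong (R.-‿inverseʳ _) ≈-refl) ⟩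
      (1# + 0#) * f + 0# * q f
        ≈⟨ solve 2 (λ f g → (con 1 :+ con 0) :* f :+ con 0 :* g := f) ≈-refl f (q f) ⟩
      f ∎

    cancel : a ≢ b → ∀ {f g} → (x a - x b) * f ≈ (x a - x b) * g → f ≈ g
    cancel a≢b {f} {g} e =
      ≈-trans (≈-sym (quot-exact a≢b f)) (≈-trans (quot-cong e) (quot-exact a≢b g))

-- Products of permutations compose from right to left, so v w is
-- w ∘ₚ v in the notation of Data.Fin.Permutation; in particular w sᵢ is
-- s i ∘ₚ w, which exchanges the entries of w in positions i and i+1.

s : Fin m → Permutation′ (ℕ.suc m)
s i = transpose (inject₁ i) (suc i)

-- The β-divided difference.  π-unique and π-quotient say that π i f is
-- the one and only g with (xᵢ - xᵢ₊₁) g = (1+βxᵢ₊₁) f - (1+βxᵢ) (sᵢ f).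

π-numerator : Fin m → Poly (ℕ.suc m) → Poly (ℕ.suc m)
π-numerator i f =
  (1# + β * x (suc i)) * f - (1# + β * x (inject₁ i)) * (s i • f)

π : Fin m → Poly (ℕ.suc m) → Poly (ℕ.suc m)
π i f = quot (inject₁ i) (suc i) (π-numerator i f)

inject₁≢suc : (i : Fin m) → inject₁ i ≢ suc i
inject₁≢suc i e = ℕ.1+n≢n (sym (trans (sym (Fin.toℕ-inject₁ i)) (cong toℕ e)))

s-left : (i : Fin m) → s i ⟨$⟩ʳ inject₁ i ≡ suc i
s-left i rewrite dec-true (inject₁ i ≟ inject₁ i) refl = refl

s-right : (i : Fin m) → s i ⟨$⟩ʳ suc i ≡ inject₁ i
s-right i rewrite dec-false (suc i ≟ inject₁ i) (inject₁≢suc i ∘ sym)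
                | dec-true (suc i ≟ suc i) refl = refl

s-fix : (i : Fin m) {k : Fin (ℕ.suc m)} → k ≢ inject₁ i → k ≢ suc i → s i ⟨$⟩ʳ k ≡ k
s-fix i {k} p q rewrite dec-false (k ≟ inject₁ i) p | dec-false (k ≟ suc i) q = refl

s-involutive : (i : Fin m) (k : Fin (ℕ.suc m)) → s i ⟨$⟩ʳ (s i ⟨$⟩ʳ k) ≡ k
s-involutive i k = case k ≟ inject₁ i of λ where
  (yes refl) → trans (cong (s i ⟨$⟩ʳ_) (s-left i)) (s-right i)
  (no p) → case k ≟ suc i of λ where
    (yes refl) → trans (cong (s i ⟨$⟩ʳ_) (s-right i)) (s-left i)
    (no q) → trans (cong (s i ⟨$⟩ʳ_) (s-fix i p q)) (s-fix i p q)

π-quotient : (i : Fin m) (f : Poly (ℕ.suc m)) →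
             (x (inject₁ i) - x (suc i)) * π i f ≈ π-numerator i f
π-quotient {m} i f = begin
  d * π i f                          ≈⟨ R.+-identityʳ _ ⟨
  d * π i f + 0#                     ≈⟨ +-cong ≈-refl remainder ⟨
  d * π i f + substX μ (π-numerator i f)
                                     ≈⟨ division (inject₁ i) (suc i) (π-numerator i f) ⟩
  π-numerator i f                    ∎
  where
  module R = CommutativeRing (polyRing (ℕ.suc m))
  open SetoidReasoning R.setoid

  d : Poly (ℕ.suc m)
  d = x (inject₁ i) - x (suc i)

  μ : Fin (ℕ.suc m) → Fin (ℕ.suc m)
  μ = merge (inject₁ i) (suc i)

  μ-left : μ (inject₁ i) ≡ suc i
  μ-left rewrite dec-true (inject₁ i ≟ inject₁ i) refl = refl

  μ-right : μ (suc i) ≡ suc i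
  μ-right rewrite dec-false (suc i ≟ inject₁ i) (inject₁≢suc i ∘ sym) = refl

  μ∘s : ∀ k → μ (s i ⟨$⟩ʳ k) ≡ μ k
  μ∘s k = case k ≟ inject₁ i of λ where
    (yes refl) → trans (cong μ (s-left i)) (trans μ-right (sym μ-left))
    (no p) → case k ≟ suc i of λ where
      (yes refl) → trans (cong μ (s-right i)) (trans μ-left (sym μ-right))
      (no q) → cong μ (s-fix i p q)

  remainder : substX μ (π-numerator i f) ≈ 0#
  remainder rewrite substX-∘ {ρ = μ} {σ = s i ⟨$⟩ʳ_} μ∘s f | μ-left | μ-right = R.-‿inverseʳ _

π-unique : (i : Fin m) (f g : Poly (ℕ.suc m)) →
           (x (inject₁ i) - x (suc i)) * g ≈ π-numerator i f → g ≈ π i f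
π-unique i f g e =
  cancel (inject₁ i) (suc i) (inject₁≢suc i) (≈-trans e (≈-sym (π-quotient i f)))

𝔊-w₀ : (n : ℕ) → Poly n
𝔊-w₀ n = ∏ (filter (λ (i , j) → ℕ.suc (toℕ i) ℕ.+ ℕ.suc (toℕ j) ℕ.≤? n)
                   (cartesianProduct (allFin n) (allFin n)))
           (λ (i , j) → x i ⊕ y j)

-- IsGrothendieck w f: the recursion started at w₀ produces f at w, along
-- some chain of descents.  Independence of the chain is not built in: a
-- statement about every f with IsGrothendieck w f is a statement about
-- all chains.

data IsGrothendieck {m : ℕ} : Permutation′ (ℕ.suc m) → Poly (ℕ.suc m) → Set where
  longest : ∀ {w} → w ≈ₚ reverse → IsGrothendieck w (𝔊-w₀ (ℕ.suc m))
  descend : ∀ {w f} (i : Fin m) {v} → IsGrothendieck w f →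
            w ⟨$⟩ʳ inject₁ i > w ⟨$⟩ʳ suc i →
            v ≈ₚ s i ∘ₚ w →
            IsGrothendieck v (π i f)

sumFin : (Fin n → ℕ) → ℕ
sumFin {ℕ.zero}  f = 0
sumFin {ℕ.suc n} f = f zero ℕ.+ sumFin (f ∘ suc)

sumFin-cong : {f g : Fin n → ℕ} → (∀ i → f i ≡ g i) → sumFin f ≡ sumFin g
sumFin-cong {ℕ.zero}  h = refl
sumFin-cong {ℕ.suc n} h = cong₂ ℕ._+_ (h zero) (sumFin-cong (h ∘ suc))

sumFin-< : {f g : Fin (ℕ.suc m) → ℕ} (i : Fin m) →
           (∀ k → k ≢ inject₁ i → k ≢ suc i → f k ≡ g k) →
           f (inject₁ i) ℕ.+ f (suc i) ℕ.< g (inject₁ i) ℕ.+ g (suc i) →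
           sumFin f ℕ.< sumFin g
sumFin-< {f = f} {g} zero h lt =
  subst₂ ℕ._<_ (ℕ.+-assoc (f zero) _ _) (ℕ.+-assoc (g zero) _ _)
    (ℕ.+-mono-<-≤ lt (ℕ.≤-reflexive (sumFin-cong λ k → h (suc (suc k)) (λ ()) (λ ()))))
sumFin-< (suc i) h lt =
  ℕ.+-mono-≤-< (ℕ.≤-reflexive (h zero (λ ()) (λ ())))
    (sumFin-< i (λ k p q → h (suc k) (p ∘ Fin.suc-injective) (q ∘ Fin.suc-injective)) lt)

weight : Permutation′ n → ℕ
weight w = sumFin λ k → toℕ k ℕ.* toℕ (w ⟨$⟩ʳ k)

weight-< : (w : Permutation′ (ℕ.suc m)) (i : Fin m) →
           w ⟨$⟩ʳ inject₁ i < w ⟨$⟩ʳ suc i → weight (s i ∘ₚ w) ℕ.< weight w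
weight-< w i lt = sumFin-< i
  (λ k p q → cong (λ l → toℕ k ℕ.* toℕ (w ⟨$⟩ʳ l)) (s-fix i p q))
  (subst₂ ℕ._<_ (sym exchanged) (sym original) (rearrangement (toℕ i) lt))
  where
  A B : ℕ
  A = toℕ (w ⟨$⟩ʳ inject₁ i)
  B = toℕ (w ⟨$⟩ʳ suc i)

  exchanged : toℕ (inject₁ i) ℕ.* toℕ (w ⟨$⟩ʳ (s i ⟨$⟩ʳ inject₁ i))
              ℕ.+ toℕ (suc i) ℕ.* toℕ (w ⟨$⟩ʳ (s i ⟨$⟩ʳ suc i))
            ≡ toℕ i ℕ.* B ℕ.+ ℕ.suc (toℕ i) ℕ.* A
  exchanged = cong₂ ℕ._+_
    (cong₂ ℕ._*_ (Fin.toℕ-inject₁ i) (cong (toℕ ∘ (w ⟨$⟩ʳ_)) (s-left i)))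
    (cong (λ k → ℕ.suc (toℕ i) ℕ.* toℕ (w ⟨$⟩ʳ k)) (s-right i))

  original : toℕ (inject₁ i) ℕ.* A ℕ.+ toℕ (suc i) ℕ.* B
           ≡ toℕ i ℕ.* A ℕ.+ ℕ.suc (toℕ i) ℕ.* B
  original = cong (λ t → t ℕ.* A ℕ.+ ℕ.suc (toℕ i) ℕ.* B) (Fin.toℕ-inject₁ i)

  rearrangement : ∀ t {a b} → a ℕ.< b →
                  t ℕ.* b ℕ.+ ℕ.suc t ℕ.* a ℕ.< t ℕ.* a ℕ.+ ℕ.suc t ℕ.* b
  rearrangement t {a} {b} a<b = subst₂ ℕ._<_
    (solve 3 (λ t a b → t :* a :+ t :* b :+ a := t :* b :+ (a :+ t :* a)) refl t a b)
    (solve 3 (λ t a b → t :* a :+ t :* b :+ b := t :* a :+ (b :+ t :* b)) refl t a b)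
    (ℕ.+-monoʳ-< (t ℕ.* a ℕ.+ t ℕ.* b) a<b)
    where open ℕSolver.+-*-Solver

decreasing⇒reverse : (w : Permutation′ (ℕ.suc m)) →
                     (∀ i → w ⟨$⟩ʳ inject₁ i > w ⟨$⟩ʳ suc i) → w ≈ₚ reverse
decreasing⇒reverse {m} w dec k = Fin.toℕ-injective (begin
  toℕ (w ⟨$⟩ʳ k)                           ≡⟨ ℕ.m+n∸n≡m _ (toℕ k) ⟨
  toℕ (w ⟨$⟩ʳ k) ℕ.+ toℕ k ℕ.∸ toℕ k       ≡⟨ cong (ℕ._∸ toℕ k) (ℕ.≤-antisym (upper k) (lower k)) ⟩
  m ℕ.∸ toℕ k                              ≡⟨ Fin.opposite-prop k ⟨
  toℕ (reverse ⟨$⟩ʳ k)                     ∎)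
  where
  open ≡.≡-Reasoning

  e : Fin (ℕ.suc m) → ℕ
  e k = toℕ (w ⟨$⟩ʳ k) ℕ.+ toℕ k

  step : ∀ i → e (suc i) ℕ.≤ e (inject₁ i)
  step i = subst₂ ℕ._≤_ (sym (ℕ.+-suc _ _))
             (cong (toℕ (w ⟨$⟩ʳ inject₁ i) ℕ.+_) (sym (Fin.toℕ-inject₁ i)))
             (ℕ.+-monoˡ-≤ (toℕ i) (dec i))

  upper : ∀ k → e k ℕ.≤ m
  upper = <-weakInduction (λ k → e k ℕ.≤ m)
    (subst (ℕ._≤ m) (sym (ℕ.+-identityʳ _)) (Fin.toℕ≤pred[n] (w ⟨$⟩ʳ zero)))
    (λ i → ℕ.≤-trans (step i))

  lower : ∀ k → m ℕ.≤ e k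
  lower = >-weakInduction (λ k → m ℕ.≤ e k)
    (subst (λ l → m ℕ.≤ toℕ (w ⟨$⟩ʳ fromℕ m) ℕ.+ l) (sym (Fin.toℕ-fromℕ m)) (ℕ.m≤n+m m _))
    (λ i h → ℕ.≤-trans h (step i))

ascent-induction : (P : Permutation′ (ℕ.suc m) → Set) →
  (∀ w → w ≈ₚ reverse → P w) →
  (∀ w i → w ⟨$⟩ʳ inject₁ i < w ⟨$⟩ʳ suc i → P (s i ∘ₚ w) → P w) →
  ∀ w → P w
ascent-induction P base up w = go w (<-wellFounded (weight w))
  where
  go : ∀ w → Acc ℕ._<_ (weight w) → P w
  go w (acc rs) with any? (λ i → w ⟨$⟩ʳ inject₁ i <? w ⟨$⟩ʳ suc i)
  ... | yes (i , lt) = up w i lt (go (s i ∘ₚ w) (rs (weight-< w i lt)))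
  ... | no none = base w (decreasing⇒reverse w λ i →
          ℕ.≤∧≢⇒< (ℕ.≮⇒≥ (λ lt → none (i , lt)))
            (λ eq → inject₁≢suc i (trans (sym (Perm.inverseˡ w))
              (trans (cong (w Perm.⟨$⟩ˡ_) (sym (Fin.toℕ-injective eq))) (Perm.inverseˡ w)))))

grothendieck-exists : (w : Permutation′ (ℕ.suc m)) → ∃ (IsGrothendieck w)
grothendieck-exists = ascent-induction (∃ ∘ IsGrothendieck)
  (λ w w≈ → _ , longest w≈)
  (λ w i lt (f , G) → π i f , descend i G
     (subst₂ _<_ (cong (w ⟨$⟩ʳ_) (sym (s-right i))) (cong (w ⟨$⟩ʳ_) (sym (s-left i))) lt)
     (λ k → cong (w ⟨$⟩ʳ_) (sym (s-involutive i k))))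

product : Vec (Fin m) k → Permutation′ (ℕ.suc m)
product []      = Perm.id
product (i ∷ u) = product u ∘ₚ s i

HasWord : Permutation′ (ℕ.suc m) → ℕ → Set
HasWord {m} w k = ∃[ u ] w ≈ₚ product {m} {k} u

record IsCoxeterLength (w : Permutation′ (ℕ.suc m)) (k : ℕ) : Set where
  field
    attained : HasWord w k
    minimal  : ∀ l → HasWord w l → k ℕ.≤ l

snoc-word : (w : Permutation′ (ℕ.suc m)) (i : Fin m) →
            HasWord (s i ∘ₚ w) k → HasWord w (ℕ.suc k)
snoc-word w i (u , e) = u Vec.∷ʳ i , λ k →
  trans (cong (w ⟨$⟩ʳ_) (sym (s-involutive i k)))
        (trans (e (s i ⟨$⟩ʳ k)) (sym (product-∷ʳ u k)))
  where
  product-∷ʳ : ∀ {k} (u : Vec (Fin _) k) → product (u Vec.∷ʳ i) ≈ₚ s i ∘ₚ product u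
  product-∷ʳ []      k = refl
  product-∷ʳ (j ∷ u) k = cong (s j ⟨$⟩ʳ_) (product-∷ʳ u k)

word-exists : (w : Permutation′ (ℕ.suc m)) → ∃ (HasWord w)
word-exists {m} = ascent-induction (∃ ∘ HasWord)
  (λ w w≈ → let (l , u , e) = reverse-word in l , u , λ k → trans (w≈ k) (e k))
  (λ w i _ (l , h) → ℕ.suc l , snoc-word w i h)
  where
  -- First solve w·u = w₀ for every w, then take w to be the identity.
  Q : Permutation′ (ℕ.suc m) → Set
  Q w = ∃[ l ] ∃[ u ] reverse ≈ₚ product {m} {l} u ∘ₚ w

  reverse-word : ∃ (HasWord reverse)
  reverse-word = ascent-induction Q
    (λ w w≈ → 0 , [] , λ k → sym (w≈ k))
    (λ w i _ (l , u , e) → ℕ.suc l , i ∷ u , e)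
    Perm.id

hasWord? : (w : Permutation′ (ℕ.suc m)) → Decidable (HasWord w)
hasWord? w k = search k (λ u → all? λ j → w ⟨$⟩ʳ j ≟ product u ⟨$⟩ʳ j)
  where
  search : ∀ {m} k {P : Pred (Vec (Fin m) k) 0ℓ} → Decidable P → Dec (∃ P)
  search ℕ.zero    P? = map′ ([] ,_) (λ { ([] , p) → p }) (P? [])
  search (ℕ.suc k) P? =
    map′ (λ (i , u , p) → i ∷ u , p) (λ { (i ∷ u , p) → i , u , p })
      (any? λ i → search k (P? ∘ (i ∷_)))

least : {P : Pred ℕ 0ℓ} → Decidable P → ∀ k → P k → ∃[ l ] P l × (∀ j → P j → l ℕ.≤ j)
least P? ℕ.zero p = 0 , p , λ _ _ → z≤n
least {P} P? (ℕ.suc k) p with P? 0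
... | yes p₀ = 0 , p₀ , λ _ _ → z≤n
... | no ¬p₀ with least {P ∘ ℕ.suc} (P? ∘ ℕ.suc) k p
...   | l , q , min = ℕ.suc l , q , λ where
          ℕ.zero    p₀ → contradiction p₀ ¬p₀
          (ℕ.suc j) pⱼ → s≤s (min j pⱼ)

coxeterLength : (w : Permutation′ (ℕ.suc m)) → ∃ (IsCoxeterLength w)
coxeterLength w =
  let (k , h)           = word-exists w
      (l , h′ , l-min)  = least (hasWord? w) k h
  in  l , record { attained = h′ ; minimal = l-min }

ℓ : Permutation′ (ℕ.suc m) → ℕ
ℓ w = proj₁ (coxeterLength w)

data Tile : Set where
  downElbow upElbow crossing blank horizontal vertical : Tile

data Side : Set where
  left right top bottom : Side

meets : Tile → Side → Bool
meets downElbow  bottom = true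
meets downElbow  right  = true
meets downElbow  _      = false
meets upElbow    left   = true
meets upElbow    top    = true
meets upElbow    _      = false
meets crossing   _      = true
meets blank      _      = false
meets horizontal left   = true
meets horizontal right  = true
meets horizontal _      = false
meets vertical   bottom = true
meets vertical   top    = true
meets vertical   _      = false

-- Rows from top to bottom, each row from left to right.

Tiling : ℕ → Set
Tiling n = Vec (Vec Tile n) n

tile : Tiling n → Fin n → Fin n → Tile
tile P i j = lookup (lookup P i) j

record IsBPD {n : ℕ} (P : Tiling n) : Set where
  field
    horizontally-adjacent : ∀ i j j′ → toℕ j′ ≡ ℕ.suc (toℕ j) →
                            meets (tile P i j) right ≡ meets (tile P i j′) left
    vertically-adjacent   : ∀ i i′ j → toℕ i′ ≡ ℕ.suc (toℕ i) →
                            meets (tile P i j) bottom ≡ meets (tile P i′ j) top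
    bottom-boundary       : ∀ i j → ℕ.suc (toℕ i) ≡ n → meets (tile P i j) bottom ≡ true
    right-boundary        : ∀ i j → ℕ.suc (toℕ j) ≡ n → meets (tile P i j) right ≡ true
    left-boundary         : ∀ i j → toℕ j ≡ 0 → meets (tile P i j) left ≡ false
    top-boundary          : ∀ i j → toℕ i ≡ 0 → meets (tile P i j) top ≡ false

isBPD? : Decidable (IsBPD {n})
isBPD? P = map′
  (λ (a , b , c , d , e , f) → record
    { horizontally-adjacent = a ; vertically-adjacent = b ; bottom-boundary = c
    ; right-boundary = d ; left-boundary = e ; top-boundary = f })
  (λ B → let open IsBPD B in
    horizontally-adjacent , vertically-adjacent , bottom-boundary ,
    right-boundary , left-boundary , top-boundary)
  ((all? λ i → all? λ j → all? λ j′ → (_ ℕ.≟ _) →-dec (_ Bool.≟ _)) ×-dec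
   (all? λ i → all? λ i′ → all? λ j → (_ ℕ.≟ _) →-dec (_ Bool.≟ _)) ×-dec
   (all? λ i → all? λ j → (_ ℕ.≟ _) →-dec (_ Bool.≟ _)) ×-dec
   (all? λ i → all? λ j → (_ ℕ.≟ _) →-dec (_ Bool.≟ _)) ×-dec
   (all? λ i → all? λ j → (_ ℕ.≟ _) →-dec (_ Bool.≟ _)) ×-dec
   (all? λ i → all? λ j → (_ ℕ.≟ _) →-dec (_ Bool.≟ _)))

-- The label carried by an edge; nothing if no pipe meets the edge.

Label : Set
Label = Maybe ℕ

-- Labels entering from the left and from below ↦ labels leaving through
-- the right edge and through the top edge.  In a bumpless pipe dream both
-- labels entering a crossing are present.

propagate : Tile → Label → Label → Label × Label
propagate downElbow  l        b        = b , nothing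
propagate upElbow    l        b        = nothing , l
propagate crossing   (just l) (just b) = just (l ⊓ b) , just (l ⊔ b)
propagate crossing   _        _        = nothing , nothing
propagate blank      l        b        = nothing , nothing
propagate horizontal l        b        = l , nothing
propagate vertical   l        b        = nothing , b

-- Given the label on the left edge of a row and those on its bottom edges,
-- the label on its right edge and those on its top edges.

propagateRow : Vec Tile k → Label → Vec Label k → Label × Vec Label k
propagateRow []      l []       = l , []
propagateRow (t ∷ r) l (b ∷ bs) =
  let (l′ , b′)  = propagate t l b
      (l″ , bs′) = propagateRow r l′ bs
  in  l″ , b′ ∷ bs′

-- The labels on the right edges of the rows, and those on the top edges of
-- the first row, given the labels on the bottom edges of the last row.

propagateRows : Vec (Vec Tile n) k → Vec Label n → Vec Label k × Vec Label n
propagateRows []       bs = [] , bs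
propagateRows (r ∷ rs) bs =
  let (out , bs′) = propagateRows rs bs
      (l , bs″)   = propagateRow r nothing bs′
  in  l ∷ out , bs″

-- Labels are 0,…,n-1, in line with the indexing of Fin.

∂ : Tiling n → Fin n → Label
∂ P = lookup (proj₁ (propagateRows P (tabulate (just ∘ toℕ))))

record IsPipeDream (w : Permutation′ n) (P : Tiling n) : Set where
  field
    isBPD    : IsBPD P
    demazure : ∀ i → ∂ P i ≡ just (toℕ (w ⟨$⟩ʳ i))

isPipeDream? : (w : Permutation′ n) → Decidable (IsPipeDream w)
isPipeDream? w P = map′
  (λ (b , d) → record { isBPD = b ; demazure = d })
  (λ p → IsPipeDream.isBPD p , IsPipeDream.demazure p)
  (isBPD? P ×-dec all? (λ i → Maybe.≡-dec ℕ._≟_ _ _))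

-- Sets of positions; (i , j) is encoded as combine i j.

Positions : ℕ → Set
Positions n = Subset (n ℕ.* n)

positionsOf : (Tile → Bool) → Tiling n → Positions n
positionsOf {n} p P = tabulate λ c → p (uncurry (tile P) (remQuot n c))

isBlank isUpElbow : Tile → Bool
isBlank blank     = true
isBlank _         = false
isUpElbow upElbow = true
isUpElbow _       = false

D U : Tiling n → Positions n
D = positionsOf isBlank
U = positionsOf isUpElbow

elements : Positions n → List (Fin n × Fin n)
elements {n} A = map (remQuot n) (filter (_∈? A) (allFin (n ℕ.* n)))

record IsMarkedBPD (w : Permutation′ n) (PS : Tiling n × Positions n) : Set where
  field
    pipeDream : IsPipeDream w (proj₁ PS)
    marking   : proj₂ PS ⊆ U (proj₁ PS)

isMarkedBPD? : (w : Permutation′ n) → Decidable (IsMarkedBPD w)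
isMarkedBPD? w (P , S) with isPipeDream? w P | S ⊆? U P
... | yes p | yes m = yes (record { pipeDream = p ; marking = m })
... | no ¬p | _     = no (¬p ∘ IsMarkedBPD.pipeDream)
... | _     | no ¬m = no λ q → ¬m (IsMarkedBPD.marking q)

vectors : {A : Set} → List A → (k : ℕ) → List (Vec A k)
vectors as ℕ.zero    = [] ∷ []
vectors as (ℕ.suc k) = cartesianProductWith _∷_ as (vectors as k)

tiles : List Tile
tiles = downElbow ∷ upElbow ∷ crossing ∷ blank ∷ horizontal ∷ vertical ∷ []

MPipes : Permutation′ n → List (Tiling n × Positions n)
MPipes {n} w = filter (isMarkedBPD? w)
  (cartesianProduct (vectors (vectors tiles n) n)
                    (vectors (inside ∷ outside ∷ []) (n ℕ.* n)))

-- MPipes w lists every marked bumpless pipe dream for w exactly once.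

∈-vectors : {A : Set} {as : List A} → (∀ a → a ∈ as) → (v : Vec A k) → v ∈ vectors as k
∈-vectors h []      = here refl
∈-vectors h (a ∷ v) = ∈-cartesianProductWith⁺ _∷_ (h a) (∈-vectors h v)

∈-tiles : ∀ t → t ∈ tiles
∈-tiles downElbow  = here refl
∈-tiles upElbow    = there (here refl)
∈-tiles crossing   = there (there (here refl))
∈-tiles blank      = there (there (there (here refl)))
∈-tiles horizontal = there (there (there (there (here refl))))
∈-tiles vertical   = there (there (there (there (there (here refl)))))

∈-sides : ∀ b → b ∈ inside ∷ outside ∷ []
∈-sides true  = here refl
∈-sides false = there (here refl)

MPipes-complete : (w : Permutation′ n) {PS : Tiling n × Positions n} →
                  IsMarkedBPD w PS → PS ∈ MPipes w
MPipes-complete w = ∈-filter⁺ (isMarkedBPD? w)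
  (∈-cartesianProduct⁺ (∈-vectors (∈-vectors ∈-tiles) _) (∈-vectors ∈-sides _))

MPipes-sound : (w : Permutation′ n) {PS : Tiling n × Positions n} →
               PS ∈ MPipes w → IsMarkedBPD w PS
MPipes-sound {n} w p = proj₂ (∈-filter⁻ (isMarkedBPD? w)
  {xs = cartesianProduct (vectors (vectors tiles n) n)
                         (vectors (inside ∷ outside ∷ []) (n ℕ.* n))} p)

vectors-unique : {A : Set} {as : List A} → Unique as → ∀ k → Unique (vectors as k)
vectors-unique u ℕ.zero    = [] ∷ []
vectors-unique u (ℕ.suc k) = cartesianProductWith⁺ _∷_ ∷-injective u (vectors-unique u k)

MPipes-unique : (w : Permutation′ n) → Unique (MPipes w)
MPipes-unique {n} w = filter⁺ (isMarkedBPD? w) (cartesianProduct⁺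
  (vectors-unique (vectors-unique tiles-unique n) n)
  (vectors-unique sides-unique (n ℕ.* n)))
  where
  tiles-unique : Unique tiles
  tiles-unique =
    ((λ ()) ∷ (λ ()) ∷ (λ ()) ∷ (λ ()) ∷ (λ ()) ∷ []) ∷
    ((λ ()) ∷ (λ ()) ∷ (λ ()) ∷ (λ ()) ∷ []) ∷
    ((λ ()) ∷ (λ ()) ∷ (λ ()) ∷ []) ∷
    ((λ ()) ∷ (λ ()) ∷ []) ∷
    ((λ ()) ∷ []) ∷
    [] ∷ []

  sides-unique : Unique (inside ∷ outside ∷ [])
  sides-unique = ((λ ()) ∷ []) ∷ [] ∷ []

{-# OPTIONS --safe #-}

-- Weight a bumpless pipe dream by β (xᵢ ⊕ yⱼ) at each blank tile and by
-- 1 + β (xᵢ ⊕ yⱼ) at each upward elbow.  The sum Z_w of these weights over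
-- Pipes(w) is β^ℓ(w) times the right-hand side of the theorem, because a
-- pipe dream for w has as many blanks as crossings, hence at least ℓ(w).
-- Z_w is the partition function of a coloured lattice model that satisfies
-- a Yang–Baxter equation, and exchanging the spectral parameters xᵢ and xᵢ₊₁
-- of two adjacent rows gives, for wᵢ > wᵢ₊₁,
--   (1+βxᵢ) sᵢZ_w = (1+βxᵢ₊₁) Z_w + β (xᵢ₊₁ - xᵢ) Z_{wsᵢ},
-- that is, β Z_{wsᵢ} = πᵢ Z_w.  For w₀ there is a single pipe dream, so
-- Z_w = β^ℓ(w) 𝔊_w for all w by descending induction, and β can be cancelled.

module Submission where

open import Algebra.Bundles using (CommutativeRing; Monoid)
import Algebra.Properties.Monoid.Sum as MonoidSum
import Algebra.Solver.Ring.NaturalCoefficients.Default as RingSolver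
open import Data.Bool.Base using (Bool; true; false; if_then_else_)
import Data.Bool.Properties as Bool
open import Data.Fin.Base as Fin
  using (Fin; zero; suc; toℕ; inject₁; remQuot; opposite; _↑ˡ_; _↑ʳ_)
open import Data.Fin.Permutation using (Permutation′)
open import Data.Fin.Permutation as Perm using (_⟨$⟩ʳ_; _∘ₚ_; reverse)
import Data.Fin.Properties as Fin
open import Data.Fin.Subset using (_∪_; ∣_∣)
open import Data.Fin.Subset using (Subset; inside; outside)
open import Data.Fin.Subset.Properties using (_⊆?_; _∈?_)
open import Data.List.Base as List
  using (List; []; _∷_; _++_; map; filter; allFin; cartesianProduct; cartesianProductWith)
import Data.List.Properties as List
open import Data.Maybe.Base using (just; nothing; is-just)
open import Data.Nat.Base as ℕ using (ℕ; _∸_)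
open import Data.Nat.Base using (zero; suc; _⊓_; _⊔_; _≤_; z≤n; s≤s)
import Data.Nat.Properties as ℕ
import Data.Nat.Solver as ℕSolver
open import Data.Product.Base using (_,_)
open import Data.Product.Base as Product using (_×_; proj₁; proj₂; uncurry; ∃)
open import Data.Sum.Base using (_⊎_; inj₁; inj₂)
open import Data.Unit.Base using (⊤; tt)
open import Data.Vec.Base as Vec using (Vec; []; _∷_; lookup; tabulate; toList)
import Data.Vec.Properties as Vec
open import Function.Base using (_∘_)
open import Relation.Binary.PropositionalEquality as ≡
  using (_≡_; _≢_; refl; sym; trans; cong; cong₂; subst)
import Relation.Binary.Reasoning.Setoid as SetoidReasoning
open import Relation.Nullary.Decidable
  using (Dec; does; yes; no; dec-true; dec-false; _×-dec_)
open import Relation.Nullary.Negation using (¬_; contradiction)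
open import Relation.Unary using (Decidable)
open import Defs

-- Cancellation of β

-- The factor 1 + β (xᵢ ⊕ yⱼ) of an upward elbow is the sum over its two markings. The lattice sum
-- is handled not as a list of tilings but as nested operators applied to an arbitrary function of
-- the outgoing labels; this makes the Yang-Baxter equation a comparison in one column. The R-matrix
-- enters at the left boundary, where both rows are vacant and it is the scalar 1 + βxᵢ. It leaves
-- at the right boundary, where it partly sorts the two output labels, larger one on top. Here the
-- descent matters: a sorted pair equals (wᵢ, wᵢ₊₁) if and only if the unsorted pair is (wᵢ, wᵢ₊₁)
-- or (wᵢ₊₁, wᵢ), which is why just two partition functions appear. The min/max rule at crossings is
-- what makes the states with three pipes agree. The two spectral parameters are written p and p +
-- e, so that the local identities have natural coefficients. Cancelling β, like cancelling xᵢ -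
-- xᵢ₊₁, needs a proof that the presented ring has no such torsion; a quotient map defined on terms
-- and compatible with `_≈_` provides it.

at-β≡0 : ∀ {n} → Poly n → Poly n
at-β≡0 β       = 0#
at-β≡0 (x i)   = x i
at-β≡0 (y j)   = y j
at-β≡0 0#      = 0#
at-β≡0 1#      = 1#
at-β≡0 (p + q) = at-β≡0 p + at-β≡0 q
at-β≡0 (p * q) = at-β≡0 p * at-β≡0 q
at-β≡0 (- p)   = - at-β≡0 p

at-β≡0-cong : ∀ {n} {p q : Poly n} → p ≈ q → at-β≡0 p ≈ at-β≡0 q
at-β≡0-cong ≈-refl           = ≈-refl
at-β≡0-cong (≈-sym e)        = ≈-sym (at-β≡0-cong e)
at-β≡0-cong (≈-trans e e′)   = ≈-trans (at-β≡0-cong e) (at-β≡0-cong e′)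
at-β≡0-cong (+-cong e e′)    = +-cong (at-β≡0-cong e) (at-β≡0-cong e′)
at-β≡0-cong (*-cong e e′)    = *-cong (at-β≡0-cong e) (at-β≡0-cong e′)
at-β≡0-cong (-‿cong e)       = -‿cong (at-β≡0-cong e)
at-β≡0-cong (+-assoc _ _ _)  = +-assoc _ _ _
at-β≡0-cong (+-comm _ _)     = +-comm _ _
at-β≡0-cong (+-identityˡ _)  = +-identityˡ _
at-β≡0-cong (-‿inverseˡ _)   = -‿inverseˡ _
at-β≡0-cong (*-assoc _ _ _)  = *-assoc _ _ _
at-β≡0-cong (*-comm _ _)     = *-comm _ _
at-β≡0-cong (*-identityˡ _)  = *-identityˡ _
at-β≡0-cong (distribˡ _ _ _) = distribˡ _ _ _

-- Division by β with remainder `at-β≡0`, carried out on terms. The product clause comes from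
-- expanding the first factor as β q + r, then the second: a Leibniz rule twisted by `at-β≡0`.
quot-β : ∀ {n} → Poly n → Poly n
quot-β β       = 1#
quot-β (x i)   = 0#
quot-β (y j)   = 0#
quot-β 0#      = 0#
quot-β 1#      = 0#
quot-β (p + q) = quot-β p + quot-β q
quot-β (p * q) = quot-β p * q + at-β≡0 p * quot-β q
quot-β (- p)   = - quot-β p

module _ {n : ℕ} where

  private
    module R = CommutativeRing (polyRing n)
    open RingSolver R.commutativeSemiring
    open SetoidReasoning R.setoid
    open import Algebra.Properties.Ring R.ring using (-‿distribʳ-*; -‿+-comm)

    q r : Poly n → Poly n
    q = quot-β
    r = at-β≡0

    constant : (p : Poly n) → β * 0# + p ≈ p
    constant p = solve 2 (λ b p → b :* con 0 :+ p := p) ≈-refl β p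

  β-division : (p : Poly n) → β * quot-β p + at-β≡0 p ≈ p
  β-division β       = solve 1 (λ b → b :* con 1 :+ con 0 := b) ≈-refl β
  β-division (x i)   = constant (x i)
  β-division (y j)   = constant (y j)
  β-division 0#      = constant 0#
  β-division 1#      = constant 1#
  β-division (f + g) = begin
    β * (q f + q g) + (r f + r g)
      ≈⟨ solve 5 (λ d f f′ g g′ → d :* (f :+ g) :+ (f′ :+ g′)
                               := (d :* f :+ f′) :+ (d :* g :+ g′))
               ≈-refl β (q f) (r f) (q g) (r g) ⟩
    (β * q f + r f) + (β * q g + r g)
      ≈⟨ +-cong (β-division f) (β-division g) ⟩
    f + g ∎
  β-division (f * g) = begin
    β * (q f * g + r f * q g) + r f * r g
      ≈⟨ solve 6 (λ d f f′ g g₁ g′ → d :* (f :* g :+ f′ :* g₁) :+ f′ :* g′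
                               := d :* f :* g :+ f′ :* (d :* g₁ :+ g′))
               ≈-refl β (q f) (r f) g (q g) (r g) ⟩
    β * q f * g + r f * (β * q g + r g)
      ≈⟨ +-cong ≈-refl (*-cong ≈-refl (β-division g)) ⟩
    β * q f * g + r f * g
      ≈⟨ R.distribʳ _ _ _ ⟨
    (β * q f + r f) * g
      ≈⟨ *-cong (β-division f) ≈-refl ⟩
    f * g ∎
  β-division (- f)   = begin
    β * - q f + - r f        ≈⟨ +-cong (-‿distribʳ-* β (q f)) ≈-refl ⟨
    - (β * q f) + - r f      ≈⟨ -‿+-comm _ _ ⟩
    - (β * q f + r f)        ≈⟨ -‿cong (β-division f) ⟩
    - f                      ∎

  quot-β-cong : {f g : Poly n} → f ≈ g → quot-β f ≈ quot-β g
  quot-β-cong ≈-refl           = ≈-refl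
  quot-β-cong (≈-sym e)        = ≈-sym (quot-β-cong e)
  quot-β-cong (≈-trans e e′)   = ≈-trans (quot-β-cong e) (quot-β-cong e′)
  quot-β-cong (+-cong e e′)    = +-cong (quot-β-cong e) (quot-β-cong e′)
  quot-β-cong (*-cong e e′)    =
    +-cong (*-cong (quot-β-cong e) e′) (*-cong (at-β≡0-cong e) (quot-β-cong e′))
  quot-β-cong (-‿cong e)       = -‿cong (quot-β-cong e)
  quot-β-cong (+-assoc _ _ _)  = +-assoc _ _ _
  quot-β-cong (+-comm _ _)     = +-comm _ _
  quot-β-cong (+-identityˡ _)  = +-identityˡ _
  quot-β-cong (-‿inverseˡ _)   = -‿inverseˡ _
  quot-β-cong (*-assoc f g h)  =
    solve 7 (λ f f′ g g′ g₁ h h₁ →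
               (f :* g :+ f′ :* g₁) :* h :+ (f′ :* g′) :* h₁
            := f :* (g :* h) :+ f′ :* (g₁ :* h :+ g′ :* h₁))
      ≈-refl (q f) (r f) g (r g) (q g) h (q h)
  -- The product clause is asymmetric; expanding the untouched factor into quotient and remainder
  -- makes it symmetric.
  quot-β-cong (*-comm f g)     = begin
    q f * g + r f * q g
      ≈⟨ +-cong (*-cong ≈-refl (β-division g)) ≈-refl ⟨
    q f * (β * q g + r g) + r f * q g
      ≈⟨ solve 5 (λ d f f′ g g′ → f :* (d :* g :+ g′) :+ f′ :* g
                               := g :* (d :* f :+ f′) :+ g′ :* f)
               ≈-refl β (q f) (r f) (q g) (r g) ⟩
    q g * (β * q f + r f) + r g * q f
      ≈⟨ +-cong (*-cong ≈-refl (β-division f)) ≈-refl ⟩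
    q g * f + r g * q f ∎
  quot-β-cong (*-identityˡ f)  =
    solve 2 (λ f g → con 0 :* f :+ con 1 :* g := g) ≈-refl f (q f)
  quot-β-cong (distribˡ f g h) =
    solve 6 (λ f f′ g g₁ h h₁ →
               f :* (g :+ h) :+ f′ :* (g₁ :+ h₁)
            := (f :* g :+ f′ :* g₁) :+ (f :* h :+ f′ :* h₁))
      ≈-refl (q f) (r f) g (q g) h (q h)

  -- `quot-β` undoes multiplication by β and respects `_≈_`, so this multiplication is injective.
  β-cancel : {f g : Poly n} → β * f ≈ β * g → f ≈ g
  β-cancel {f} {g} e = ≈-trans (≈-sym (exact f)) (≈-trans (quot-β-cong e) (exact g))
    where
    exact : ∀ f → quot-β (β * f) ≈ f
    exact f = solve 2 (λ f g → con 1 :* f :+ con 0 :* g := f) ≈-refl f (q f)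

  β^-cancel : ∀ k {f g : Poly n} → β ^ k * f ≈ β ^ k * g → f ≈ g
  β^-cancel zero    e = ≈-trans (≈-sym (*-identityˡ _)) (≈-trans e (*-identityˡ _))
  β^-cancel (suc k) e = β^-cancel k
    (β-cancel (≈-trans (≈-sym (*-assoc _ _ _)) (≈-trans e (*-assoc _ _ _))))

-- Sums and products over lists

module _ {n : ℕ} where

  private
    module R = CommutativeRing (polyRing n)
    open RingSolver R.commutativeSemiring

  ∑-cong : {A : Set} (as : List A) {f g : A → Poly n} → (∀ a → f a ≈ g a) → ∑ as f ≈ ∑ as g
  ∑-cong []       h = ≈-refl
  ∑-cong (a ∷ as) h = +-cong (h a) (∑-cong as h)

  ∏-cong : {A : Set} (as : List A) {f g : A → Poly n} → (∀ a → f a ≈ g a) → ∏ as f ≈ ∏ as g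
  ∏-cong []       h = ≈-refl
  ∏-cong (a ∷ as) h = *-cong (h a) (∏-cong as h)

  ∑-++ : {A : Set} (as bs : List A) (f : A → Poly n) → ∑ (as ++ bs) f ≈ ∑ as f + ∑ bs f
  ∑-++ []       bs f = ≈-sym (+-identityˡ _)
  ∑-++ (a ∷ as) bs f = ≈-trans (+-cong ≈-refl (∑-++ as bs f)) (≈-sym (+-assoc _ _ _))

  ∏-++ : {A : Set} (as bs : List A) (f : A → Poly n) → ∏ (as ++ bs) f ≈ ∏ as f * ∏ bs f
  ∏-++ []       bs f = ≈-sym (*-identityˡ _)
  ∏-++ (a ∷ as) bs f = ≈-trans (*-cong ≈-refl (∏-++ as bs f)) (≈-sym (*-assoc _ _ _))

  ∑-map : {A B : Set} (h : A → B) (as : List A) (f : B → Poly n) → ∑ (map h as) f ≡ ∑ as (f ∘ h)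
  ∑-map h []       f = refl
  ∑-map h (a ∷ as) f = cong (f (h a) +_) (∑-map h as f)

  ∏-map : {A B : Set} (h : A → B) (as : List A) (f : B → Poly n) → ∏ (map h as) f ≡ ∏ as (f ∘ h)
  ∏-map h []       f = refl
  ∏-map h (a ∷ as) f = cong (f (h a) *_) (∏-map h as f)

  ∑-*ˡ : {A : Set} (c : Poly n) (as : List A) (f : A → Poly n) →
         c * ∑ as f ≈ ∑ as (λ a → c * f a)
  ∑-*ˡ c []       f = R.zeroʳ c
  ∑-*ˡ c (a ∷ as) f = ≈-trans (distribˡ _ _ _) (+-cong ≈-refl (∑-*ˡ c as f))

  ∑-+ : {A : Set} (as : List A) (f g : A → Poly n) →
        ∑ as (λ a → f a + g a) ≈ ∑ as f + ∑ as g
  ∑-+ []       f g = ≈-sym (+-identityˡ _)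
  ∑-+ (a ∷ as) f g = ≈-trans (+-cong ≈-refl (∑-+ as f g))
    (solve 4 (λ a b c d → (a :+ b) :+ (c :+ d) := (a :+ c) :+ (b :+ d)) ≈-refl
       (f a) (g a) (∑ as f) (∑ as g))

  ∑-0 : {A : Set} (as : List A) → ∑ as (λ _ → 0#) ≈ 0# {n}
  ∑-0 []       = ≈-refl
  ∑-0 (a ∷ as) = ≈-trans (+-identityˡ _) (∑-0 as)

  ∑-swap : {A B : Set} (as : List A) (bs : List B) (f : A → B → Poly n) →
           ∑ as (λ a → ∑ bs (f a)) ≈ ∑ bs (λ b → ∑ as (λ a → f a b))
  ∑-swap []       bs f = ≈-sym (∑-0 bs)
  ∑-swap (a ∷ as) bs f = ≈-trans (+-cong ≈-refl (∑-swap as bs f)) (≈-sym (∑-+ bs (f a) _))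

  ∑-cartesianProductWith : {A B C : Set} (h : A → B → C) (as : List A) (bs : List B)
    (f : C → Poly n) →
    ∑ (cartesianProductWith h as bs) f ≈ ∑ as (λ a → ∑ bs (λ b → f (h a b)))
  ∑-cartesianProductWith h []       bs f = ≈-refl
  ∑-cartesianProductWith h (a ∷ as) bs f = ≈-trans (∑-++ (map (h a) bs) _ f)
    (+-cong (R.reflexive (∑-map (h a) bs f)) (∑-cartesianProductWith h as bs f))

  ∏-cartesianProduct : {A B : Set} (as : List A) (bs : List B) (f : A × B → Poly n) →
    ∏ (cartesianProduct as bs) f ≈ ∏ as (λ a → ∏ bs (λ b → f (a , b)))
  ∏-cartesianProduct []       bs f = ≈-refl
  ∏-cartesianProduct (a ∷ as) bs f = ≈-trans (∏-++ (map (a ,_) bs) _ f)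
    (*-cong (R.reflexive (∏-map (a ,_) bs f)) (∏-cartesianProduct as bs f))

  ∑-filter : {A : Set} {P : A → Set} (P? : Decidable P) (as : List A) (f : A → Poly n) →
             ∑ (filter P? as) f ≈ ∑ as (λ a → if does (P? a) then f a else 0#)
  ∑-filter P? []       f = ≈-refl
  ∑-filter P? (a ∷ as) f with does (P? a)
  ... | true  = +-cong ≈-refl (∑-filter P? as f)
  ... | false = ≈-trans (∑-filter P? as f) (≈-sym (+-identityˡ _))

  ∏-filter : {A : Set} {P : A → Set} (P? : Decidable P) (as : List A) (f : A → Poly n) →
             ∏ (filter P? as) f ≈ ∏ as (λ a → if does (P? a) then f a else 1#)
  ∏-filter P? []       f = ≈-refl
  ∏-filter P? (a ∷ as) f with does (P? a)
  ... | true  = *-cong ≈-refl (∏-filter P? as f)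
  ... | false = ≈-trans (∏-filter P? as f) (≈-sym (*-identityˡ _))

-- The coloured lattice model

private
  -- The labels of three crossing pipes in the Yang–Baxter equation.
  lower-entry : ∀ a b c → (a ⊓ (b ⊔ c)) ⊓ (b ⊓ c) ≡ (a ⊓ b) ⊓ c
  lower-entry a b c = ≡.trans (ℕ.⊓-assoc a (b ⊔ c) (b ⊓ c))
    (≡.trans (cong (a ⊓_) (ℕ.m≥n⇒m⊓n≡n (ℕ.m⊓n≤m⊔n b c))) (≡.sym (ℕ.⊓-assoc a b c)))

  -- Both sides are the median of a, b and c.
  upper-entry : ∀ a b c → (a ⊓ (b ⊔ c)) ⊔ (b ⊓ c) ≡ (a ⊔ b) ⊓ ((a ⊓ b) ⊔ c)
  upper-entry a b c = ≡.sym (begin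
    (a ⊔ b) ⊓ ((a ⊓ b) ⊔ c)                ≡⟨ ℕ.⊓-distribˡ-⊔ (a ⊔ b) (a ⊓ b) c ⟩
    ((a ⊔ b) ⊓ (a ⊓ b)) ⊔ ((a ⊔ b) ⊓ c)    ≡⟨ cong₂ _⊔_ (ℕ.m≥n⇒m⊓n≡n (ℕ.m⊓n≤m⊔n a b))
                                                        (ℕ.⊓-distribʳ-⊔ c a b) ⟩
    (a ⊓ b) ⊔ ((a ⊓ c) ⊔ (b ⊓ c))          ≡⟨ ℕ.⊔-assoc (a ⊓ b) _ _ ⟨
    ((a ⊓ b) ⊔ (a ⊓ c)) ⊔ (b ⊓ c)          ≡⟨ cong (_⊔ (b ⊓ c)) (ℕ.⊓-distribˡ-⊔ a b c) ⟨
    (a ⊓ (b ⊔ c)) ⊔ (b ⊓ c)                ∎)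
    where open ≡.≡-Reasoning

  top-entry : ∀ a b c → (a ⊔ b) ⊔ ((a ⊓ b) ⊔ c) ≡ a ⊔ (b ⊔ c)
  top-entry a b c = ≡.trans (≡.sym (ℕ.⊔-assoc (a ⊔ b) (a ⊓ b) c))
    (≡.trans (cong (_⊔ c) (ℕ.m≥n⇒m⊔n≡m (ℕ.m⊓n≤m⊔n a b))) (ℕ.⊔-assoc a b c))

s-suc : ∀ {m} (i : Fin m) k → s (suc i) ⟨$⟩ʳ suc k ≡ suc (s i ⟨$⟩ʳ k)
s-suc i k with does (k Fin.≟ inject₁ i)
... | true  = refl
... | false with does (k Fin.≟ suc i)
...   | true  = refl
...   | false = refl

module _ {n : ℕ} where

  private
    module R = CommutativeRing (polyRing n)
    open RingSolver R.commutativeSemiring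

  -- With p = β xᵢ and q = β yⱼ this is β (xᵢ ⊕ yⱼ).
  blankWeight : Poly n → Poly n → Poly n
  blankWeight p q = p + q + p * q

  -- The transfer matrices are written in continuation passing style: φ is
  -- a function of the outgoing labels (right before top), and the result
  -- is the weighted sum of φ over all admissible fillings.
  cell : Poly n → Poly n → Label → Label → (Label → Label → Poly n) → Poly n
  cell p q nothing  nothing  φ = blankWeight p q * φ nothing nothing
  cell p q nothing  (just b) φ = φ (just b) nothing + φ nothing (just b)
  cell p q (just a) nothing  φ =
    φ (just a) nothing + (1# + blankWeight p q) * φ nothing (just a)
  cell p q (just a) (just b) φ = φ (just (a ⊓ b)) (just (a ⊔ b))

  row : ∀ {k} → Poly n → (Fin k → Poly n) → Label → Vec Label k →
        (Label → Vec Label k → Poly n) → Poly n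
  row p q l []       φ = φ l []
  row p q l (b ∷ bs) φ = cell p (q zero) l b λ r t →
    row p (q ∘ suc) r bs λ r′ ts → φ r′ (t ∷ ts)

  rows : ∀ {k m} → (Fin k → Poly n) → (Fin m → Poly n) → Vec Label m →
         (Vec Label k → Vec Label m → Poly n) → Poly n
  rows {zero}  p q bs φ = φ [] bs
  rows {suc k} p q bs φ = rows (p ∘ suc) q bs λ out ts →
    row (p zero) q nothing ts λ r ts′ → φ (r ∷ out) ts′

  -- Congruence and linearity of the transfer operators

  blankWeight-cong : ∀ {p p′ q q′} → p ≈ p′ → q ≈ q′ → blankWeight p q ≈ blankWeight p′ q′
  blankWeight-cong e e′ = +-cong (+-cong e e′) (*-cong e e′)

  cell-cong : ∀ {p p′ q q′} → p ≈ p′ → q ≈ q′ → ∀ l b {φ ψ} →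
              (∀ r t → φ r t ≈ ψ r t) → cell p q l b φ ≈ cell p′ q′ l b ψ
  cell-cong e e′ nothing  nothing  h = *-cong (blankWeight-cong e e′) (h _ _)
  cell-cong e e′ nothing  (just b) h = +-cong (h _ _) (h _ _)
  cell-cong e e′ (just a) nothing  h =
    +-cong (h _ _) (*-cong (+-cong ≈-refl (blankWeight-cong e e′)) (h _ _))
  cell-cong e e′ (just a) (just b) h = h _ _

  row-cong : ∀ {k} {p p′} {q q′ : Fin k → Poly n} → p ≈ p′ → (∀ j → q j ≈ q′ j) →
             ∀ l bs {φ ψ} → (∀ r ts → φ r ts ≈ ψ r ts) → row p q l bs φ ≈ row p′ q′ l bs ψ
  row-cong e e′ l []       h = h _ _
  row-cong e e′ l (b ∷ bs) h = cell-cong e (e′ zero) l b λ r t →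
    row-cong e (e′ ∘ suc) r bs λ r′ ts → h r′ (t ∷ ts)

  rows-cong : ∀ {k m} {p p′ : Fin k → Poly n} (q : Fin m → Poly n) → (∀ i → p i ≈ p′ i) →
              ∀ bs {φ ψ} → (∀ out ts → φ out ts ≈ ψ out ts) → rows p q bs φ ≈ rows p′ q bs ψ
  rows-cong {zero}  q e bs h = h _ _
  rows-cong {suc k} q e bs h = rows-cong q (e ∘ suc) bs λ out ts →
    row-cong (e zero) (λ _ → ≈-refl) nothing ts λ r ts′ → h (r ∷ out) ts′

  cell-+ : ∀ p q l b φ ψ → cell p q l b (λ r t → φ r t + ψ r t) ≈ cell p q l b φ + cell p q l b ψ
  cell-+ p q nothing  nothing  φ ψ = distribˡ _ _ _
  cell-+ p q nothing  (just b) φ ψ =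
    solve 4 (λ a b c d → (a :+ b) :+ (c :+ d) := (a :+ c) :+ (b :+ d)) ≈-refl _ _ _ _
  cell-+ p q (just a) nothing  φ ψ =
    solve 5 (λ w a b c d → (a :+ b) :+ w :* (c :+ d) := (a :+ w :* c) :+ (b :+ w :* d))
      ≈-refl (1# + blankWeight p q) _ _ _ _
  cell-+ p q (just a) (just b) φ ψ = ≈-refl

  cell-* : ∀ p q l b c φ → cell p q l b (λ r t → c * φ r t) ≈ c * cell p q l b φ
  cell-* p q nothing  nothing  c φ =
    solve 3 (λ w c a → w :* (c :* a) := c :* (w :* a)) ≈-refl (blankWeight p q) c _
  cell-* p q nothing  (just b) c φ = ≈-sym (distribˡ _ _ _)
  cell-* p q (just a) nothing  c φ =
    solve 4 (λ w c a b → c :* a :+ w :* (c :* b) := c :* (a :+ w :* b))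
      ≈-refl (1# + blankWeight p q) c _ _
  cell-* p q (just a) (just b) c φ = ≈-refl

  row-+ : ∀ {k} p (q : Fin k → Poly n) l bs φ ψ →
          row p q l bs (λ r ts → φ r ts + ψ r ts) ≈ row p q l bs φ + row p q l bs ψ
  row-+ p q l []       φ ψ = ≈-refl
  row-+ p q l (b ∷ bs) φ ψ = ≈-trans
    (cell-cong ≈-refl ≈-refl l b λ r t → row-+ p (q ∘ suc) r bs _ _)
    (cell-+ p (q zero) l b _ _)

  row-* : ∀ {k} p (q : Fin k → Poly n) l bs c φ →
          row p q l bs (λ r ts → c * φ r ts) ≈ c * row p q l bs φ
  row-* p q l []       c φ = ≈-refl
  row-* p q l (b ∷ bs) c φ = ≈-trans
    (cell-cong ≈-refl ≈-refl l b λ r t → row-* p (q ∘ suc) r bs c _)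
    (cell-* p (q zero) l b c _)

  rows-+ : ∀ {k m} (p : Fin k → Poly n) (q : Fin m → Poly n) bs φ ψ →
           rows p q bs (λ out ts → φ out ts + ψ out ts) ≈ rows p q bs φ + rows p q bs ψ
  rows-+ {zero}  p q bs φ ψ = ≈-refl
  rows-+ {suc k} p q bs φ ψ = ≈-trans
    (rows-cong {p = p ∘ suc} q (λ _ → ≈-refl) bs λ out ts → row-+ (p zero) q nothing ts _ _)
    (rows-+ (p ∘ suc) q bs _ _)

  rows-* : ∀ {k m} (p : Fin k → Poly n) (q : Fin m → Poly n) bs c φ →
           rows p q bs (λ out ts → c * φ out ts) ≈ c * rows p q bs φ
  rows-* {zero}  p q bs c φ = ≈-refl
  rows-* {suc k} p q bs c φ = ≈-trans
    (rows-cong {p = p ∘ suc} q (λ _ → ≈-refl) bs λ out ts → row-* (p zero) q nothing ts c _)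
    (rows-* (p ∘ suc) q bs c _)

  -- By linearity of `row`. In `row-row` it moves the upper cell of a column in front of the lower
  -- cells further right, so that two rows can be evaluated column by column, the order in which an
  -- R-matrix can pass.
  row-cell-swap : ∀ {k} p (q : Fin k → Poly n) l bs p′ q′ l′ b
    (φ : Label → Vec Label k → Label → Label → Poly n) →
    row p q l bs (λ r ts → cell p′ q′ l′ b (φ r ts)) ≈
    cell p′ q′ l′ b (λ r′ t → row p q l bs (λ r ts → φ r ts r′ t))
  row-cell-swap p q l bs p′ q′ nothing  nothing  φ = row-* p q l bs _ _
  row-cell-swap p q l bs p′ q′ nothing  (just b) φ = row-+ p q l bs _ _
  row-cell-swap p q l bs p′ q′ (just a) nothing  φ =
    ≈-trans (row-+ p q l bs _ _) (+-cong ≈-refl (row-* p q l bs _ _))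
  row-cell-swap p q l bs p′ q′ (just a) (just b) φ = ≈-refl

  -- The first parameter and the first label belong to the upper row.
  cell₂ : Poly n → Poly n → Poly n → Label → Label → Label →
          (Label → Label → Label → Poly n) → Poly n
  cell₂ p₁ p₂ q l₁ l₂ b φ =
    cell p₂ q l₂ b λ r₂ t → cell p₁ q l₁ t λ r₁ t′ → φ r₁ r₂ t′

  row₂ : ∀ {k} → Poly n → Poly n → (Fin k → Poly n) → Label → Label → Vec Label k →
         (Label → Label → Vec Label k → Poly n) → Poly n
  row₂ p₁ p₂ q l₁ l₂ []       φ = φ l₁ l₂ []
  row₂ p₁ p₂ q l₁ l₂ (b ∷ bs) φ = cell₂ p₁ p₂ (q zero) l₁ l₂ b λ r₁ r₂ t →
    row₂ p₁ p₂ (q ∘ suc) r₁ r₂ bs λ r₁′ r₂′ ts → φ r₁′ r₂′ (t ∷ ts)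

  row-row : ∀ {k} p₁ p₂ (q : Fin k → Poly n) l₁ l₂ bs φ →
    row p₂ q l₂ bs (λ r₂ ts → row p₁ q l₁ ts (λ r₁ ts′ → φ r₁ r₂ ts′)) ≈
    row₂ p₁ p₂ q l₁ l₂ bs φ
  row-row p₁ p₂ q l₁ l₂ []       φ = ≈-refl
  row-row p₁ p₂ q l₁ l₂ (b ∷ bs) φ = cell-cong ≈-refl ≈-refl l₂ b λ r₂ t →
    ≈-trans (row-cell-swap p₂ (q ∘ suc) r₂ bs p₁ (q zero) l₁ t _)
      (cell-cong ≈-refl ≈-refl l₁ t λ r₁ t′ → row-row p₁ p₂ (q ∘ suc) r₁ r₂ bs _)

  -- The R-matrix and the Yang-Baxter equation

  -- The R-matrix for a pair of rows with parameters p and p + e.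
  exchange : Poly n → Poly n → Label → Label → (Label → Label → Poly n) → Poly n
  exchange p e nothing  nothing  φ = (1# + p) * φ nothing nothing
  exchange p e nothing  (just b) φ = (1# + (p + e)) * φ nothing (just b)
  exchange p e (just a) nothing  φ =
    (1# + p) * φ (just a) nothing + e * φ nothing (just a)
  exchange p e (just a) (just b) φ =
    (1# + p) * φ (just a) (just b) + e * φ (just (a ⊔ b)) (just (a ⊓ b))

  exchange-cong : ∀ p e l₁ l₂ {φ ψ} → (∀ r₁ r₂ → φ r₁ r₂ ≈ ψ r₁ r₂) →
                  exchange p e l₁ l₂ φ ≈ exchange p e l₁ l₂ ψ
  exchange-cong p e nothing  nothing  h = *-cong ≈-refl (h _ _)
  exchange-cong p e nothing  (just b) h = *-cong ≈-refl (h _ _)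
  exchange-cong p e (just a) nothing  h = +-cong (*-cong ≈-refl (h _ _)) (*-cong ≈-refl (h _ _))
  exchange-cong p e (just a) (just b) h = +-cong (*-cong ≈-refl (h _ _)) (*-cong ≈-refl (h _ _))

  private
    bw : ∀ {k} → Polynomial k → Polynomial k → Polynomial k
    bw p q = p :+ q :+ p :* q

  -- The occupancy of the three incoming edges gives eight cases, and in each the coefficients of
  -- the values of `φ` agree. Since `φ` is arbitrary this is an identity of operators, so columns
  -- can be crossed one after another.
  yang-baxter-cell : ∀ p e q l₁ l₂ b φ →
    exchange p e l₁ l₂ (λ l₁′ l₂′ → cell₂ (p + e) p q l₁′ l₂′ b φ) ≈
    cell₂ p (p + e) q l₁ l₂ b (λ r₁ r₂ t → exchange p e r₁ r₂ (λ r₁′ r₂′ → φ r₁′ r₂′ t))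
  yang-baxter-cell p e q nothing nothing nothing φ =
    solve 4 (λ p e q f → (con 1 :+ p) :* (bw p q :* (bw (p :+ e) q :* f))
                      := bw (p :+ e) q :* (bw p q :* ((con 1 :+ p) :* f)))
      ≈-refl p e q _
  yang-baxter-cell p e q nothing nothing (just c) φ =
    solve 6 (λ p e q f g h →
        (con 1 :+ p) :* (bw (p :+ e) q :* f :+ (g :+ h))
     := bw p q :* ((con 1 :+ (p :+ e)) :* f)
        :+ (((con 1 :+ p) :* g :+ e :* f) :+ (con 1 :+ p) :* h))
      ≈-refl p e q _ _ _
  yang-baxter-cell p e q nothing (just b) nothing φ =
    solve 6 (λ p e q f g h →
        (con 1 :+ (p :+ e)) :* (bw (p :+ e) q :* f :+ (con 1 :+ bw p q) :* (g :+ h))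
     := bw p q :* ((con 1 :+ (p :+ e)) :* f)
        :+ (con 1 :+ bw (p :+ e) q) :* (((con 1 :+ p) :* g :+ e :* f) :+ (con 1 :+ p) :* h))
      ≈-refl p e q _ _ _
  yang-baxter-cell p e q nothing (just b) (just c) φ
    -- The pair leaving to the right already has its larger label on top; sorting fixes it, and the
    -- coefficients 1 + p and e add up to 1 + (p + e).
    rewrite ℕ.m≥n⇒m⊔n≡m (ℕ.m⊓n≤m⊔n b c) | ℕ.m≥n⇒m⊓n≡n (ℕ.m⊓n≤m⊔n b c) =
    solve 4 (λ p e f g →
        (con 1 :+ (p :+ e)) :* (f :+ g)
     := ((con 1 :+ p) :* f :+ e :* f) :+ (con 1 :+ (p :+ e)) :* g)
      ≈-refl p e _ _
  yang-baxter-cell p e q (just a) nothing nothing φ =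
    solve 6 (λ p e q f g h →
        (con 1 :+ p) :* (bw p q :* (f :+ (con 1 :+ bw (p :+ e) q) :* g))
        :+ e :* (bw (p :+ e) q :* h :+ (con 1 :+ bw p q) :* (f :+ g))
     := bw (p :+ e) q :* (((con 1 :+ p) :* f :+ e :* h)
        :+ (con 1 :+ bw p q) :* ((con 1 :+ p) :* g)))
      ≈-refl p e q _ _ _
  yang-baxter-cell p e q (just a) nothing (just c) φ =
    solve 8 (λ p e q f g h i j →
        (con 1 :+ p) :* ((f :+ (con 1 :+ bw (p :+ e) q) :* g) :+ h)
        :+ e :* (i :+ j)
     := (((con 1 :+ p) :* f :+ e :* i)
        :+ (con 1 :+ bw p q) :* ((con 1 :+ (p :+ e)) :* g))
        :+ ((con 1 :+ p) :* h :+ e :* j))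
      ≈-refl p e q _ _ _ _ _
  yang-baxter-cell p e q (just a) (just b) nothing φ
    rewrite ℕ.m≥n⇒m⊔n≡m (ℕ.m⊓n≤m⊔n a b) | ℕ.m≥n⇒m⊓n≡n (ℕ.m⊓n≤m⊔n a b) =
    solve 8 (λ p e q f g h i j →
        (con 1 :+ p) :* ((f :+ (con 1 :+ bw (p :+ e) q) :* g) :+ (con 1 :+ bw p q) :* h)
        :+ e :* ((i :+ (con 1 :+ bw (p :+ e) q) :* j) :+ (con 1 :+ bw p q) :* h)
     := (((con 1 :+ p) :* f :+ e :* i)
        :+ (con 1 :+ bw p q) :* ((con 1 :+ (p :+ e)) :* g))
        :+ (con 1 :+ bw (p :+ e) q) :* ((con 1 :+ p) :* h :+ e :* j))
      ≈-refl p e q _ _ _ _ _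
  yang-baxter-cell p e q (just a) (just b) (just c) φ
    -- With three pipes each side has one state of weight 1 + p and one of weight e. The former
    -- coincide as they stand, the latter by the three rules for sorted labels.
    rewrite lower-entry a b c | upper-entry a b c | top-entry a b c = ≈-refl

  yang-baxter-row : ∀ {k} p e (q : Fin k → Poly n) l₁ l₂ bs φ →
    exchange p e l₁ l₂ (λ l₁′ l₂′ → row₂ (p + e) p q l₁′ l₂′ bs φ) ≈
    row₂ p (p + e) q l₁ l₂ bs (λ r₁ r₂ ts → exchange p e r₁ r₂ (λ r₁′ r₂′ → φ r₁′ r₂′ ts))
  yang-baxter-row p e q l₁ l₂ []       φ = ≈-refl
  yang-baxter-row p e q l₁ l₂ (b ∷ bs) φ = ≈-trans
    (yang-baxter-cell p e (q zero) l₁ l₂ b _)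
    (cell-cong ≈-refl ≈-refl l₂ b λ r₂ t → cell-cong ≈-refl ≈-refl l₁ t λ r₁ t′ →
      yang-baxter-row p e (q ∘ suc) r₁ r₂ bs _)

  exchangeAt : ∀ {m} → Poly n → Poly n → Fin m → Vec Label (suc m) →
               (Vec Label (suc m) → Poly n) → Poly n
  exchangeAt p e zero    (l₁ ∷ l₂ ∷ out) φ =
    exchange p e l₁ l₂ (λ r₁ r₂ → φ (r₁ ∷ r₂ ∷ out))
  exchangeAt p e (suc i) (l ∷ out)       φ = exchangeAt p e i out (φ ∘ (l ∷_))

  exchangeAt-cong : ∀ {m} p e (i : Fin m) out {φ ψ} → (∀ out → φ out ≈ ψ out) →
                    exchangeAt p e i out φ ≈ exchangeAt p e i out ψ
  exchangeAt-cong p e zero    (l₁ ∷ l₂ ∷ out) h = exchange-cong p e l₁ l₂ λ r₁ r₂ → h _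
  exchangeAt-cong p e (suc i) (l ∷ out)       h = exchangeAt-cong p e i out (h ∘ (l ∷_))

  exchange-row : ∀ {k} p e l₁ l₂ p′ (q : Fin k → Poly n) l bs
    (φ : Label → Label → Label → Vec Label k → Poly n) →
    exchange p e l₁ l₂ (λ r₁ r₂ → row p′ q l bs (φ r₁ r₂)) ≈
    row p′ q l bs (λ r ts → exchange p e l₁ l₂ (λ r₁ r₂ → φ r₁ r₂ r ts))
  exchange-row p e nothing  nothing  p′ q l bs φ = ≈-sym (row-* p′ q l bs _ _)
  exchange-row p e nothing  (just b) p′ q l bs φ = ≈-sym (row-* p′ q l bs _ _)
  exchange-row p e (just a) nothing  p′ q l bs φ = ≈-sym (≈-trans (row-+ p′ q l bs _ _)
    (+-cong (row-* p′ q l bs _ _) (row-* p′ q l bs _ _)))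
  exchange-row p e (just a) (just b) p′ q l bs φ = ≈-sym (≈-trans (row-+ p′ q l bs _ _)
    (+-cong (row-* p′ q l bs _ _) (row-* p′ q l bs _ _)))

  exchangeAt-row : ∀ {m k} p e (i : Fin m) out p′ (q : Fin k → Poly n) l bs
    (φ : Vec Label (suc m) → Label → Vec Label k → Poly n) →
    exchangeAt p e i out (λ out′ → row p′ q l bs (φ out′)) ≈
    row p′ q l bs (λ r ts → exchangeAt p e i out (λ out′ → φ out′ r ts))
  exchangeAt-row p e zero    (l₁ ∷ l₂ ∷ out) p′ q l bs φ = exchange-row p e l₁ l₂ p′ q l bs _
  exchangeAt-row p e (suc i) (l′ ∷ out)      p′ q l bs φ =
    exchangeAt-row p e i out p′ q l bs (φ ∘ (l′ ∷_))

  -- On vacant left edges `exchange` is multiplication by 1 + p, which is the factor on the left.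
  -- Passing it through both rows exchanges their parameters and leaves it acting on the outputs.
  -- The rows below are not affected, and `exchangeAt-row` carries the operator past the rows above.
  rows-exchange : ∀ {m k} (i : Fin m) (p : Fin (suc m) → Poly n) e (q : Fin k → Poly n) bs φ →
    p (suc i) ≈ p (inject₁ i) + e →
    (1# + p (inject₁ i)) * rows (p ∘ (s i ⟨$⟩ʳ_)) q bs φ ≈
    rows p q bs (λ out ts → exchangeAt (p (inject₁ i)) e i out (λ out′ → φ out′ ts))
  rows-exchange {suc m} zero p e q bs φ h = begin
    (1# + p₀) * rows p′ q bs (λ out ts →
      row p₀ q nothing ts (λ r₂ ts′ → row p₁ q nothing ts′ (λ r₁ → φ (r₁ ∷ r₂ ∷ out))))
      ≈⟨ rows-* p′ q bs (1# + p₀) _ ⟨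
    rows p′ q bs (λ out ts → (1# + p₀) *
      row p₀ q nothing ts (λ r₂ ts′ → row p₁ q nothing ts′ (λ r₁ → φ (r₁ ∷ r₂ ∷ out))))
      ≈⟨ rows-cong q (λ _ → ≈-refl) bs step ⟩
    rows p′ q bs (λ out ts →
      row p₁ q nothing ts (λ r₂ ts′ → row p₀ q nothing ts′ (λ r₁ → ψ out r₁ r₂))) ∎
    where
    open SetoidReasoning R.setoid
    p₀ p₁ : Poly n
    p₀ = p zero
    p₁ = p (suc zero)
    p′ : Fin m → Poly n
    p′ k = p (suc (suc k))
    ψ : Vec Label m → Label → Label → Vec Label _ → Poly n
    ψ out r₁ r₂ ts = exchange p₀ e r₁ r₂ (λ r₁′ r₂′ → φ (r₁′ ∷ r₂′ ∷ out) ts)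
    step : ∀ out ts →
      (1# + p₀) * row p₀ q nothing ts (λ r₂ ts′ → row p₁ q nothing ts′ (λ r₁ → φ (r₁ ∷ r₂ ∷ out)))
      ≈ row p₁ q nothing ts (λ r₂ ts′ → row p₀ q nothing ts′ (λ r₁ → ψ out r₁ r₂))
    step out ts = begin
      (1# + p₀) *
      row p₀ q nothing ts (λ r₂ ts′ → row p₁ q nothing ts′ (λ r₁ → φ (r₁ ∷ r₂ ∷ out)))
        ≈⟨ *-cong ≈-refl (row-cong ≈-refl (λ _ → ≈-refl) nothing ts λ r₂ ts′ →
             row-cong h (λ _ → ≈-refl) nothing ts′ λ _ _ → ≈-refl) ⟩
      (1# + p₀) *
      row p₀ q nothing ts (λ r₂ ts′ → row (p₀ + e) q nothing ts′ (λ r₁ → φ (r₁ ∷ r₂ ∷ out)))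
        ≈⟨ *-cong ≈-refl (row-row (p₀ + e) p₀ q nothing nothing ts _) ⟩
      (1# + p₀) * row₂ (p₀ + e) p₀ q nothing nothing ts (λ r₁ r₂ → φ (r₁ ∷ r₂ ∷ out))
        ≈⟨ yang-baxter-row p₀ e q nothing nothing ts (λ r₁ r₂ → φ (r₁ ∷ r₂ ∷ out)) ⟩
      row₂ p₀ (p₀ + e) q nothing nothing ts (ψ out)
        ≈⟨ row-row p₀ (p₀ + e) q nothing nothing ts _ ⟨
      row (p₀ + e) q nothing ts (λ r₂ ts′ → row p₀ q nothing ts′ (λ r₁ → ψ out r₁ r₂))
        ≈⟨ row-cong h (λ _ → ≈-refl) nothing ts (λ _ _ → ≈-refl) ⟨
      row p₁ q nothing ts (λ r₂ ts′ → row p₀ q nothing ts′ (λ r₁ → ψ out r₁ r₂)) ∎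
  rows-exchange {suc m} (suc i) p e q bs φ h = ≈-trans
    (*-cong ≈-refl (rows-cong q (λ k → R.reflexive (cong p (s-suc i k))) bs {φ = ψ} λ _ _ → ≈-refl))
    (≈-trans (rows-exchange i (p ∘ suc) e q bs ψ h)
      (rows-cong {p = p ∘ suc} q (λ _ → ≈-refl) bs λ out ts →
        exchangeAt-row (p (suc (inject₁ i))) e i out (p zero) q nothing ts
          (λ out′ r → φ (r ∷ out′))))
    where
    ψ : Vec Label (suc m) → Vec Label _ → Poly n
    ψ out ts = row (p zero) q nothing ts λ r → φ (r ∷ out)

  -- Boundary conditions on the right and top edges

  isLabel : ℕ → Label → Poly n
  isLabel a nothing  = 0#
  isLabel a (just b) = if does (a ℕ.≟ b) then 1# else 0#

  isLabel-≢ : ∀ {a b} → a ≢ b → isLabel a (just b) ≡ 0#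
  isLabel-≢ {a} {b} ne rewrite dec-false (a ℕ.≟ b) ne = refl

  isLabel-refl : ∀ a → isLabel a (just a) ≡ 1#
  isLabel-refl a rewrite dec-true (a ℕ.≟ a) refl = refl

  isLabels : ∀ {k} → (Fin k → ℕ) → Vec Label k → Poly n
  isLabels W []       = 1#
  isLabels W (l ∷ ls) = isLabel (W zero) l * isLabels (W ∘ suc) ls

  isLabels-cong : ∀ {k} {W V : Fin k → ℕ} → (∀ i → W i ≡ V i) → ∀ ls → isLabels W ls ≡ isLabels V ls
  isLabels-cong h []       = refl
  isLabels-cong h (l ∷ ls) = cong₂ (λ a → isLabel a l *_) (h zero) (isLabels-cong (h ∘ suc) ls)

  -- The pair (c , d) sorted with the larger label first is (a , b) just when (c , d) is (a , b) or
  -- (b , a). As b < a, the relative order of c and d rules out one of the two, whose product is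
  -- shown to vanish.
  isLabel-⊔⊓ : ∀ {a b} → b ℕ.< a → ∀ c d →
    isLabel a (just (c ⊔ d)) * isLabel b (just (c ⊓ d)) ≈
    isLabel a (just c) * isLabel b (just d) + isLabel b (just c) * isLabel a (just d)
  isLabel-⊔⊓ {a} {b} b<a c d with ℕ.≤-total d c
  ... | inj₁ d≤c rewrite ℕ.m≥n⇒m⊔n≡m d≤c | ℕ.m≥n⇒m⊓n≡n d≤c =
        ≈-trans (≈-sym (R.+-identityʳ _)) (+-cong ≈-refl (≈-sym vanish))
    where
    vanish : isLabel b (just c) * isLabel a (just d) ≈ 0#
    vanish with b ℕ.≟ c | a ℕ.≟ d
    ... | no ne    | _        = ≈-trans (*-cong (R.reflexive (isLabel-≢ ne)) ≈-refl) (R.zeroˡ _)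
    ... | yes _    | no ne    = ≈-trans (*-cong ≈-refl (R.reflexive (isLabel-≢ ne))) (R.zeroʳ _)
    ... | yes refl | yes refl = contradiction b<a (ℕ.≤⇒≯ d≤c)
  ... | inj₂ c≤d rewrite ℕ.m≤n⇒m⊔n≡n c≤d | ℕ.m≤n⇒m⊓n≡m c≤d =
        ≈-trans (*-comm _ _) (≈-trans (≈-sym (+-identityˡ _)) (+-cong (≈-sym vanish) ≈-refl))
    where
    vanish : isLabel a (just c) * isLabel b (just d) ≈ 0#
    vanish with a ℕ.≟ c | b ℕ.≟ d
    ... | no ne    | _        = ≈-trans (*-cong (R.reflexive (isLabel-≢ ne)) ≈-refl) (R.zeroˡ _)
    ... | yes _    | no ne    = ≈-trans (*-cong ≈-refl (R.reflexive (isLabel-≢ ne))) (R.zeroʳ _)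
    ... | yes refl | yes refl = contradiction b<a (ℕ.≤⇒≯ c≤d)

  -- The sorting term contributes e to both orders of the labels. The contribution to the original
  -- order joins 1 + p, which produces the coefficient 1 + (p + e). If a label is missing, both
  -- sides vanish.
  exchange-isLabel : ∀ p e {a b} → b ℕ.< a → ∀ l₁ l₂ c →
    exchange p e l₁ l₂ (λ r₁ r₂ → isLabel a r₁ * (isLabel b r₂ * c)) ≈
    (1# + (p + e)) * (isLabel a l₁ * (isLabel b l₂ * c)) +
    e * (isLabel b l₁ * (isLabel a l₂ * c))
  exchange-isLabel p e {a} {b} b<a nothing nothing c =
    solve 3 (λ p e c → (con 1 :+ p) :* (con 0 :* (con 0 :* c))
      := (con 1 :+ (p :+ e)) :* (con 0 :* (con 0 :* c)) :+ e :* (con 0 :* (con 0 :* c)))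
      ≈-refl p e c
  exchange-isLabel p e {a} {b} b<a nothing (just d) c =
    solve 5 (λ p e c f g → (con 1 :+ (p :+ e)) :* (con 0 :* (f :* c))
      := (con 1 :+ (p :+ e)) :* (con 0 :* (f :* c)) :+ e :* (con 0 :* (g :* c)))
      ≈-refl p e c (isLabel b (just d)) (isLabel a (just d))
  exchange-isLabel p e {a} {b} b<a (just d) nothing c =
    solve 5 (λ p e c f g →
         (con 1 :+ p) :* (f :* (con 0 :* c)) :+ e :* (con 0 :* (g :* c))
      := (con 1 :+ (p :+ e)) :* (f :* (con 0 :* c)) :+ e :* (g :* (con 0 :* c)))
      ≈-refl p e c (isLabel a (just d)) (isLabel b (just d))
  exchange-isLabel p e {a} {b} b<a (just d) (just d′) c = ≈-trans
    (+-cong ≈-refl (*-cong ≈-refl (≈-trans (≈-sym (*-assoc _ _ _))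
      (*-cong (isLabel-⊔⊓ b<a d d′) ≈-refl))))
    (solve 7 (λ p e c f g h i →
         (con 1 :+ p) :* (f :* (g :* c)) :+ e :* ((f :* g :+ h :* i) :* c)
      := (con 1 :+ (p :+ e)) :* (f :* (g :* c)) :+ e :* (h :* (i :* c)))
      ≈-refl p e c (isLabel a (just d)) (isLabel b (just d′))
        (isLabel b (just d)) (isLabel a (just d′)))

  exchangeAt-isLabels : ∀ {m} p e (i : Fin m) (W : Fin (suc m) → ℕ) →
    W (suc i) ℕ.< W (inject₁ i) → ∀ out c →
    exchangeAt p e i out (λ out′ → isLabels W out′ * c) ≈
    (1# + (p + e)) * (isLabels W out * c) + e * (isLabels (W ∘ (s i ⟨$⟩ʳ_)) out * c)
  exchangeAt-isLabels p e zero W lt (l₁ ∷ l₂ ∷ out) c = ≈-trans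
    (exchange-cong p e l₁ l₂ λ r₁ r₂ → assoc₃ _ _ _ _)
    (≈-trans (exchange-isLabel p e lt l₁ l₂ _)
      (≈-sym (+-cong (*-cong ≈-refl (assoc₃ _ _ _ _)) (*-cong ≈-refl (assoc₃ _ _ _ _)))))
    where
    assoc₃ : ∀ f g h c → (f * (g * h)) * c ≈ f * (g * (h * c))
    assoc₃ = solve 4 (λ f g h c → (f :* (g :* h)) :* c := f :* (g :* (h :* c))) ≈-refl
  exchangeAt-isLabels p e (suc i) W lt (l ∷ out) c = ≈-trans
    (exchangeAt-cong p e i out λ out′ → rotate _ _ _)
    (≈-trans (exchangeAt-isLabels p e i (W ∘ suc) lt out (isLabel (W zero) l * c))
      (≈-sym (+-cong (*-cong ≈-refl (rotate _ _ _)) (*-cong ≈-refl (≈-trans (rotate _ _ _)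
        (*-cong (R.reflexive (isLabels-cong (λ k → cong W (s-suc i k)) out)) ≈-refl))))))
    where
    rotate : ∀ f g c → (f * g) * c ≈ g * (f * c)
    rotate = solve 3 (λ f g c → (f :* g) :* c := g :* (f :* c)) ≈-refl

  vacant : ∀ {k} → Vec Label k → Poly n
  vacant []             = 1#
  vacant (nothing ∷ ls) = vacant ls
  vacant (just _ ∷ ls)  = 0#

  partition : ∀ {k m} → (Fin k → ℕ) → (Fin k → Poly n) → (Fin m → Poly n) → Poly n
  partition W p q =
    rows p q (tabulate (just ∘ toℕ)) λ out ts → isLabels W out * vacant ts

  partition-cong : ∀ {k m} {W V : Fin k → ℕ} → (∀ i → W i ≡ V i) →
    ∀ p (q : Fin m → Poly n) → partition W p q ≈ partition V p q
  partition-cong h p q = rows-cong {p = p} q (λ _ → ≈-refl) _ λ out ts →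
    *-cong (R.reflexive (isLabels-cong h out)) ≈-refl

  partition-exchange : ∀ {m k} (i : Fin m) (W : Fin (suc m) → ℕ)
    (p : Fin (suc m) → Poly n) (q : Fin k → Poly n) e →
    W (suc i) ℕ.< W (inject₁ i) → p (suc i) ≈ p (inject₁ i) + e →
    (1# + p (inject₁ i)) * partition W (p ∘ (s i ⟨$⟩ʳ_)) q ≈
    (1# + p (suc i)) * partition W p q + e * partition (W ∘ (s i ⟨$⟩ʳ_)) p q
  partition-exchange i W p q e lt h = begin
    (1# + p (inject₁ i)) * partition W (p ∘ (s i ⟨$⟩ʳ_)) q
      ≈⟨ rows-exchange i p e q _ _ h ⟩
    rows p q _ (λ out ts → exchangeAt (p (inject₁ i)) e i out (λ out′ → isLabels W out′ * vacant ts))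
      ≈⟨ rows-cong {p = p} q (λ _ → ≈-refl) _ (λ out ts →
           exchangeAt-isLabels (p (inject₁ i)) e i W lt out (vacant ts)) ⟩
    rows p q _ (λ out ts → (1# + (p (inject₁ i) + e)) * φ W out ts + e * φ W′ out ts)
      ≈⟨ rows-+ p q _ (λ out ts → (1# + (p (inject₁ i) + e)) * φ W out ts)
           (λ out ts → e * φ W′ out ts) ⟩
    rows p q _ (λ out ts → (1# + (p (inject₁ i) + e)) * φ W out ts) +
    rows p q _ (λ out ts → e * φ W′ out ts)
      ≈⟨ +-cong (rows-* p q _ _ (φ W)) (rows-* p q _ _ (φ W′)) ⟩
    (1# + (p (inject₁ i) + e)) * partition W p q + e * partition W′ p q
      ≈⟨ +-cong (*-cong (+-cong ≈-refl h) ≈-refl) ≈-refl ⟨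
    (1# + p (suc i)) * partition W p q + e * partition W′ p q ∎
    where
    open SetoidReasoning R.setoid
    W′ : Fin _ → ℕ
    W′ = W ∘ (s i ⟨$⟩ʳ_)
    φ : (Fin _ → ℕ) → Vec Label _ → Vec Label _ → Poly n
    φ V out ts = isLabels V out * vacant ts

  -- Substitution for the x variables

  substX-cell : ∀ ρ p q l b (φ : Label → Label → Poly n) →
    substX ρ (cell p q l b φ) ≡ cell (substX ρ p) (substX ρ q) l b (λ r t → substX ρ (φ r t))
  substX-cell ρ p q nothing  nothing  φ = refl
  substX-cell ρ p q nothing  (just b) φ = refl
  substX-cell ρ p q (just a) nothing  φ = refl
  substX-cell ρ p q (just a) (just b) φ = refl

  substX-row : ∀ {k} ρ p (q : Fin k → Poly n) l bs φ →
    substX ρ (row p q l bs φ) ≈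
    row (substX ρ p) (substX ρ ∘ q) l bs (λ r ts → substX ρ (φ r ts))
  substX-row ρ p q l []       φ = ≈-refl
  substX-row ρ p q l (b ∷ bs) φ = ≈-trans (R.reflexive (substX-cell ρ p (q zero) l b _))
    (cell-cong ≈-refl ≈-refl l b λ r t → substX-row ρ p (q ∘ suc) r bs _)

  substX-rows : ∀ {k m} ρ (p : Fin k → Poly n) (q : Fin m → Poly n) bs φ →
    substX ρ (rows p q bs φ) ≈
    rows (substX ρ ∘ p) (substX ρ ∘ q) bs (λ out ts → substX ρ (φ out ts))
  substX-rows {zero}  ρ p q bs φ = ≈-refl
  substX-rows {suc k} ρ p q bs φ = ≈-trans (substX-rows ρ (p ∘ suc) q bs _)
    (rows-cong {p = substX ρ ∘ p ∘ suc} (substX ρ ∘ q) (λ _ → ≈-refl) bs λ out ts →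
      substX-row ρ (p zero) q nothing ts _)

  substX-isLabels : ∀ {k} ρ (W : Fin k → ℕ) ls → substX ρ (isLabels W ls) ≡ isLabels W ls
  substX-isLabels ρ W []             = refl
  substX-isLabels ρ W (nothing ∷ ls) = cong (0# *_) (substX-isLabels ρ (W ∘ suc) ls)
  substX-isLabels ρ W (just a ∷ ls) with does (W zero ℕ.≟ a)
  ... | true  = cong (1# *_) (substX-isLabels ρ (W ∘ suc) ls)
  ... | false = cong (0# *_) (substX-isLabels ρ (W ∘ suc) ls)

  substX-vacant : ∀ {k} ρ (ls : Vec Label k) → substX ρ (vacant ls) ≡ vacant ls
  substX-vacant ρ []             = refl
  substX-vacant ρ (nothing ∷ ls) = substX-vacant ρ ls
  substX-vacant ρ (just _ ∷ ls)  = refl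

  -- The variables occur only in the spectral parameters, not in the labels. Hence sᵢ acts on a
  -- partition function by exchanging the parameters of two rows, which is the left-hand side of
  -- `partition-exchange`.
  substX-partition : ∀ {k m} ρ (W : Fin k → ℕ) p (q : Fin m → Poly n) →
    substX ρ (partition W p q) ≈ partition W (substX ρ ∘ p) (substX ρ ∘ q)
  substX-partition ρ W p q = ≈-trans (substX-rows ρ p q _ _)
    (rows-cong {p = substX ρ ∘ p} (substX ρ ∘ q) (λ _ → ≈-refl) _ λ out ts →
      R.reflexive (cong₂ _*_ (substX-isLabels ρ W out) (substX-vacant ρ ts)))

-- From tilings to lattice states

module _ {a b} (M : Monoid a b) where

  open Monoid M
    renaming (_≈_ to _≈M_; refl to ≈M-refl; sym to ≈M-sym; trans to ≈M-trans; reflexive to ≈M-reflexive)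
  open MonoidSum M using (sum; sum-cong-≋)

  sum-split : ∀ m {k} (f : Fin (m ℕ.+ k) → Carrier) →
              sum f ≈M sum (λ i → f (i ↑ˡ k)) ∙ sum (λ j → f (m ↑ʳ j))
  sum-split zero    f = ≈M-sym (identityˡ _)
  sum-split (suc m) f =
    ≈M-trans (∙-cong ≈M-refl (sum-split m (f ∘ suc))) (≈M-sym (assoc _ _ _))

  -- Stated over a monoid because it is used twice: multiplicatively for the weights of the cells,
  -- additively for the number of blank tiles.
  sum-remQuot : ∀ m {k} (f : Fin m × Fin k → Carrier) →
                sum (λ c → f (remQuot {m} k c)) ≈M sum (λ i → sum (λ j → f (i , j)))
  sum-remQuot zero        f = ≈M-refl
  sum-remQuot (suc m) {k} f = ≈M-trans (sum-split k _) (∙-cong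
    (sum-cong-≋ λ j → ≈M-reflexive (cong f (Fin.remQuot-combine {suc m} zero j)))
    (≈M-trans (sum-cong-≋ λ c → ≈M-reflexive (cong f (lower c)))
      (sum-remQuot m (f ∘ Product.map₁ suc))))
    where
    lower : ∀ c → remQuot {suc m} k (k ↑ʳ c) ≡ Product.map₁ suc (remQuot {m} k c)
    lower c rewrite Fin.splitAt-↑ʳ k (m ℕ.* k) c = refl

module _ {n : ℕ} where

  private
    module R = CommutativeRing (polyRing n)
    open RingSolver R.commutativeSemiring

  open MonoidSum R.*-monoid using () renaming (sum to prod; sum-cong-≋ to prod-cong) public

  ∏-tabulate : ∀ {A : Set} {k} (g : Fin k → A) (f : A → Poly n) → ∏ (List.tabulate g) f ≡ prod (f ∘ g)
  ∏-tabulate {k = zero}  g f = refl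
  ∏-tabulate {k = suc k} g f = cong (f (g zero) *_) (∏-tabulate (g ∘ suc) f)

  -- Summation over markings

  -- The contribution of one cell, summed over its two possible markings.
  markedWeight : Bool → Bool → Poly n → Poly n
  markedWeight true  _     a = β * a
  markedWeight false true  a = 1# + β * a
  markedWeight false false a = 1#

  markingTerm : ∀ {N} → Subset N → Subset N → (Fin N → Poly n) → Subset N → Poly n
  markingTerm D U a S = if does (S ⊆? U)
    then β ^ (∣ D ∣ ℕ.+ ∣ S ∣) * prod (λ c → if does (c ∈? D ∪ S) then a c else 1#)
    else 0#

  markingTerm-inside : ∀ {N} (D U : Subset N) a S →
    markingTerm (outside ∷ D) (inside ∷ U) a (inside ∷ S) ≈
    β * a zero * markingTerm D U (a ∘ suc) S
  markingTerm-inside D U a S with does (S ⊆? U)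
  ... | false = ≈-sym (R.zeroʳ _)
  ... | true rewrite ℕ.+-suc ∣ D ∣ ∣ S ∣ =
    solve 4 (λ b e a p → (b :* e) :* (a :* p) := (b :* a) :* (e :* p)) ≈-refl
      β (β ^ (∣ D ∣ ℕ.+ ∣ S ∣)) (a zero) _

  markingTerm-outside : ∀ {N} (D U : Subset N) u a S →
    markingTerm (outside ∷ D) (u ∷ U) a (outside ∷ S) ≈ markingTerm D U (a ∘ suc) S
  markingTerm-outside D U u a S with does (S ⊆? U)
  ... | false = ≈-refl
  ... | true  = *-cong ≈-refl (*-identityˡ _)

  markingTerm-blank : ∀ {N} (D U : Subset N) u a S →
    markingTerm (inside ∷ D) (u ∷ U) a (outside ∷ S) ≈
    β * a zero * markingTerm D U (a ∘ suc) S
  markingTerm-blank D U u a S with does (S ⊆? U)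
  ... | false = ≈-sym (R.zeroʳ _)
  ... | true  =
    solve 4 (λ b e a p → (b :* e) :* (a :* p) := (b :* a) :* (e :* p)) ≈-refl
      β (β ^ (∣ D ∣ ℕ.+ ∣ S ∣)) (a zero) _

  -- The distributive law: the choice of S is independent from position to position, giving β a at a
  -- position of D, 1 + β a at one of U, and 1 elsewhere. Disjointness excludes a blank that could
  -- also be marked, which would be counted with two powers of β.
  ∑-markings : ∀ {N} (D U : Subset N) (a : Fin N → Poly n) →
    (∀ c → lookup D c ≡ inside → lookup U c ≡ outside) →
    ∑ (vectors (inside ∷ outside ∷ []) N) (markingTerm D U a) ≈
    prod (λ c → markedWeight (lookup D c) (lookup U c) (a c))
  ∑-markings []      []      a h =
    solve 0 (con 1 :* con 1 :+ con 0 := con 1) ≈-refl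
  ∑-markings {suc N} (d ∷ D) (u ∷ U) a h = ≈-trans
    (∑-cartesianProductWith _∷_ (inside ∷ outside ∷ []) (vectors _ N) _)
    (≈-trans (first d u (h zero)) (*-cong ≈-refl (∑-markings D U (a ∘ suc) (h ∘ suc))))
    where
    Σ′ : (Subset N → Poly n) → Poly n
    Σ′ = ∑ (vectors (inside ∷ outside ∷ []) N)
    rest : Poly n
    rest = Σ′ (markingTerm D U (a ∘ suc))
    first : ∀ d u → (d ≡ inside → u ≡ outside) →
      Σ′ (λ S → markingTerm (d ∷ D) (u ∷ U) a (inside ∷ S)) +
      (Σ′ (λ S → markingTerm (d ∷ D) (u ∷ U) a (outside ∷ S)) + 0#) ≈
      markedWeight d u (a zero) * rest
    first true  true  h = contradiction (h refl) λ ()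
    first true  false h = ≈-trans
      (+-cong (∑-0 (vectors _ N)) (≈-trans (R.+-identityʳ _)
        (≈-trans (∑-cong (vectors _ N) (markingTerm-blank D U false a))
          (≈-sym (∑-*ˡ (β * a zero) (vectors _ N) _)))))
      (+-identityˡ _)
    first false true  h = ≈-trans
      (+-cong
        (≈-trans (∑-cong (vectors _ N) (markingTerm-inside D U a))
          (≈-sym (∑-*ˡ (β * a zero) (vectors _ N) _)))
        (+-cong (∑-cong (vectors _ N) (markingTerm-outside D U true a)) ≈-refl))
      (solve 2 (λ w r → w :* r :+ (r :+ con 0) := (con 1 :+ w) :* r) ≈-refl (β * a zero) rest)
    first false false h = ≈-trans
      (+-cong (∑-0 (vectors _ N))
        (+-cong (∑-cong (vectors _ N) (markingTerm-outside D U false a)) ≈-refl))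
      (solve 1 (λ r → con 0 :+ (r :+ con 0) := con 1 :* r) ≈-refl rest)

  tileWeight : Poly n → Poly n → Tile → Poly n
  tileWeight p q blank   = blankWeight p q
  tileWeight p q upElbow = 1# + blankWeight p q
  tileWeight p q _       = 1#

  blankWeight-⊕ : ∀ a b → β * (a ⊕ b) ≈ blankWeight (β * a) (β * b)
  blankWeight-⊕ a b =
    solve 3 (λ c a b → c :* (a :+ b :+ c :* a :* b) := c :* a :+ c :* b :+ c :* a :* (c :* b))
      ≈-refl β a b

  markedWeight-tile : ∀ a b t → markedWeight (isBlank t) (isUpElbow t) (a ⊕ b) ≈
                                tileWeight (β * a) (β * b) t
  markedWeight-tile a b downElbow  = ≈-refl
  markedWeight-tile a b upElbow    = +-cong ≈-refl (blankWeight-⊕ a b)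
  markedWeight-tile a b crossing   = ≈-refl
  markedWeight-tile a b blank      = blankWeight-⊕ a b
  markedWeight-tile a b horizontal = ≈-refl
  markedWeight-tile a b vertical   = ≈-refl

  tilingWeight : ∀ {k m} → (Fin k → Poly n) → (Fin m → Poly n) → Vec (Vec Tile m) k → Poly n
  tilingWeight p q P = prod λ i → prod λ j → tileWeight (p i) (q j) (lookup (lookup P i) j)

  ∑-markings-of-tiling : (P : Tiling n) →
    ∑ (vectors (inside ∷ outside ∷ []) (n ℕ.* n)) (λ S → if does (S ⊆? U P)
        then β ^ (∣ D P ∣ ℕ.+ ∣ S ∣) * ∏ (elements (D P ∪ S)) (λ (i , j) → x i ⊕ y j)
        else 0#) ≈
    tilingWeight (λ i → β * x i) (λ j → β * y j) P
  ∑-markings-of-tiling P = ≈-trans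
    (∑-cong (vectors _ (n ℕ.* n)) λ S → ≈-if (does (S ⊆? U P)) (*-cong ≈-refl (begin
      ∏ (elements (D P ∪ S)) ⊕-pair
        ≈⟨ R.reflexive (∏-map (remQuot n) (filter (_∈? (D P ∪ S)) (allFin (n ℕ.* n))) ⊕-pair) ⟩
      ∏ (filter (_∈? (D P ∪ S)) (allFin (n ℕ.* n))) a
        ≈⟨ ∏-filter (_∈? (D P ∪ S)) (allFin (n ℕ.* n)) a ⟩
      ∏ (allFin (n ℕ.* n)) (marked S)
        ≈⟨ R.reflexive (∏-tabulate {k = n ℕ.* n} (λ c → c) (marked S)) ⟩
      prod (marked S) ∎)))
    (≈-trans (∑-markings (D P) (U P) a disjoint)
    (≈-trans (prod-cong λ c → ≈-trans
        (R.reflexive (cong₂ (λ d u → markedWeight d u (a c))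
          (Vec.lookup∘tabulate _ c) (Vec.lookup∘tabulate _ c)))
        (markedWeight-tile _ _ (uncurry (tile P) (remQuot n c))))
      (sum-remQuot R.*-monoid n (λ (i , j) → tileWeight (β * x i) (β * y j) (tile P i j)))))
    where
    open SetoidReasoning R.setoid
    ⊕-pair : Fin n × Fin n → Poly n
    ⊕-pair (i , j) = x i ⊕ y j
    a : Fin (n ℕ.* n) → Poly n
    a = ⊕-pair ∘ remQuot n
    marked : Positions n → Fin (n ℕ.* n) → Poly n
    marked S c = if does (c ∈? D P ∪ S) then a c else 1#
    ≈-if : ∀ b {f g : Poly n} → f ≈ g → (if b then f else 0#) ≈ (if b then g else 0#)
    ≈-if true  e = e
    ≈-if false e = ≈-refl
    blank⇒¬upElbow : ∀ t → isBlank t ≡ true → isUpElbow t ≡ false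
    blank⇒¬upElbow blank _ = refl
    disjoint : ∀ c → lookup (D P) c ≡ inside → lookup (U P) c ≡ outside
    disjoint c e = trans (Vec.lookup∘tabulate _ c)
      (blank⇒¬upElbow (uncurry (tile P) (remQuot n c))
        (trans (sym (Vec.lookup∘tabulate _ c)) e))

-- Tilings compatible with their propagated labels

Compatible : Tile → Label → Label → Set
Compatible t l b = meets t left ≡ is-just l × meets t bottom ≡ is-just b

compatible? : ∀ t l b → Dec (Compatible t l b)
compatible? t l b = (_ Bool.≟ _) ×-dec (_ Bool.≟ _)

RowCompatible : ∀ {k} → Vec Tile k → Label → Vec Label k → Set
RowCompatible []      l []       = ⊤
RowCompatible (t ∷ r) l (b ∷ bs) = Compatible t l b × RowCompatible r (proj₁ (propagate t l b)) bs

RowsCompatible : ∀ {k m} → Vec (Vec Tile m) k → Vec Label m → Set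
RowsCompatible []      bs = ⊤
RowsCompatible (r ∷ P) bs =
  RowsCompatible P bs × RowCompatible r nothing (proj₂ (propagateRows P bs))

module _ {n : ℕ} where

  private
    module R = CommutativeRing (polyRing n)
    open RingSolver R.commutativeSemiring

  cellWeight : Poly n → Poly n → Tile → Label → Label → Poly n
  cellWeight p q t l b = if does (compatible? t l b) then tileWeight p q t else 0#

  rowWeight : ∀ {k} → Poly n → (Fin k → Poly n) → Vec Tile k → Label → Vec Label k → Poly n
  rowWeight p q []      l []       = 1#
  rowWeight p q (t ∷ r) l (b ∷ bs) =
    cellWeight p (q zero) t l b * rowWeight p (q ∘ suc) r (proj₁ (propagate t l b)) bs

  rowsWeight : ∀ {k m} → (Fin k → Poly n) → (Fin m → Poly n) → Vec (Vec Tile m) k →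
               Vec Label m → Poly n
  rowsWeight p q []      bs = 1#
  rowsWeight p q (r ∷ P) bs =
    rowsWeight (p ∘ suc) q P bs * rowWeight (p zero) q r nothing (proj₂ (propagateRows P bs))

  -- The tiles compatible with the incoming labels are the summands of `cell`. The six terms on the
  -- right come in the order of `tiles`, with coefficient 0 at the incompatible ones.
  cell-∑ : ∀ p q l b φ →
    cell p q l b φ ≈ ∑ tiles (λ t → cellWeight p q t l b * uncurry φ (propagate t l b))
  cell-∑ p q nothing  nothing  φ =
    solve 2 (λ w f → w :* f := con 0 :* f :+ (con 0 :* f :+ (con 0 :* f :+
                               (w :* f :+ (con 0 :* f :+ (con 0 :* f :+ con 0))))))
      ≈-refl (blankWeight p q) (φ nothing nothing)
  cell-∑ p q nothing  (just b) φ =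
    solve 3 (λ f g h → f :+ g := con 1 :* f :+ (con 0 :* h :+ (con 0 :* h :+
                               (con 0 :* h :+ (con 0 :* h :+ (con 1 :* g :+ con 0))))))
      ≈-refl (φ (just b) nothing) (φ nothing (just b)) (φ nothing nothing)
  cell-∑ p q (just a) nothing  φ =
    solve 4 (λ w f g h → f :+ w :* g := con 0 :* h :+ (w :* g :+ (con 0 :* h :+
                               (con 0 :* h :+ (con 1 :* f :+ (con 0 :* h :+ con 0))))))
      ≈-refl (1# + blankWeight p q) (φ (just a) nothing) (φ nothing (just a)) (φ nothing nothing)
  cell-∑ p q (just a) (just b) φ =
    solve 6 (λ f g h i j k → f := con 0 :* g :+ (con 0 :* h :+ (con 1 :* f :+
                               (con 0 :* i :+ (con 0 :* j :+ (con 0 :* k :+ con 0))))))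
      ≈-refl (φ (just (a ℕ.⊓ b)) (just (a ℕ.⊔ b))) (φ (just b) nothing) (φ nothing (just a))
        (φ nothing nothing) (φ (just a) nothing) (φ nothing (just b))

  row-∑ : ∀ {k} p (q : Fin k → Poly n) l bs φ →
    row p q l bs φ ≈
    ∑ (vectors tiles k) (λ r → rowWeight p q r l bs * uncurry φ (propagateRow r l bs))
  row-∑ p q l []       φ = solve 1 (λ f → f := con 1 :* f :+ con 0) ≈-refl (φ l [])
  row-∑ {suc k} p q l (b ∷ bs) φ = ≈-trans (cell-∑ p (q zero) l b _)
    (≈-trans (∑-cong tiles step) (≈-sym (∑-cartesianProductWith _∷_ tiles (vectors tiles k) term)))
    where
    term : Vec Tile (suc k) → Poly n
    term r = rowWeight p q r l (b ∷ bs) * uncurry φ (propagateRow r l (b ∷ bs))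
    step : ∀ t →
      cellWeight p (q zero) t l b * row p (q ∘ suc) (proj₁ (propagate t l b)) bs
        (λ r ts → φ r (proj₂ (propagate t l b) ∷ ts)) ≈
      ∑ (vectors tiles k) (λ r → term (t ∷ r))
    step t = ≈-trans
      (*-cong ≈-refl (row-∑ p (q ∘ suc) (proj₁ (propagate t l b)) bs
        (λ r ts → φ r (proj₂ (propagate t l b) ∷ ts))))
      (≈-trans (∑-*ˡ _ (vectors tiles k) _)
        (∑-cong (vectors tiles k) λ r → ≈-sym (*-assoc _ _ _)))

  rows-∑ : ∀ {k m} p (q : Fin m → Poly n) bs φ →
    rows p q bs φ ≈
    ∑ (vectors (vectors tiles m) k) (λ P → rowsWeight p q P bs * uncurry φ (propagateRows P bs))
  rows-∑ {zero}      p q bs φ = solve 1 (λ f → f := con 1 :* f :+ con 0) ≈-refl (φ [] bs)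
  rows-∑ {suc k} {m} p q bs φ = ≈-trans (rows-∑ (p ∘ suc) q bs _)
    (≈-trans (∑-cong tilings λ P → ≈-trans (*-cong ≈-refl (row-∑ (p zero) q nothing _ _))
        (≈-trans (∑-*ˡ _ (vectors tiles m) _)
          (∑-cong (vectors tiles m) λ r → ≈-sym (*-assoc _ _ _))))
    -- Labels travel upwards, so the transfer operators sum over the lower rows before the top row,
    -- whereas `vectors` enumerates the top row outermost.
    (≈-trans (∑-swap tilings (vectors tiles m) _)
      (≈-sym (∑-cartesianProductWith _∷_ (vectors tiles m) tilings _))))
    where
    tilings : List (Vec (Vec Tile m) k)
    tilings = vectors (vectors tiles m) k

  rowWeight-compatible : ∀ {k} p (q : Fin k → Poly n) r l bs → RowCompatible r l bs →
    rowWeight p q r l bs ≈ prod (λ j → tileWeight p (q j) (lookup r j))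
  rowWeight-compatible p q []      l []       _        = ≈-refl
  rowWeight-compatible p q (t ∷ r) l (b ∷ bs) (c , cs)
    rewrite dec-true (compatible? t l b) c =
    *-cong ≈-refl (rowWeight-compatible p (q ∘ suc) r _ bs cs)

  rowsWeight-compatible : ∀ {k m} p (q : Fin m → Poly n) (P : Vec (Vec Tile m) k) bs →
    RowsCompatible P bs → rowsWeight p q P bs ≈ tilingWeight p q P
  rowsWeight-compatible p q []      bs _        = ≈-refl
  rowsWeight-compatible p q (r ∷ P) bs (cs , c) = ≈-trans (*-comm _ _) (*-cong
    (rowWeight-compatible (p zero) q r nothing _ c)
    (rowsWeight-compatible (p ∘ suc) q P bs cs))

  private
    zeroˡ : ∀ {f g : Poly n} → f ≈ 0# → f * g ≈ 0#
    zeroˡ e = ≈-trans (*-cong e ≈-refl) (R.zeroˡ _)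

    zeroʳ : ∀ {f g : Poly n} → g ≈ 0# → f * g ≈ 0#
    zeroʳ e = ≈-trans (*-cong ≈-refl e) (R.zeroʳ _)

  -- The support lemmas are disjunctions so that in `partition-∑` a tiling that is not a pipe dream
  -- forces one of the three factors of its term to vanish.
  rowWeight-support : ∀ {k} p (q : Fin k → Poly n) r l bs →
    RowCompatible r l bs ⊎ rowWeight p q r l bs ≈ 0#
  rowWeight-support p q []      l []       = inj₁ tt
  rowWeight-support p q (t ∷ r) l (b ∷ bs)
    with compatible? t l b | rowWeight-support p (q ∘ suc) r (proj₁ (propagate t l b)) bs
  ... | yes c | inj₁ cs = inj₁ (c , cs)
  ... | _     | inj₂ e  = inj₂ (zeroʳ e)
  ... | no ¬c | _       = inj₂ (zeroˡ (R.reflexive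
          (cong (if_then tileWeight p (q zero) t else 0#) (dec-false (compatible? t l b) ¬c))))

  rowsWeight-support : ∀ {k m} p (q : Fin m → Poly n) (P : Vec (Vec Tile m) k) bs →
    RowsCompatible P bs ⊎ rowsWeight p q P bs ≈ 0#
  rowsWeight-support p q []      bs = inj₁ tt
  rowsWeight-support p q (r ∷ P) bs
    with rowsWeight-support (p ∘ suc) q P bs
       | rowWeight-support (p zero) q r nothing (proj₂ (propagateRows P bs))
  ... | inj₁ cs | inj₁ c = inj₁ (cs , c)
  ... | inj₂ e  | _      = inj₂ (zeroˡ e)
  ... | inj₁ _  | inj₂ e = inj₂ (zeroʳ e)

  isLabels-≈1 : ∀ {k} (W : Fin k → ℕ) ls → (∀ i → lookup ls i ≡ just (W i)) →
                isLabels W ls ≈ 1# {n}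
  isLabels-≈1 W []             h = ≈-refl
  isLabels-≈1 W (l ∷ ls)       h rewrite h zero = ≈-trans
    (*-cong (R.reflexive (isLabel-refl (W zero))) (isLabels-≈1 (W ∘ suc) ls (h ∘ suc)))
    (*-identityˡ _)

  isLabels-support : ∀ {k} (W : Fin k → ℕ) ls →
    (∀ i → lookup ls i ≡ just (W i)) ⊎ isLabels W ls ≈ 0# {n}
  isLabels-support W []             = inj₁ λ ()
  isLabels-support W (nothing ∷ ls) = inj₂ (R.zeroˡ _)
  isLabels-support W (just a ∷ ls) with W zero ℕ.≟ a | isLabels-support (W ∘ suc) ls
  ... | yes e | inj₁ h = inj₁ λ { zero → cong just (sym e) ; (suc i) → h i }
  ... | _     | inj₂ e = inj₂ (zeroʳ e)
  ... | no ne | _      = inj₂ (zeroˡ (R.reflexive (isLabel-≢ ne)))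

  vacant-≈1 : ∀ {k} (ls : Vec Label k) → (∀ j → lookup ls j ≡ nothing) → vacant ls ≈ 1# {n}
  vacant-≈1 []             h = ≈-refl
  vacant-≈1 (nothing ∷ ls) h = vacant-≈1 ls (h ∘ suc)
  vacant-≈1 (just _ ∷ ls)  h = contradiction (h zero) λ ()

  vacant-support : ∀ {k} (ls : Vec Label k) →
    (∀ j → lookup ls j ≡ nothing) ⊎ vacant ls ≈ 0# {n}
  vacant-support []             = inj₁ λ ()
  vacant-support (nothing ∷ ls) with vacant-support ls
  ... | inj₁ h = inj₁ λ { zero → refl ; (suc j) → h j }
  ... | inj₂ e = inj₂ e
  vacant-support (just _ ∷ ls)  = inj₂ ≈-refl

-- Propagation emits a label exactly on the outgoing edges that the tile meets. It is therefore
-- enough to test the left and bottom edges of every cell: agreement along shared edges follows.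
compatible-right : ∀ t l b → Compatible t l b → meets t right ≡ is-just (proj₁ (propagate t l b))
compatible-right downElbow  l        b        (_ , e) = e
compatible-right upElbow    l        b        _       = refl
compatible-right crossing   (just _) (just _) _       = refl
compatible-right crossing   (just _) nothing  (_ , ())
compatible-right blank      l        b        _       = refl
compatible-right horizontal l        b        (e , _) = e
compatible-right vertical   l        b        _       = refl

compatible-top : ∀ t l b → Compatible t l b → meets t top ≡ is-just (proj₂ (propagate t l b))
compatible-top downElbow  l        b        _       = refl
compatible-top upElbow    l        b        (e , _) = e
compatible-top crossing   (just _) (just _) _       = refl
compatible-top crossing   (just _) nothing  (_ , ())
compatible-top blank      l        b        _       = refl
compatible-top horizontal l        b        _       = refl
compatible-top vertical   l        b        (_ , e) = e

-- Bumpless pipe dreams as compatible tilings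

row-left : ∀ {k} (r : Vec Tile k) l bs → RowCompatible r l bs →
           ∀ j → toℕ j ≡ 0 → meets (lookup r j) left ≡ is-just l
row-left (t ∷ r) l (b ∷ bs) (c , _) zero _ = proj₁ c

row-bottom : ∀ {k} (r : Vec Tile k) l bs → RowCompatible r l bs →
             ∀ j → meets (lookup r j) bottom ≡ is-just (lookup bs j)
row-bottom (t ∷ r) l (b ∷ bs) (c , _)  zero    = proj₂ c
row-bottom (t ∷ r) l (b ∷ bs) (_ , cs) (suc j) = row-bottom r _ bs cs j

row-top : ∀ {k} (r : Vec Tile k) l bs → RowCompatible r l bs →
          ∀ j → meets (lookup r j) top ≡ is-just (lookup (proj₂ (propagateRow r l bs)) j)
row-top (t ∷ r) l (b ∷ bs) (c , _)  zero    = compatible-top t l b c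
row-top (t ∷ r) l (b ∷ bs) (_ , cs) (suc j) = row-top r _ bs cs j

row-right : ∀ {k} (r : Vec Tile k) l bs → RowCompatible r l bs →
            ∀ j → suc (toℕ j) ≡ k → meets (lookup r j) right ≡ is-just (proj₁ (propagateRow r l bs))
row-right (t ∷ [])     l (b ∷ [])     (c , _)  zero    _ = compatible-right t l b c
row-right (t ∷ _ ∷ _)  l (b ∷ _)      _        zero    ()
row-right (t ∷ r)      l (b ∷ bs)     (_ , cs) (suc j) e = row-right r _ bs cs j (ℕ.suc-injective e)

row-adjacent : ∀ {k} (r : Vec Tile k) l bs → RowCompatible r l bs →
  ∀ j j′ → toℕ j′ ≡ suc (toℕ j) → meets (lookup r j) right ≡ meets (lookup r j′) left
row-adjacent (t ∷ r) l (b ∷ bs) (c , cs) zero    (suc j′) e =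
  trans (compatible-right t l b c) (sym (row-left r _ bs cs j′ (ℕ.suc-injective e)))
row-adjacent (t ∷ r) l (b ∷ bs) (c , cs) (suc j) (suc j′) e =
  row-adjacent r _ bs cs j j′ (ℕ.suc-injective e)

row-compatible : ∀ {k} (r : Vec Tile k) l bs →
  (∀ j → toℕ j ≡ 0 → meets (lookup r j) left ≡ is-just l) →
  (∀ j → meets (lookup r j) bottom ≡ is-just (lookup bs j)) →
  (∀ j j′ → toℕ j′ ≡ suc (toℕ j) → meets (lookup r j) right ≡ meets (lookup r j′) left) →
  RowCompatible r l bs
row-compatible []      l []       _ _ _ = tt
row-compatible (t ∷ r) l (b ∷ bs) L B A = c ,
  row-compatible r _ bs
    (λ j e → trans (sym (A zero (suc j) (cong suc e))) (compatible-right t l b c))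
    (B ∘ suc)
    (λ j j′ e → A (suc j) (suc j′) (cong suc e))
  where
  c : Compatible t l b
  c = L zero refl , B zero

rows-row : ∀ {k m} (P : Vec (Vec Tile m) k) bs → RowsCompatible P bs → ∀ i →
  ∃ λ bs′ → RowCompatible (lookup P i) nothing bs′ ×
            proj₁ (propagateRow (lookup P i) nothing bs′) ≡ lookup (proj₁ (propagateRows P bs)) i
rows-row (r ∷ P) bs (cs , c) zero    = _ , c , refl
rows-row (r ∷ P) bs (cs , c) (suc i) = rows-row P bs cs i

rows-top : ∀ {k m} (P : Vec (Vec Tile m) k) bs → RowsCompatible P bs → ∀ i j → toℕ i ≡ 0 →
  meets (lookup (lookup P i) j) top ≡ is-just (lookup (proj₂ (propagateRows P bs)) j)
rows-top (r ∷ P) bs (cs , c) zero j _ = row-top r nothing _ c j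

rows-bottom : ∀ {k m} (P : Vec (Vec Tile m) k) bs → RowsCompatible P bs →
  ∀ i j → suc (toℕ i) ≡ k → meets (lookup (lookup P i) j) bottom ≡ is-just (lookup bs j)
rows-bottom (r ∷ [])    bs (_ , c)  zero    j _  = row-bottom r nothing bs c j
rows-bottom (r ∷ _ ∷ _) bs _        zero    j ()
rows-bottom (r ∷ P)     bs (cs , _) (suc i) j e = rows-bottom P bs cs i j (ℕ.suc-injective e)

rows-adjacent : ∀ {k m} (P : Vec (Vec Tile m) k) bs → RowsCompatible P bs →
  ∀ i i′ j → toℕ i′ ≡ suc (toℕ i) →
  meets (lookup (lookup P i) j) bottom ≡ meets (lookup (lookup P i′) j) top
rows-adjacent (r ∷ P) bs (cs , c) zero    (suc i′) j e =
  trans (row-bottom r nothing _ c j) (sym (rows-top P bs cs i′ j (ℕ.suc-injective e)))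
rows-adjacent (r ∷ P) bs (cs , c) (suc i) (suc i′) j e =
  rows-adjacent P bs cs i i′ j (ℕ.suc-injective e)

rows-compatible : ∀ {k m} (P : Vec (Vec Tile m) k) bs →
  (∀ i j j′ → toℕ j′ ≡ suc (toℕ j) →
    meets (lookup (lookup P i) j) right ≡ meets (lookup (lookup P i) j′) left) →
  (∀ i j → toℕ j ≡ 0 → meets (lookup (lookup P i) j) left ≡ false) →
  (∀ i i′ j → toℕ i′ ≡ suc (toℕ i) →
    meets (lookup (lookup P i) j) bottom ≡ meets (lookup (lookup P i′) j) top) →
  (∀ i j → suc (toℕ i) ≡ k → meets (lookup (lookup P i) j) bottom ≡ is-just (lookup bs j)) →
  RowsCompatible P bs
rows-compatible []      bs H L V B = tt
rows-compatible (r ∷ P) bs H L V B = cs , row-compatible r nothing _ (L zero) (bottoms P V B cs) (H zero)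
  where
  cs : RowsCompatible P bs
  cs = rows-compatible P bs (H ∘ suc) (L ∘ suc) (λ i i′ j e → V (suc i) (suc i′) j (cong suc e))
         (λ i j e → B (suc i) j (cong suc e))
  -- The labels below `r` come from the bottom boundary if `r` is the last row, and otherwise from
  -- the tops of the next row. The lower rows are abstracted to allow this case split.
  bottoms : ∀ {k} (P : Vec (Vec Tile _) k) →
    (∀ i i′ j → toℕ i′ ≡ suc (toℕ i) →
      meets (lookup (lookup (r ∷ P) i) j) bottom ≡ meets (lookup (lookup (r ∷ P) i′) j) top) →
    (∀ i j → suc (toℕ i) ≡ suc k →
      meets (lookup (lookup (r ∷ P) i) j) bottom ≡ is-just (lookup bs j)) →
    RowsCompatible P bs →
    ∀ j → meets (lookup r j) bottom ≡ is-just (lookup (proj₂ (propagateRows P bs)) j)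
  bottoms []       V B cs j = B zero j refl
  bottoms (r′ ∷ P) V B cs j = trans (V zero (suc zero) j refl) (rows-top (r′ ∷ P) bs cs zero j refl)

initialLabels : ∀ n → Vec Label n
initialLabels n = tabulate (just ∘ toℕ)

initialLabels-just : ∀ {n} (j : Fin n) → is-just (lookup (initialLabels n) j) ≡ true
initialLabels-just j = cong is-just (Vec.lookup∘tabulate (just ∘ toℕ) j)

-- The three fields correspond to the three factors of a term of the partition function: cell
-- weights, outputs and vacancy of the top. The right boundary condition is contained in `outputs`,
-- since those labels are present.
record Traced {n} (w : Permutation′ n) (P : Tiling n) : Set where
  field
    compatible : RowsCompatible P (initialLabels n)
    outputs    : ∀ i → ∂ P i ≡ just (toℕ (w ⟨$⟩ʳ i))
    vacancy    : ∀ j → lookup (proj₂ (propagateRows P (initialLabels n))) j ≡ nothing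

isPipeDream⇒traced : ∀ {n} (w : Permutation′ n) P → IsPipeDream w P → Traced w P
isPipeDream⇒traced {zero}  w [] pd = record { compatible = tt ; outputs = λ () ; vacancy = λ () }
isPipeDream⇒traced {suc m} w P pd = record
  { compatible = cs ; outputs = demazure
  ; vacancy = λ j → is-just-false (trans (sym (rows-top P _ cs zero j refl)) (top-boundary zero j refl)) }
  where
  open IsPipeDream pd
  open IsBPD isBPD
  cs : RowsCompatible P (initialLabels (suc m))
  cs = rows-compatible P _ horizontally-adjacent left-boundary vertically-adjacent
         (λ i j e → trans (bottom-boundary i j e) (sym (initialLabels-just j)))
  is-just-false : ∀ {l : Label} → is-just l ≡ false → l ≡ nothing
  is-just-false {nothing} _ = refl

traced⇒isPipeDream : ∀ {n} (w : Permutation′ n) P → Traced w P → IsPipeDream w P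
traced⇒isPipeDream w P tr = record { demazure = outputs ; isBPD = record
  { horizontally-adjacent = λ i → let (_ , c , _) = rows-row P _ compatible i in
      row-adjacent (lookup P i) nothing _ c
  ; vertically-adjacent = rows-adjacent P _ compatible
  ; bottom-boundary = λ i j e → trans (rows-bottom P _ compatible i j e) (initialLabels-just j)
  ; right-boundary = λ i j e → let (_ , c , out) = rows-row P _ compatible i in
      trans (row-right (lookup P i) nothing _ c j e) (cong is-just (trans out (outputs i)))
  ; left-boundary = λ i → let (_ , c , _) = rows-row P _ compatible i in
      row-left (lookup P i) nothing _ c
  ; top-boundary = λ i j e → trans (rows-top P _ compatible i j e) (cong is-just (vacancy j)) } }
  where open Traced tr

-- The sum over marked pipe dreams as a partition function

module _ {n : ℕ} where

  private
    module R = CommutativeRing (polyRing n)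

    if-≈ : {A : Set} (a? : Dec A) {f g : Poly n} → (A → f ≈ g) → (¬ A → f ≈ 0#) →
           f ≈ (if does a? then g else 0#)
    if-≈ (yes a) h h′ = h a
    if-≈ (no ¬a) h h′ = h′ ¬a

    if-no : {A : Set} (a? : Dec A) {f : Poly n} → ¬ A → (if does a? then f else 0#) ≈ 0#
    if-no (yes a) ¬a = contradiction a ¬a
    if-no (no _)  ¬a = ≈-refl

    if-yes : {A : Set} (a? : Dec A) {f : Poly n} → A → (if does a? then f else 0#) ≈ f
    if-yes (yes _) a = ≈-refl
    if-yes (no ¬a) a = contradiction a ¬a

  partition-∑ : ∀ (w : Permutation′ n) (p q : Fin n → Poly n) →
    partition (toℕ ∘ (w ⟨$⟩ʳ_)) p q ≈
    ∑ (vectors (vectors tiles n) n) (λ P → if does (isPipeDream? w P) then tilingWeight p q P else 0#)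
  partition-∑ w p q = ≈-trans (rows-∑ p q _ _) (∑-cong (vectors (vectors tiles n) n) term)
    where
    W : Fin n → ℕ
    W = toℕ ∘ (w ⟨$⟩ʳ_)
    term : ∀ P → rowsWeight p q P (initialLabels n) *
      (isLabels W (proj₁ (propagateRows P (initialLabels n))) *
       vacant (proj₂ (propagateRows P (initialLabels n)))) ≈
      (if does (isPipeDream? w P) then tilingWeight p q P else 0#)
    term P = if-≈ (isPipeDream? w P) dream λ ¬pd → vanish ¬pd
      (rowsWeight-support p q P (initialLabels n))
      (isLabels-support W (proj₁ (propagateRows P (initialLabels n))))
      (vacant-support (proj₂ (propagateRows P (initialLabels n))))
      where
      dream : IsPipeDream w P → _ ≈ tilingWeight p q P
      dream pd = ≈-trans
        (*-cong (rowsWeight-compatible p q P _ compatible)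
          (≈-trans (*-cong (isLabels-≈1 W _ outputs) (vacant-≈1 (proj₂ (propagateRows P (initialLabels n))) vacancy)) (*-identityˡ _)))
        (R.*-identityʳ _)
        where open Traced (isPipeDream⇒traced w P pd)
      vanish : ∀ {f g h : Poly n} → ¬ IsPipeDream w P →
        RowsCompatible P (initialLabels n) ⊎ f ≈ 0# →
        (∀ i → ∂ P i ≡ just (W i)) ⊎ g ≈ 0# →
        (∀ j → lookup (proj₂ (propagateRows P (initialLabels n))) j ≡ nothing) ⊎ h ≈ 0# →
        f * (g * h) ≈ 0#
      vanish ¬pd (inj₂ e) _ _ = ≈-trans (*-cong e ≈-refl) (R.zeroˡ _)
      vanish ¬pd (inj₁ _) (inj₂ e) _ =
        ≈-trans (*-cong ≈-refl (≈-trans (*-cong e ≈-refl) (R.zeroˡ _))) (R.zeroʳ _)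
      vanish ¬pd (inj₁ _) (inj₁ _) (inj₂ e) =
        ≈-trans (*-cong ≈-refl (≈-trans (*-cong ≈-refl e) (R.zeroʳ _))) (R.zeroʳ _)
      vanish ¬pd (inj₁ c) (inj₁ o) (inj₁ v) = contradiction
        (traced⇒isPipeDream w P (record { compatible = c ; outputs = o ; vacancy = v })) ¬pd

  -- The bound makes the truncated subtraction in the exponent a true one, so that β ^ k restores
  -- the full power of β and the sum over markings factorises.
  MPipes-∑ : ∀ (w : Permutation′ n) k → (∀ P → IsPipeDream w P → k ℕ.≤ ∣ D P ∣) →
    β ^ k * ∑ (MPipes w) (λ (P , S) →
      β ^ ((∣ D P ∣ ℕ.+ ∣ S ∣) ∸ k) * ∏ (elements (D P ∪ S)) (λ (i , j) → x i ⊕ y j)) ≈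
    partition (toℕ ∘ (w ⟨$⟩ʳ_)) (λ i → β * x i) (λ j → β * y j)
  MPipes-∑ w k bound = ≈-trans
    (≈-trans (∑-*ˡ (β ^ k) (MPipes w) term)
    (≈-trans (∑-filter (isMarkedBPD? w) (List.cartesianProduct tilings subsets) (λ PS → β ^ k * term PS))
    (≈-trans (∑-cartesianProductWith _,_ tilings subsets filtered) (∑-cong tilings step))))
    (≈-sym (partition-∑ w _ _))
    where
    tilings = vectors (vectors tiles n) n
    subsets = vectors (inside ∷ outside ∷ []) (n ℕ.* n)
    term filtered : Tiling n × Positions n → Poly n
    term (P , S) = β ^ ((∣ D P ∣ ℕ.+ ∣ S ∣) ∸ k) * ∏ (elements (D P ∪ S)) (λ (i , j) → x i ⊕ y j)
    filtered PS = if does (isMarkedBPD? w PS) then β ^ k * term PS else 0#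
    absorb : ∀ P S → k ℕ.≤ ∣ D P ∣ → β ^ k * term (P , S) ≈
      β ^ (∣ D P ∣ ℕ.+ ∣ S ∣) * ∏ (elements (D P ∪ S)) (λ (i , j) → x i ⊕ y j)
    absorb P S h = ≈-trans (≈-sym (*-assoc _ _ _)) (*-cong
      (≈-trans (≈-sym (^-homo-* β k _))
        (R.reflexive (cong (β ^_) (ℕ.m+[n∸m]≡n (ℕ.≤-trans h (ℕ.m≤m+n _ ∣ S ∣))))))
      ≈-refl)
      where open import Algebra.Properties.Semiring.Exp R.semiring using (^-homo-*)
    step : ∀ P → ∑ subsets (λ S → filtered (P , S)) ≈
      (if does (isPipeDream? w P) then tilingWeight (λ i → β * x i) (λ j → β * y j) P else 0#)
    step P = if-≈ (isPipeDream? w P)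
      (λ pd → ≈-trans (∑-cong subsets (marked pd)) (∑-markings-of-tiling P))
      (λ ¬pd → ≈-trans
        (∑-cong subsets λ S → if-no (isMarkedBPD? w (P , S)) (¬pd ∘ IsMarkedBPD.pipeDream))
        (∑-0 subsets))
      where
      marked : IsPipeDream w P → ∀ S → filtered (P , S) ≈ (if does (S ⊆? U P)
        then β ^ (∣ D P ∣ ℕ.+ ∣ S ∣) * ∏ (elements (D P ∪ S)) (λ (i , j) → x i ⊕ y j) else 0#)
      marked pd S = if-≈ (S ⊆? U P)
        (λ S⊆U → ≈-trans
          (if-yes (isMarkedBPD? w (P , S)) (record { pipeDream = pd ; marking = S⊆U }))
          (absorb P S (bound P pd)))
        (λ S⊈U → if-no (isMarkedBPD? w (P , S)) (S⊈U ∘ IsMarkedBPD.marking))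

-- Inversions, crossings and blank tiles

open MonoidSum ℕ.+-0-monoid using () renaming (sum to sumℕ)

indicator : Bool → ℕ
indicator b = if b then 1 else 0

indicator≤1 : ∀ b → indicator b ≤ 1
indicator≤1 true  = s≤s z≤n
indicator≤1 false = z≤n

-- A vacant edge stays in the word but forms no inversion, so words read along paths of edges can be
-- compared letter by letter.
smaller : Label → Label → ℕ
smaller (just a) (just b) = indicator (does (a ℕ.<? b))
smaller _        _        = 0

smaller≤1 : ∀ l l′ → smaller l l′ ≤ 1
smaller≤1 (just a) (just b) = indicator≤1 (does (a ℕ.<? b))
smaller≤1 (just _) nothing  = z≤n
smaller≤1 nothing  _        = z≤n

below : Label → List Label → ℕ
below l []        = 0
below l (l′ ∷ ls) = smaller l′ l ℕ.+ below l ls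

inversions : List Label → ℕ
inversions []       = 0
inversions (l ∷ ls) = below l ls ℕ.+ inversions ls

below-nothing : ∀ ls → below nothing ls ≡ 0
below-nothing []             = refl
below-nothing (just _ ∷ ls)  = below-nothing ls
below-nothing (nothing ∷ ls) = below-nothing ls

below-swap : ∀ l a b ls → below l (a ∷ b ∷ ls) ≡ below l (b ∷ a ∷ ls)
below-swap l a b ls = solve 3 (λ x y z → x :+ (y :+ z) := y :+ (x :+ z)) refl
  (smaller a l) (smaller b l) (below l ls)
  where open ℕSolver.+-*-Solver

-- Only the exchanged pair changes its status. The balanced form holds whichever of the two labels
-- is smaller.
inversions-swap : ∀ a b ls →
  inversions (a ∷ b ∷ ls) ℕ.+ smaller a b ≡ smaller b a ℕ.+ inversions (b ∷ a ∷ ls)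
inversions-swap a b ls =
  solve 5 (λ s t x y z → ((t :+ x) :+ (y :+ z)) :+ s := t :+ ((s :+ y) :+ (x :+ z))) refl
    (smaller a b) (smaller b a) (below a ls) (below b ls) (inversions ls)
  where open ℕSolver.+-*-Solver

inversions-swap-≤ : ∀ a b ls → inversions (a ∷ b ∷ ls) ≤ suc (inversions (b ∷ a ∷ ls))
inversions-swap-≤ a b ls = ℕ.≤-trans (ℕ.m≤m+n _ (smaller a b))
  (ℕ.≤-trans (ℕ.≤-reflexive (inversions-swap a b ls)) (ℕ.+-monoˡ-≤ _ (smaller≤1 b a)))

isCrossing : Tile → Bool
isCrossing crossing = true
isCrossing _        = false

crossings blanks : Tile → ℕ
crossings = indicator ∘ isCrossing
blanks    = indicator ∘ isBlank

-- A compatible tile merely permutes its two labels, vacancies included, so comparisons with a third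
-- label are not affected.
tile-below : ∀ t l b → Compatible t l b → ∀ a ls →
  let (r , u) = propagate t l b in below a (u ∷ r ∷ ls) ≡ below a (l ∷ b ∷ ls)
tile-below downElbow  nothing  b        _ a ls = refl
tile-below upElbow    l        nothing  _ a ls = refl
tile-below crossing   (just c) (just d) _ a ls with ℕ.≤-total c d
... | inj₁ c≤d rewrite ℕ.m≤n⇒m⊔n≡n c≤d | ℕ.m≤n⇒m⊓n≡m c≤d = below-swap a (just d) (just c) ls
... | inj₂ d≤c rewrite ℕ.m≥n⇒m⊔n≡m d≤c | ℕ.m≥n⇒m⊓n≡n d≤c = refl
tile-below blank      nothing  nothing  _ a ls = refl
tile-below horizontal l        nothing  _ a ls = below-swap a nothing l ls
tile-below vertical   nothing  b        _ a ls = below-swap a b nothing ls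

-- At a crossing an ascending pair becomes descending and gains at most one inversion, while a
-- descending pair keeps its order. The second possibility, two pipes meeting again, is the reason
-- for an inequality.
tile-inversions : ∀ t l b → Compatible t l b → ∀ ls →
  let (r , u) = propagate t l b in
  inversions (u ∷ r ∷ ls) ≤ crossings t ℕ.+ inversions (l ∷ b ∷ ls)
tile-inversions downElbow  nothing  b        _ ls = ℕ.≤-refl
tile-inversions upElbow    l        nothing  _ ls = ℕ.≤-refl
tile-inversions crossing   (just c) (just d) _ ls with ℕ.≤-total c d
... | inj₁ c≤d rewrite ℕ.m≤n⇒m⊔n≡n c≤d | ℕ.m≤n⇒m⊓n≡m c≤d = inversions-swap-≤ (just d) (just c) ls
... | inj₂ d≤c rewrite ℕ.m≥n⇒m⊔n≡m d≤c | ℕ.m≥n⇒m⊓n≡n d≤c = ℕ.n≤1+n _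
tile-inversions blank      nothing  nothing  _ ls = ℕ.≤-refl
tile-inversions horizontal nothing  nothing  _ ls = ℕ.≤-refl
tile-inversions horizontal (just a) nothing  _ ls rewrite below-nothing ls = ℕ.≤-refl
tile-inversions vertical   nothing  nothing  _ ls = ℕ.≤-refl
tile-inversions vertical   nothing  (just b) _ ls rewrite below-nothing ls = ℕ.≤-refl

module _ where
  open ℕ.≤-Reasoning

  row-below : ∀ {k} (r : Vec Tile k) l bs → RowCompatible r l bs → ∀ a out →
    let (l′ , ts) = propagateRow r l bs in
    below a (toList ts ++ l′ ∷ out) ≡ below a (l ∷ toList bs ++ out)
  row-below []      l []       _        a out = refl
  row-below (t ∷ r) l (b ∷ bs) (c , cs) a out =
    trans (cong (_ ℕ.+_) (row-below r _ bs cs a out)) (tile-below t l b c a (toList bs ++ out))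

  -- Reading the tops, then the current label, then the remaining bottoms
  -- and the outputs of the lower rows, only crossings create inversions.
  row-inversions : ∀ {k} (r : Vec Tile k) l bs → RowCompatible r l bs → ∀ out →
    let (l′ , ts) = propagateRow r l bs in
    inversions (toList ts ++ l′ ∷ out) ≤
    sumℕ (λ j → crossings (lookup r j)) ℕ.+ inversions (l ∷ toList bs ++ out)
  row-inversions []      l []       _        out = ℕ.≤-refl
  row-inversions (t ∷ r) l (b ∷ bs) (c , cs) out = begin
    below u word ℕ.+ inversions word
      ≤⟨ ℕ.+-mono-≤ (ℕ.≤-reflexive (row-below r m bs cs u out)) (row-inversions r m bs cs out) ⟩
    below u (m ∷ rest) ℕ.+ (sumℕ (λ j → crossings (lookup r j)) ℕ.+ inversions (m ∷ rest))
      ≡⟨ solve 3 (λ x y z → x :+ (y :+ z) := y :+ (x :+ z)) refl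
           (below u (m ∷ rest)) (sumℕ (λ j → crossings (lookup r j))) (inversions (m ∷ rest)) ⟩
    sumℕ (λ j → crossings (lookup r j)) ℕ.+ inversions (u ∷ m ∷ rest)
      ≤⟨ ℕ.+-monoʳ-≤ (sumℕ (λ j → crossings (lookup r j))) (tile-inversions t l b c rest) ⟩
    sumℕ (λ j → crossings (lookup r j)) ℕ.+ (crossings t ℕ.+ inversions (l ∷ b ∷ rest))
      ≡⟨ solve 3 (λ x y z → x :+ (y :+ z) := (y :+ x) :+ z) refl
           (sumℕ (λ j → crossings (lookup r j))) (crossings t) (inversions (l ∷ b ∷ rest)) ⟩
    (crossings t ℕ.+ sumℕ (λ j → crossings (lookup r j))) ℕ.+ inversions (l ∷ b ∷ rest) ∎
    where
    open ℕSolver.+-*-Solver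
    m u : Label
    m = proj₁ (propagate t l b)
    u = proj₂ (propagate t l b)
    rest word : List Label
    rest = toList bs ++ out
    word = toList (proj₂ (propagateRow r m bs)) ++ proj₁ (propagateRow r m bs) ∷ out

  count : ∀ {k m} → (Tile → ℕ) → Vec (Vec Tile m) k → ℕ
  count f P = sumℕ λ i → sumℕ λ j → f (lookup (lookup P i) j)

  -- Working through the rows moves the reading path from the bottom boundary to the path along the
  -- top edges and down the right boundary. Each row starts with a vacant left edge, which adds
  -- nothing.
  rows-inversions : ∀ {k m} (P : Vec (Vec Tile m) k) bs → RowsCompatible P bs →
    let (out , ts) = propagateRows P bs in
    inversions (toList ts ++ toList out) ≤ count crossings P ℕ.+ inversions (toList bs)
  rows-inversions []      bs _        = ℕ.≤-reflexive (cong inversions (List.++-identityʳ (toList bs)))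
  rows-inversions (r ∷ P) bs (cs , c) = begin
    inversions (toList (proj₂ (propagateRow r nothing ts)) ++ proj₁ (propagateRow r nothing ts) ∷ toList out)
      ≤⟨ row-inversions r nothing ts c (toList out) ⟩
    n ℕ.+ (below nothing (toList ts ++ toList out) ℕ.+ inversions (toList ts ++ toList out))
      ≡⟨ cong (λ z → n ℕ.+ (z ℕ.+ inversions (toList ts ++ toList out))) (below-nothing (toList ts ++ toList out)) ⟩
    n ℕ.+ inversions (toList ts ++ toList out)
      ≤⟨ ℕ.+-monoʳ-≤ n (rows-inversions P bs cs) ⟩
    n ℕ.+ (count crossings P ℕ.+ inversions (toList bs))
      ≡⟨ ℕ.+-assoc n _ _ ⟨
    (n ℕ.+ count crossings P) ℕ.+ inversions (toList bs) ∎
    where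
    out = proj₁ (propagateRows P bs)
    ts  = proj₂ (propagateRows P bs)
    n   = sumℕ (λ j → crossings (lookup r j))

-- Equality of the numbers of blanks and crossings

occupied : Label → ℕ
occupied = indicator ∘ is-just

occupancy : ∀ {k} → Vec Label k → ℕ
occupancy []       = 0
occupancy (b ∷ bs) = occupied b ℕ.+ occupancy bs

-- Each pipe is weighted by its distance to the right boundary, so that
-- the number of horizontal steps in a row is a difference of moments.
moment : ∀ {k} → Vec Label k → ℕ
moment             []       = 0
moment {k = suc k} (b ∷ bs) = suc k ℕ.* occupied b ℕ.+ moment bs

triangle : ℕ → ℕ
triangle zero    = 0
triangle (suc k) = suc k ℕ.+ triangle k

tile-occupied : ∀ t l b → Compatible t l b →
  let (r , u) = propagate t l b in occupied l ℕ.+ occupied b ≡ occupied r ℕ.+ occupied u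
tile-occupied downElbow  nothing  b        _ = sym (ℕ.+-identityʳ _)
tile-occupied upElbow    l        nothing  _ = ℕ.+-identityʳ _
tile-occupied crossing   (just c) (just d) _ = refl
tile-occupied blank      nothing  nothing  _ = refl
tile-occupied horizontal l        nothing  _ = refl
tile-occupied vertical   nothing  b        _ = refl

-- Two pipes leave a crossing, none leaves a blank and one leaves any other tile.
tile-count : ∀ t l b → Compatible t l b →
  let (r , u) = propagate t l b in
  crossings t ℕ.+ 1 ≡ blanks t ℕ.+ (occupied r ℕ.+ occupied u)
tile-count downElbow  nothing  (just _) _ = refl
tile-count upElbow    (just _) nothing  _ = refl
tile-count crossing   (just c) (just d) _ = refl
tile-count blank      nothing  nothing  _ = refl
tile-count horizontal (just _) nothing  _ = refl
tile-count vertical   nothing  (just _) _ = refl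

row-occupancy : ∀ {k} (r : Vec Tile k) l bs → RowCompatible r l bs →
  let (l′ , ts) = propagateRow r l bs in
  occupied l ℕ.+ occupancy bs ≡ occupied l′ ℕ.+ occupancy ts
row-occupancy []      l []       _        = refl
row-occupancy (t ∷ r) l (b ∷ bs) (c , cs) = begin
  occupied l ℕ.+ (occupied b ℕ.+ occupancy bs)  ≡⟨ ℕ.+-assoc (occupied l) _ _ ⟨
  occupied l ℕ.+ occupied b ℕ.+ occupancy bs    ≡⟨ cong (ℕ._+ occupancy bs) (tile-occupied t l b c) ⟩
  occupied m ℕ.+ occupied u ℕ.+ occupancy bs
    ≡⟨ solve 3 (λ x y z → (x :+ y) :+ z := y :+ (x :+ z)) refl (occupied m) (occupied u) (occupancy bs) ⟩
  occupied u ℕ.+ (occupied m ℕ.+ occupancy bs)  ≡⟨ cong (occupied u ℕ.+_) (row-occupancy r m bs cs) ⟩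
  occupied u ℕ.+ (occupied l′ ℕ.+ occupancy ts)
    ≡⟨ solve 3 (λ x y z → x :+ (y :+ z) := y :+ (x :+ z)) refl (occupied u) (occupied l′) (occupancy ts) ⟩
  occupied l′ ℕ.+ (occupied u ℕ.+ occupancy ts) ∎
  where
  open ≡.≡-Reasoning
  open ℕSolver.+-*-Solver
  m  = proj₁ (propagate t l b)
  u  = proj₂ (propagate t l b)
  l′ = proj₁ (propagateRow r m bs)
  ts = proj₂ (propagateRow r m bs)

-- Sum `tile-count` over the row. By conservation, a right edge carries `occupied l` plus the
-- surplus of bottoms over tops up to its column; summed over all right edges, a column counts once
-- for each column from it to the boundary, which gives the moments.
row-count : ∀ {k} (r : Vec Tile k) l bs → RowCompatible r l bs →
  let ts = proj₂ (propagateRow r l bs) in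
  sumℕ (λ j → crossings (lookup r j)) ℕ.+ k ℕ.+ moment ts ≡
  sumℕ (λ j → blanks (lookup r j)) ℕ.+ k ℕ.* occupied l ℕ.+ moment bs ℕ.+ occupancy ts
row-count         []      l []       _        = refl
row-count {suc k} (t ∷ r) l (b ∷ bs) (c , cs) = begin
  crossings t ℕ.+ X ℕ.+ suc k ℕ.+ (suc k ℕ.* u ℕ.+ M′)
    ≡⟨ solve 5 (λ x X k u M′ → x :+ X :+ (con 1 :+ k) :+ ((con 1 :+ k) :* u :+ M′)
                := (x :+ con 1) :+ (X :+ k :+ M′) :+ (con 1 :+ k) :* u)
         refl (crossings t) X k u M′ ⟩
  (crossings t ℕ.+ 1) ℕ.+ (X ℕ.+ k ℕ.+ M′) ℕ.+ suc k ℕ.* u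
    ≡⟨ cong₂ (λ v w → v ℕ.+ w ℕ.+ suc k ℕ.* u) (tile-count t l b c) (row-count r _ bs cs) ⟩
  (blanks t ℕ.+ (m ℕ.+ u)) ℕ.+ (B ℕ.+ k ℕ.* m ℕ.+ M ℕ.+ O) ℕ.+ suc k ℕ.* u
    ≡⟨ solve 7 (λ y m u B k M O →
           (y :+ (m :+ u)) :+ (B :+ k :* m :+ M :+ O) :+ (con 1 :+ k) :* u
        := y :+ B :+ (con 1 :+ k) :* (m :+ u) :+ M :+ (u :+ O))
         refl (blanks t) m u B k M O ⟩
  blanks t ℕ.+ B ℕ.+ suc k ℕ.* (m ℕ.+ u) ℕ.+ M ℕ.+ (u ℕ.+ O)
    ≡⟨ cong (λ v → blanks t ℕ.+ B ℕ.+ suc k ℕ.* v ℕ.+ M ℕ.+ (u ℕ.+ O)) (tile-occupied t l b c) ⟨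
  blanks t ℕ.+ B ℕ.+ suc k ℕ.* (occupied l ℕ.+ occupied b) ℕ.+ M ℕ.+ (u ℕ.+ O)
    ≡⟨ solve 7 (λ y l b B k M O →
           y :+ B :+ (con 1 :+ k) :* (l :+ b) :+ M :+ O
        := y :+ B :+ (con 1 :+ k) :* l :+ ((con 1 :+ k) :* b :+ M) :+ O)
         refl (blanks t) (occupied l) (occupied b) B k M (u ℕ.+ O) ⟩
  blanks t ℕ.+ B ℕ.+ suc k ℕ.* occupied l ℕ.+ (suc k ℕ.* occupied b ℕ.+ M) ℕ.+ (u ℕ.+ O) ∎
  where
  open ≡.≡-Reasoning
  open ℕSolver.+-*-Solver
  m  = occupied (proj₁ (propagate t l b))
  u  = occupied (proj₂ (propagate t l b))
  ts = proj₂ (propagateRow r (proj₁ (propagate t l b)) bs)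
  X  = sumℕ (λ j → crossings (lookup r j))
  B  = sumℕ (λ j → blanks (lookup r j))
  M  = moment bs
  M′ = moment ts
  O  = occupancy ts

rows-occupancy : ∀ {k m} (P : Vec (Vec Tile m) k) bs → RowsCompatible P bs →
  let (out , ts) = propagateRows P bs in
  (∀ i → is-just (lookup out i) ≡ true) → k ℕ.+ occupancy ts ≡ occupancy bs
rows-occupancy []      bs _        _ = refl
rows-occupancy {suc k} (r ∷ P) bs (cs , c) h = begin
  suc (k ℕ.+ occupancy ts′)                    ≡⟨ ℕ.+-suc k _ ⟨
  k ℕ.+ (1 ℕ.+ occupancy ts′)
    ≡⟨ cong (λ z → k ℕ.+ (indicator z ℕ.+ occupancy ts′)) (h zero) ⟨
  k ℕ.+ (occupied l ℕ.+ occupancy ts′)         ≡⟨ cong (k ℕ.+_) (row-occupancy r nothing ts c) ⟨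
  k ℕ.+ occupancy ts                           ≡⟨ rows-occupancy P bs cs (h ∘ suc) ⟩
  occupancy bs                                 ∎
  where
  open ≡.≡-Reasoning
  ts  = proj₂ (propagateRows P bs)
  l   = proj₁ (propagateRow r nothing ts)
  ts′ = proj₂ (propagateRow r nothing ts)

-- In `row-count` the moments telescope from row to row. Each row releases one pipe, so the tops of
-- the uppermost of k + 1 rows carry m - (k + 1) pipes; the differences between the width m and
-- these numbers add up to `triangle`.
rows-count : ∀ {k m} (P : Vec (Vec Tile m) k) bs → RowsCompatible P bs → occupancy bs ≡ m →
  let (out , ts) = propagateRows P bs in
  (∀ i → is-just (lookup out i) ≡ true) →
  count crossings P ℕ.+ triangle k ℕ.+ moment ts ≡ count blanks P ℕ.+ moment bs
rows-count []      bs _ _ _ = refl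
rows-count {suc k} {m} (r ∷ P) bs (cs , c) full h =
  ℕ.+-cancelʳ-≡ (O ℕ.+ moment ts) _ _ (begin
  X ℕ.+ Xs ℕ.+ (suc k ℕ.+ T) ℕ.+ M ℕ.+ (O ℕ.+ moment ts)
    ≡⟨ solve 7 (λ X Xs k T M O M′ → X :+ Xs :+ (k :+ T) :+ M :+ (O :+ M′)
                := (X :+ (k :+ O) :+ M) :+ (Xs :+ T :+ M′))
         refl X Xs (suc k) T M O (moment ts) ⟩
  (X ℕ.+ (suc k ℕ.+ O) ℕ.+ M) ℕ.+ (Xs ℕ.+ T ℕ.+ moment ts)
    ≡⟨ cong₂ (λ v w → (X ℕ.+ v ℕ.+ M) ℕ.+ w)
         (trans (rows-occupancy (r ∷ P) bs (cs , c) h) full)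
         (rows-count P bs cs full (h ∘ suc)) ⟩
  (X ℕ.+ m ℕ.+ M) ℕ.+ (Bs ℕ.+ moment bs)
    ≡⟨ cong (ℕ._+ (Bs ℕ.+ moment bs)) (row-count r nothing ts c) ⟩
  (B ℕ.+ m ℕ.* 0 ℕ.+ moment ts ℕ.+ O) ℕ.+ (Bs ℕ.+ moment bs)
    ≡⟨ solve 6 (λ B m M′ O Bs M → (B :+ m :* con 0 :+ M′ :+ O) :+ (Bs :+ M)
                := B :+ Bs :+ M :+ (O :+ M′))
         refl B m (moment ts) O Bs (moment bs) ⟩
  B ℕ.+ Bs ℕ.+ moment bs ℕ.+ (O ℕ.+ moment ts) ∎)
  where
  open ≡.≡-Reasoning
  open ℕSolver.+-*-Solver
  ts = proj₂ (propagateRows P bs)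
  X  = sumℕ (λ j → crossings (lookup r j))
  B  = sumℕ (λ j → blanks (lookup r j))
  Xs = count crossings P
  Bs = count blanks P
  T  = triangle k
  M  = moment (proj₂ (propagateRow r nothing ts))
  O  = occupancy (proj₂ (propagateRow r nothing ts))

occupancy-full : ∀ {k} (bs : Vec Label k) → (∀ j → is-just (lookup bs j) ≡ true) → occupancy bs ≡ k
occupancy-full []            h = refl
occupancy-full (just _ ∷ bs) h = cong suc (occupancy-full bs (h ∘ suc))
occupancy-full (nothing ∷ _) h = contradiction (h zero) λ ()

moment-full : ∀ {k} (bs : Vec Label k) → (∀ j → is-just (lookup bs j) ≡ true) → moment bs ≡ triangle k
moment-full         []            h = refl
moment-full {suc k} (just _ ∷ bs) h = cong₂ ℕ._+_ (ℕ.*-identityʳ (suc k)) (moment-full bs (h ∘ suc))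
moment-full         (nothing ∷ _) h = contradiction (h zero) λ ()

moment-vacant : ∀ {k} (bs : Vec Label k) → (∀ j → lookup bs j ≡ nothing) → moment bs ≡ 0
moment-vacant         []             h = refl
moment-vacant {suc k} (nothing ∷ bs) h = cong₂ ℕ._+_ (ℕ.*-zeroʳ (suc k)) (moment-vacant bs (h ∘ suc))
moment-vacant         (just _ ∷ _)   h = contradiction (h zero) λ ()

-- All bottom edges are occupied and all top edges vacant, so the boundary moments are `triangle n`
-- and 0.
crossings≡blanks : ∀ {n} (w : Permutation′ n) P → IsPipeDream w P → count crossings P ≡ count blanks P
crossings≡blanks {n} w P pd = ℕ.+-cancelʳ-≡ (triangle n) _ _ (begin
  count crossings P ℕ.+ triangle n
    ≡⟨ ℕ.+-identityʳ _ ⟨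
  count crossings P ℕ.+ triangle n ℕ.+ 0
    ≡⟨ cong (count crossings P ℕ.+ triangle n ℕ.+_) (moment-vacant ts vacancy) ⟨
  count crossings P ℕ.+ triangle n ℕ.+ moment ts
    ≡⟨ rows-count P _ compatible (occupancy-full (initialLabels n) initialLabels-just)
         (λ i → cong is-just (outputs i)) ⟩
  count blanks P ℕ.+ moment (initialLabels n)
    ≡⟨ cong (count blanks P ℕ.+_) (moment-full (initialLabels n) initialLabels-just) ⟩
  count blanks P ℕ.+ triangle n ∎)
  where
  ts = proj₂ (propagateRows P (initialLabels n))
  open ≡.≡-Reasoning
  open Traced (isPipeDream⇒traced w P pd)

-- The inversion number as a lower bound for the blanks

word : ∀ {k} → (Fin k → ℕ) → List Label
word f = List.tabulate (just ∘ f)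

toList-word : ∀ {k} (ls : Vec Label k) (f : Fin k → ℕ) → (∀ i → lookup ls i ≡ just (f i)) →
              toList ls ≡ word f
toList-word []       f h = refl
toList-word (l ∷ ls) f h = cong₂ _∷_ (h zero) (toList-word ls (f ∘ suc) (h ∘ suc))

inversions-vacant : ∀ {k} (ts : Vec Label k) ls → (∀ j → lookup ts j ≡ nothing) →
                    inversions (toList ts ++ ls) ≡ inversions ls
inversions-vacant []             ls h = refl
inversions-vacant (nothing ∷ ts) ls h rewrite below-nothing (toList ts ++ ls) =
  inversions-vacant ts ls (h ∘ suc)
inversions-vacant (just _ ∷ _)   ls h = contradiction (h zero) λ ()

below-word : ∀ {k} a (f : Fin k → ℕ) → (∀ i → a ≤ f i) → below (just a) (word f) ≡ 0
below-word {zero}  a f h = refl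
below-word {suc k} a f h rewrite dec-false (f zero ℕ.<? a) (ℕ.≤⇒≯ (h zero)) =
  below-word a (f ∘ suc) (h ∘ suc)

inversions-monotone : ∀ {k} (f : Fin k → ℕ) → (∀ {i j} → i Fin.≤ j → f i ≤ f j) →
                      inversions (word f) ≡ 0
inversions-monotone {zero}  f h = refl
inversions-monotone {suc k} f h = cong₂ ℕ._+_
  (below-word (f zero) (f ∘ suc) (λ i → h {zero} {suc i} z≤n))
  (inversions-monotone (f ∘ suc) (h ∘ s≤s))

inv : ∀ {n} → Permutation′ n → ℕ
inv w = inversions (word (toℕ ∘ (w ⟨$⟩ʳ_)))

-- The word on the bottom boundary is increasing and the top edges are vacant, so all inversions of
-- the output word are created at crossings.
inv≤crossings : ∀ {n} (w : Permutation′ n) P → IsPipeDream w P → inv w ≤ count crossings P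
inv≤crossings {n} w P pd = begin
  inversions (word (toℕ ∘ (w ⟨$⟩ʳ_)))   ≡⟨ cong inversions (toList-word out _ outputs) ⟨
  inversions (toList out)               ≡⟨ inversions-vacant ts _ vacancy ⟨
  inversions (toList ts ++ toList out)  ≤⟨ rows-inversions P _ compatible ⟩
  count crossings P ℕ.+ inversions (toList (initialLabels n))
    ≡⟨ cong (λ ls → count crossings P ℕ.+ inversions ls)
         (toList-word (initialLabels n) toℕ (Vec.lookup∘tabulate _)) ⟩
  count crossings P ℕ.+ inversions (word (toℕ {n}))
    ≡⟨ cong (count crossings P ℕ.+_) (inversions-monotone {n} toℕ λ i≤j → i≤j) ⟩
  count crossings P ℕ.+ 0               ≡⟨ ℕ.+-identityʳ _ ⟩
  count crossings P                     ∎
  where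
  open ℕ.≤-Reasoning
  open Traced (isPipeDream⇒traced w P pd)
  out = proj₁ (propagateRows P (initialLabels n))
  ts  = proj₂ (propagateRows P (initialLabels n))

∣D∣≡blanks : ∀ {n} (P : Tiling n) → ∣ D P ∣ ≡ count blanks P
∣D∣≡blanks {n} P = trans (size (isBlank ∘ uncurry (tile P) ∘ remQuot n))
  (sum-remQuot ℕ.+-0-monoid n (blanks ∘ uncurry (tile P)))
  where
  size : ∀ {N} (f : Fin N → Bool) → ∣ tabulate f ∣ ≡ sumℕ (indicator ∘ f)
  size {zero}  f = refl
  size {suc N} f with f zero
  ... | true  = cong suc (size (f ∘ suc))
  ... | false = size (f ∘ suc)

inv≤∣D∣ : ∀ {n} (w : Permutation′ n) P → IsPipeDream w P → inv w ≤ ∣ D P ∣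
inv≤∣D∣ w P pd = ℕ.≤-trans (inv≤crossings w P pd)
  (ℕ.≤-reflexive (trans (crossings≡blanks w P pd) (sym (∣D∣≡blanks P))))

-- Inversion number and Coxeter length

below-s : ∀ {m} l (i : Fin m) (f : Fin (suc m) → ℕ) →
          below l (word (f ∘ (s i ⟨$⟩ʳ_))) ≡ below l (word f)
below-s {suc m} l zero f =
  below-swap l (just (f (suc zero))) (just (f zero)) (word (λ k → f (suc (suc k))))
below-s {suc m} l (suc i) f = cong (smaller (just (f zero)) l ℕ.+_) (trans
  (cong (below l) (List.tabulate-cong λ k → cong (just ∘ f) (s-suc i k)))
  (below-s l i (f ∘ suc)))

inversions-s : ∀ {m} (i : Fin m) (f : Fin (suc m) → ℕ) →
  let a = just (f (inject₁ i)); b = just (f (suc i)) in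
  inversions (word f) ℕ.+ smaller a b ≡ smaller b a ℕ.+ inversions (word (f ∘ (s i ⟨$⟩ʳ_)))
inversions-s {suc m} zero f =
  inversions-swap (just (f zero)) (just (f (suc zero))) (word (λ k → f (suc (suc k))))
inversions-s {suc m} (suc i) f = begin
  below a₀ (word (f ∘ suc)) ℕ.+ inversions (word (f ∘ suc)) ℕ.+ smaller a b
    ≡⟨ ℕ.+-assoc (below a₀ (word (f ∘ suc))) _ _ ⟩
  below a₀ (word (f ∘ suc)) ℕ.+ (inversions (word (f ∘ suc)) ℕ.+ smaller a b)
    ≡⟨ cong₂ ℕ._+_ (sym (below-s a₀ i (f ∘ suc))) (inversions-s i (f ∘ suc)) ⟩
  below a₀ (word g) ℕ.+ (smaller b a ℕ.+ inversions (word g))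
    ≡⟨ solve 3 (λ x y z → x :+ (y :+ z) := y :+ (x :+ z)) refl
         (below a₀ (word g)) (smaller b a) (inversions (word g)) ⟩
  smaller b a ℕ.+ (below a₀ (word g) ℕ.+ inversions (word g))
    ≡⟨ cong (λ ls → smaller b a ℕ.+ (below a₀ ls ℕ.+ inversions ls))
         (List.tabulate-cong λ k → cong (just ∘ f) (s-suc i k)) ⟨
  smaller b a ℕ.+ inversions (word (f ∘ (s (suc i) ⟨$⟩ʳ_))) ∎
  where
  open ≡.≡-Reasoning
  open ℕSolver.+-*-Solver
  a₀ = just (f zero)
  a  = just (f (suc (inject₁ i)))
  b  = just (f (suc (suc i)))
  g  = f ∘ suc ∘ (s i ⟨$⟩ʳ_)

inversions-descent : ∀ {m} (i : Fin m) (f : Fin (suc m) → ℕ) → f (suc i) ℕ.< f (inject₁ i) →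
                     inversions (word f) ≡ suc (inversions (word (f ∘ (s i ⟨$⟩ʳ_))))
inversions-descent i f lt with inversions-s i f
... | e rewrite dec-true (f (suc i) ℕ.<? f (inject₁ i)) lt
              | dec-false (f (inject₁ i) ℕ.<? f (suc i)) (ℕ.<⇒≯ lt) =
      trans (sym (ℕ.+-identityʳ _)) e

inversions-s-≤ : ∀ {m} (i : Fin m) (f : Fin (suc m) → ℕ) →
                 inversions (word (f ∘ (s i ⟨$⟩ʳ_))) ≤ suc (inversions (word f))
inversions-s-≤ i f = begin
  inversions (word (f ∘ (s i ⟨$⟩ʳ_)))                    ≤⟨ ℕ.m≤n+m _ (smaller b a) ⟩
  smaller b a ℕ.+ inversions (word (f ∘ (s i ⟨$⟩ʳ_)))    ≡⟨ inversions-s i f ⟨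
  inversions (word f) ℕ.+ smaller a b                    ≤⟨ ℕ.+-monoʳ-≤ _ (smaller≤1 a b) ⟩
  inversions (word f) ℕ.+ 1                              ≡⟨ ℕ.+-comm _ 1 ⟩
  suc (inversions (word f))                              ∎
  where
  open ℕ.≤-Reasoning
  a = just (f (inject₁ i))
  b = just (f (suc i))

inversions-product : ∀ {m k} (u : Vec (Fin m) k) (f : Fin (suc m) → ℕ) →
  inversions (word (f ∘ (product u ⟨$⟩ʳ_))) ≤ k ℕ.+ inversions (word f)
inversions-product []                f = ℕ.≤-refl
inversions-product {k = suc k} (i ∷ u) f = ℕ.≤-trans
  (inversions-product u (f ∘ (s i ⟨$⟩ʳ_)))
  (ℕ.≤-trans (ℕ.+-monoʳ-≤ k (inversions-s-≤ i f)) (ℕ.≤-reflexive (ℕ.+-suc k _)))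

inv-cong : ∀ {n} {w v : Permutation′ n} → w Perm.≈ v → inv w ≡ inv v
inv-cong h = cong inversions (List.tabulate-cong λ k → cong (just ∘ toℕ) (h k))

inv-id : ∀ {n} → inv (Perm.id {n}) ≡ 0
inv-id {n} = inversions-monotone {n} toℕ λ i≤j → i≤j

inv≤length : ∀ {m k} (w : Permutation′ (suc m)) → HasWord w k → inv w ≤ k
inv≤length {m} {k} w (u , e) = ℕ.≤-trans
  (ℕ.≤-reflexive (inv-cong {w = w} {v = product u} e))
  (ℕ.≤-trans (inversions-product u toℕ)
    (ℕ.≤-reflexive (trans (cong (k ℕ.+_) (inv-id {suc m})) (ℕ.+-identityʳ k))))

-- Complementing the values reduces this to `decreasing⇒reverse`.
increasing⇒id : ∀ {m} (w : Permutation′ (suc m)) →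
                (∀ i → w ⟨$⟩ʳ inject₁ i Fin.< w ⟨$⟩ʳ suc i) → w Perm.≈ Perm.id
increasing⇒id {m} w inc k = trans (sym (Fin.opposite-involutive _))
  (trans (cong opposite (decreasing⇒reverse (w ∘ₚ reverse) dec k)) (Fin.opposite-involutive k))
  where
  dec : ∀ i → opposite (w ⟨$⟩ʳ inject₁ i) Fin.> opposite (w ⟨$⟩ʳ suc i)
  dec i = ≡.subst₂ ℕ._<_ (sym (Fin.opposite-prop (w ⟨$⟩ʳ suc i)))
    (sym (Fin.opposite-prop (w ⟨$⟩ʳ inject₁ i)))
    (ℕ.∸-monoʳ-< (s≤s (inc i)) (Fin.toℕ<n _))

-- Bubble sort: an exchange at a descent removes exactly one inversion, and without descents w is
-- the identity. The recursion runs on `k`.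
word-of-length-inv : ∀ {m} k (w : Permutation′ (suc m)) → inv w ≡ k → HasWord w k
word-of-length-inv k w e with Fin.any? (λ i → w ⟨$⟩ʳ suc i Fin.<? w ⟨$⟩ʳ inject₁ i)
word-of-length-inv zero w e | yes (i , lt) =
  contradiction (trans (sym e) (inversions-descent i (toℕ ∘ (w ⟨$⟩ʳ_)) lt)) λ ()
word-of-length-inv (suc k) w e | yes (i , lt) = snoc-word w i (word-of-length-inv k (s i ∘ₚ w)
  (ℕ.suc-injective (trans (sym (inversions-descent i (toℕ ∘ (w ⟨$⟩ʳ_)) lt)) e)))
word-of-length-inv {m} k w e | no ascending =
  subst (HasWord w) (trans (sym (trans (inv-cong {w = w} {v = Perm.id} w≈id) (inv-id {suc m}))) e) ([] , w≈id)
  where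
  w≈id : w Perm.≈ Perm.id
  w≈id = increasing⇒id w λ i → ℕ.≤∧≢⇒< (ℕ.≮⇒≥ (λ lt → ascending (i , lt)))
    (λ eq → inject₁≢suc i (trans (sym (Perm.inverseˡ w))
      (trans (cong (w Perm.⟨$⟩ˡ_) (Fin.toℕ-injective eq)) (Perm.inverseˡ w))))

ℓ≡inv : ∀ {m} (w : Permutation′ (suc m)) → ℓ w ≡ inv w
ℓ≡inv w = ℕ.≤-antisym (minimal (inv w) (word-of-length-inv (inv w) w refl)) (inv≤length w attained)
  where open IsCoxeterLength (proj₂ (coxeterLength w))

-- The longest element

-- staircaseLabels d o k describes k columns numbered from o on whose
-- labels o, …, o + d ∸ 1 have already left.
fullLabels : ℕ → (k : ℕ) → Vec Label k
fullLabels o zero    = []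
fullLabels o (suc k) = just o ∷ fullLabels (suc o) k

staircaseLabels : ℕ → ℕ → (k : ℕ) → Vec Label k
staircaseLabels zero    o k       = fullLabels o k
staircaseLabels (suc d) o zero    = []
staircaseLabels (suc d) o (suc k) = nothing ∷ staircaseLabels d (suc o) k

tabulate≡fullLabels : ∀ o k → tabulate {n = k} (λ j → just (toℕ j ℕ.+ o)) ≡ fullLabels o k
tabulate≡fullLabels o zero    = refl
tabulate≡fullLabels o (suc k) = cong (just o ∷_)
  (trans (Vec.tabulate-cong λ j → cong just (sym (ℕ.+-suc (toℕ j) o))) (tabulate≡fullLabels (suc o) k))

initialLabels≡fullLabels : ∀ n → initialLabels n ≡ fullLabels 0 n
initialLabels≡fullLabels n =
  trans (Vec.tabulate-cong λ j → cong just (sym (ℕ.+-identityʳ (toℕ j)))) (tabulate≡fullLabels 0 n)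

module _ {n : ℕ} where

  private
    module R = CommutativeRing (polyRing n)
    open RingSolver R.commutativeSemiring

  vacant-staircaseLabels : ∀ k o → vacant (staircaseLabels k o k) ≈ 1# {n}
  vacant-staircaseLabels zero    o = ≈-refl
  vacant-staircaseLabels (suc k) o = vacant-staircaseLabels k (suc o)

  row-fullLabels-just : ∀ {k} p (q : Fin k → Poly n) {a o} → a ℕ.< o → ∀ φ →
    row p q (just a) (fullLabels o k) φ ≈ φ (just a) (fullLabels o k)
  row-fullLabels-just {zero}  p q a<o φ = ≈-refl
  row-fullLabels-just {suc k} p q a<o φ
    rewrite ℕ.m≤n⇒m⊓n≡m (ℕ.<⇒≤ a<o) | ℕ.m≤n⇒m⊔n≡n (ℕ.<⇒≤ a<o) =
    row-fullLabels-just p (q ∘ suc) (ℕ.m≤n⇒m≤1+n a<o) _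

  -- The row ends either vacant or with one of the labels o, o + 1, ..., all of them larger than a.
  row-fullLabels-nothing : ∀ {k} p (q : Fin k → Poly n) {a o} → a ℕ.< o → ∀ (ψ : Vec Label k → Poly n) →
    row p q nothing (fullLabels o k) (λ l ts → isLabel a l * ψ ts) ≈ 0#
  row-fullLabels-nothing {zero}  p q a<o ψ = R.zeroˡ _
  row-fullLabels-nothing {suc k} p q {a} {o} a<o ψ = ≈-trans
    (+-cong
      (≈-trans (row-fullLabels-just p (q ∘ suc) (ℕ.n<1+n o) (λ l ts → isLabel a l * ψ (nothing ∷ ts)))
        (≈-trans (*-cong (R.reflexive (isLabel-≢ (ℕ.<⇒≢ a<o))) ≈-refl) (R.zeroˡ _)))
      (row-fullLabels-nothing p (q ∘ suc) (ℕ.m≤n⇒m≤1+n a<o) (λ ts → ψ (just o ∷ ts))))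
    (+-identityˡ _)

  staircaseRow : ∀ {k} → Poly n → (Fin k → Poly n) → ℕ → Poly n
  staircaseRow         p q zero    = 1#
  staircaseRow {zero}  p q (suc d) = 1#
  staircaseRow {suc k} p q (suc d) = blankWeight p (q zero) * staircaseRow p (q ∘ suc) d

  -- To let the smallest remaining label leave, its pipe has to turn right
  -- at once and to cross all later ones.
  row-staircaseLabels : ∀ {k} p (q : Fin k → Poly n) a d o → a ≡ d ℕ.+ o → d ℕ.< k → ∀ (ψ : Vec Label k → Poly n) →
    row p q nothing (staircaseLabels d o k) (λ l ts → isLabel a l * ψ ts) ≈
    staircaseRow p q d * ψ (staircaseLabels (suc d) o k)
  row-staircaseLabels {suc k} p q a zero o refl d<k ψ = ≈-trans
    (+-cong
      (≈-trans (row-fullLabels-just p (q ∘ suc) (ℕ.n<1+n a) (λ l ts → isLabel a l * ψ (nothing ∷ ts)))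
        (*-cong (R.reflexive (isLabel-refl a)) ≈-refl))
      (row-fullLabels-nothing p (q ∘ suc) (ℕ.n<1+n a) (λ ts → ψ (just a ∷ ts))))
    (R.+-identityʳ _)
  row-staircaseLabels {suc k} p q a (suc d) o e (s≤s d<k) ψ = ≈-trans
    (*-cong ≈-refl (row-staircaseLabels p (q ∘ suc) a d (suc o)
      (trans e (sym (ℕ.+-suc d o))) d<k (λ ts → ψ (nothing ∷ ts))))
    (≈-sym (*-assoc _ _ _))

  staircase : ∀ {k m} → (Fin k → Poly n) → (Fin m → Poly n) → Poly n
  staircase {zero}  p q = 1#
  staircase {suc k} p q = staircase (p ∘ suc) q * staircaseRow (p zero) q k

  -- For w₀ the labels leave in the order 0, 1, 2, ... from the bottom row upwards, so the row with
  -- k rows below it releases k. The continuation `ψ` is arbitrary because the top row is absorbed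
  -- into it before the induction hypothesis is applied.
  rows-staircase : ∀ {k m} (p : Fin k → Poly n) (q : Fin m → Poly n) → k ≤ m → ∀ (ψ : Vec Label m → Poly n) →
    rows p q (fullLabels 0 m) (λ out ts → isLabels (toℕ ∘ opposite) out * ψ ts) ≈
    staircase p q * ψ (staircaseLabels k 0 m)
  rows-staircase {zero}      p q k≤m ψ = ≈-refl
  rows-staircase {suc k} {m} p q k<m ψ = begin
    rows (p ∘ suc) q (fullLabels 0 m) (λ out ts → row (p zero) q nothing ts (λ l ts′ →
      isLabels (toℕ ∘ opposite) (l ∷ out) * ψ ts′))
      ≈⟨ rows-cong {p = p ∘ suc} q (λ _ → ≈-refl) _ (λ out ts → ≈-trans
           (row-cong ≈-refl (λ _ → ≈-refl) nothing ts (regroup out))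
           (row-* (p zero) q nothing ts (isLabels (toℕ ∘ opposite) out)
             (λ l ts′ → isLabel k l * ψ ts′))) ⟩
    rows (p ∘ suc) q (fullLabels 0 m) (λ out ts → isLabels (toℕ ∘ opposite) out * ψ′ ts)
      ≈⟨ rows-staircase (p ∘ suc) q (ℕ.<⇒≤ k<m) ψ′ ⟩
    staircase (p ∘ suc) q * ψ′ (staircaseLabels k 0 m)
      ≈⟨ *-cong ≈-refl (row-staircaseLabels (p zero) q k k 0 (sym (ℕ.+-identityʳ k)) k<m ψ) ⟩
    staircase (p ∘ suc) q * (staircaseRow (p zero) q k * ψ (staircaseLabels (suc k) 0 m))
      ≈⟨ *-assoc _ _ _ ⟨
    staircase p q * ψ (staircaseLabels (suc k) 0 m) ∎
    where
    open SetoidReasoning R.setoid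
    ψ′ : Vec Label m → Poly n
    ψ′ ts = row (p zero) q nothing ts (λ l ts′ → isLabel k l * ψ ts′)
    regroup : ∀ out l ts → isLabels (toℕ ∘ opposite) (l ∷ out) * ψ ts ≈
                           isLabels (toℕ ∘ opposite) out * (isLabel k l * ψ ts)
    regroup out l ts = ≈-trans
      (*-cong (R.reflexive (cong₂ (λ a c → isLabel a l * c) (Fin.toℕ-fromℕ k)
        (isLabels-cong (λ i → Fin.toℕ-inject₁ (opposite i)) out))) ≈-refl)
      (solve 3 (λ f g c → (f :* g) :* c := g :* (f :* c)) ≈-refl _ _ _)

  partition-opposite : (p q : Fin n → Poly n) → partition (toℕ ∘ opposite) p q ≈ staircase p q
  partition-opposite p q = ≈-trans
    (R.reflexive (cong (λ bs → rows p q bs (λ out ts → isLabels (toℕ ∘ opposite) out * vacant ts))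
      (initialLabels≡fullLabels n)))
    (≈-trans (rows-staircase p q ℕ.≤-refl vacant)
      (≈-trans (*-cong ≈-refl (vacant-staircaseLabels n 0)) (R.*-identityʳ _)))

  staircaseRow-⊕ : ∀ {k} a (g : Fin k → Poly n) d → d ≤ k →
    staircaseRow (β * a) (λ j → β * g j) d ≈
    β ^ d * prod (λ j → if does (suc (toℕ j) ℕ.≤? d) then a ⊕ g j else 1#)
  staircaseRow-⊕ {k} a g zero _ = ≈-sym (≈-trans (*-identityˡ _) (prod-1 k))
    where
    prod-1 : ∀ k → prod {n} {k} (λ _ → 1#) ≈ 1#
    prod-1 zero    = ≈-refl
    prod-1 (suc k) = ≈-trans (*-identityˡ _) (prod-1 k)
  staircaseRow-⊕ {suc k} a g (suc d) (s≤s d≤k) = ≈-trans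
    (*-cong (≈-sym (blankWeight-⊕ a (g zero))) (staircaseRow-⊕ a (g ∘ suc) d d≤k))
    (solve 4 (λ b a c r → (b :* a) :* (c :* r) := (b :* c) :* (a :* r)) ≈-refl
      β (a ⊕ g zero) (β ^ d) _)

below-word-all : ∀ {k} a (f : Fin k → ℕ) → (∀ i → f i ℕ.< a) → below (just a) (word f) ≡ k
below-word-all {zero}  a f h = refl
below-word-all {suc k} a f h rewrite dec-true (f zero ℕ.<? a) (h zero) =
  cong suc (below-word-all a (f ∘ suc) (h ∘ suc))

inv-opposite : ℕ → ℕ
inv-opposite k = inversions (word (toℕ ∘ opposite {k}))

inv-opposite-suc : ∀ k → inv-opposite (suc k) ≡ k ℕ.+ inv-opposite k
inv-opposite-suc k = trans
  (cong₂ (λ a ls → below (just a) ls ℕ.+ inversions ls) (Fin.toℕ-fromℕ k)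
    (List.tabulate-cong {n = k} λ i → cong just (Fin.toℕ-inject₁ (opposite i))))
  (cong (ℕ._+ inv-opposite k) (below-word-all k (toℕ ∘ opposite) (λ i → Fin.toℕ<n (opposite i))))

module _ {n : ℕ} where

  private
    module R = CommutativeRing (polyRing n)
    open RingSolver R.commutativeSemiring
    open import Algebra.Properties.Semiring.Exp R.semiring using (^-homo-*)

  -- Each blank of the staircase yields one β, and a top row with k blanks matches the k inversions
  -- that the first entry of the reversed word adds. Removing that row lowers the bound on i + j by
  -- one, which is the staircase of the remaining rows.
  staircase-⊕ : ∀ {k m} (f : Fin k → Poly n) (g : Fin m → Poly n) → k ≤ m →
    staircase (λ i → β * f i) (λ j → β * g j) ≈
    β ^ inv-opposite k * prod (λ i → prod (λ j →
      if does (suc (toℕ i) ℕ.+ suc (toℕ j) ℕ.≤? k) then f i ⊕ g j else 1#))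
  staircase-⊕ {zero}  f g k≤m = ≈-sym (*-identityˡ _)
  staircase-⊕ {suc k} f g k<m = ≈-trans
    (*-cong (staircase-⊕ (f ∘ suc) g (ℕ.<⇒≤ k<m)) (staircaseRow-⊕ (f zero) g k (ℕ.<⇒≤ k<m)))
    (≈-trans
      (solve 4 (λ a b c d → (a :* b) :* (c :* d) := (c :* a) :* (d :* b)) ≈-refl _ _ _ _)
      (*-cong (≈-trans (≈-sym (^-homo-* β k _)) (R.reflexive (cong (β ^_) (sym (inv-opposite-suc k)))))
        ≈-refl))

  𝔊-w₀-staircase : β ^ inv-opposite n * 𝔊-w₀ n ≈ staircase (λ i → β * x i) (λ j → β * y j)
  𝔊-w₀-staircase = ≈-sym (≈-trans (staircase-⊕ x y ℕ.≤-refl) (*-cong ≈-refl (≈-sym (begin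
    𝔊-w₀ n
      ≈⟨ ∏-filter _ (cartesianProduct (allFin n) (allFin n)) _ ⟩
    ∏ (cartesianProduct (allFin n) (allFin n)) cellFactor
      ≈⟨ ∏-cartesianProduct (allFin n) (allFin n) cellFactor ⟩
    ∏ (allFin n) (λ i → ∏ (allFin n) (λ j → cellFactor (i , j)))
      ≈⟨ ∏-cong (allFin n) (λ i → R.reflexive (∏-tabulate {k = n} (λ j → j) (λ j → cellFactor (i , j)))) ⟩
    ∏ (allFin n) (λ i → prod (λ j → cellFactor (i , j)))
      ≈⟨ R.reflexive (∏-tabulate {k = n} (λ i → i) (λ i → prod (λ j → cellFactor (i , j)))) ⟩
    prod (λ i → prod (λ j → cellFactor (i , j))) ∎))))
    where
    open SetoidReasoning R.setoid
    cellFactor : Fin n × Fin n → Poly n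
    cellFactor (i , j) = if does (suc (toℕ i) ℕ.+ suc (toℕ j) ℕ.≤? n) then x i ⊕ y j else 1#

-- Descending induction along chains of descents

pipeSum : ∀ {n} → Permutation′ n → Poly n
pipeSum w = partition (toℕ ∘ (w ⟨$⟩ʳ_)) (λ i → β * x i) (λ j → β * y j)

pipeSum-longest : ∀ {n} (w : Permutation′ n) → w Perm.≈ reverse → β ^ inv w * 𝔊-w₀ n ≈ pipeSum w
pipeSum-longest {n} w w≈ = ≈-trans
  (*-cong (R.reflexive (cong (β ^_) (inv-cong {w = w} {v = reverse} w≈))) ≈-refl)
  (≈-trans 𝔊-w₀-staircase (≈-trans (≈-sym (partition-opposite (λ i → β * x i) (λ j → β * y j)))
    (partition-cong (λ i → cong toℕ (sym (w≈ i))) (λ i → β * x i) (λ j → β * y j))))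
  where module R = CommutativeRing (polyRing n)

module _ {m : ℕ} where

  private
    module R = CommutativeRing (polyRing (suc m))
    open RingSolver R.commutativeSemiring
    open SetoidReasoning R.setoid

  substX-β^ : ∀ (ρ : Fin (suc m) → Fin (suc m)) k → substX ρ (β ^ k) ≡ β ^ k
  substX-β^ ρ zero    = refl
  substX-β^ ρ (suc k) = cong (β *_) (substX-β^ ρ k)

  pipeSum-exchange : (w : Permutation′ (suc m)) (i : Fin m) →
    w ⟨$⟩ʳ inject₁ i Fin.> w ⟨$⟩ʳ suc i →
    (1# + β * x (suc i)) * pipeSum w - (1# + β * x (inject₁ i)) * (s i • pipeSum w) ≈
    (x (inject₁ i) - x (suc i)) * (β * pipeSum (s i ∘ₚ w))
  pipeSum-exchange w i lt = begin
    A - B                                  ≈⟨ R.+-identityʳ _ ⟨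
    -- The two inserted terms cancel because e is -β d. One of them completes `A` to the right-hand
    -- side of the exchange relation, the other is the result.
    A - B + 0#                             ≈⟨ +-cong ≈-refl opposite-terms ⟨
    A - B + (d * (β * Z) + e * Z)
      ≈⟨ solve 4 (λ a b c d → a :+ b :+ (c :+ d) := (a :+ d) :+ b :+ c) ≈-refl A (- B) (d * (β * Z)) (e * Z) ⟩
    A + e * Z - B + d * (β * Z)            ≈⟨ +-cong (+-cong exchanged ≈-refl) ≈-refl ⟨
    B - B + d * (β * Z)                    ≈⟨ +-cong (R.-‿inverseʳ B) ≈-refl ⟩
    0# + d * (β * Z)                       ≈⟨ +-identityˡ _ ⟩
    d * (β * Z)                            ∎
    where
    x₁ x₂ d e Z A B : Poly (suc m)
    x₁ = x (inject₁ i)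
    x₂ = x (suc i)
    d  = x₁ - x₂
    e  = β * (x₂ - x₁)
    Z  = pipeSum (s i ∘ₚ w)
    A  = (1# + β * x₂) * pipeSum w
    B  = (1# + β * x₁) * (s i • pipeSum w)
    exchanged : B ≈ A + e * Z
    exchanged = ≈-trans
      (*-cong ≈-refl (substX-partition (s i ⟨$⟩ʳ_) (toℕ ∘ (w ⟨$⟩ʳ_)) (λ k → β * x k) (λ j → β * y j)))
      (partition-exchange i (toℕ ∘ (w ⟨$⟩ʳ_)) (λ k → β * x k) (λ j → β * y j) e lt difference)
      where
      difference : β * x₂ ≈ β * x₁ + e
      difference = ≈-sym (≈-trans
        (solve 4 (λ b x₁ x₂ n₁ → b :* x₁ :+ b :* (x₂ :+ n₁) := b :* (x₂ :+ (x₁ :+ n₁)))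
          ≈-refl β x₁ x₂ (- x₁))
        (*-cong ≈-refl (≈-trans (+-cong ≈-refl (R.-‿inverseʳ x₁)) (R.+-identityʳ x₂))))
    opposite-terms : d * (β * Z) + e * Z ≈ 0#
    opposite-terms = ≈-trans
      (solve 6 (λ b z x₁ x₂ n₁ n₂ → (x₁ :+ n₂) :* (b :* z) :+ b :* (x₂ :+ n₁) :* z
                                 := b :* ((x₁ :+ n₁) :+ (x₂ :+ n₂)) :* z)
        ≈-refl β Z x₁ x₂ (- x₁) (- x₂))
      (≈-trans (*-cong (*-cong ≈-refl (+-cong (R.-‿inverseʳ x₁) (R.-‿inverseʳ x₂))) ≈-refl)
        (solve 2 (λ b z → b :* (con 0 :+ con 0) :* z := con 0) ≈-refl β Z))

  -- The action of sᵢ fixes β. The scaling is stated for numerators because `π-quotient` gives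
  -- access to `π` only through them.
  β^*π-numerator : ∀ i k f → β ^ k * π-numerator i f ≈ π-numerator i (β ^ k * f)
  β^*π-numerator i k f = begin
    c * (a * f + - (b * g))              ≈⟨ distribˡ _ _ _ ⟩
    c * (a * f) + c * - (b * g)          ≈⟨ +-cong ≈-refl (-‿distribʳ-* c _) ⟨
    c * (a * f) + - (c * (b * g))        ≈⟨ +-cong (swap c a f) (-‿cong (swap c b g)) ⟩
    a * (c * f) + - (b * (c * g))        ≈⟨ +-cong ≈-refl (-‿cong (*-cong ≈-refl (*-cong
                                              (R.reflexive (substX-β^ (s i ⟨$⟩ʳ_) k)) ≈-refl))) ⟨
    a * (c * f) + - (b * (s i • (c * f)))  ∎
    where
    open import Algebra.Properties.Ring R.ring using (-‿distribʳ-*)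
    a = 1# + β * x (suc i)
    b = 1# + β * x (inject₁ i)
    c = β ^ k
    g = s i • f
    swap : ∀ c a f → c * (a * f) ≈ a * (c * f)
    swap = solve 3 (λ c a f → c :* (a :* f) := a :* (c :* f)) ≈-refl

  -- Induction on the given chain of descents. As `pipeSum w` depends on w alone, the independence
  -- of the chain comes out as well.
  grothendieck≈pipeSum : ∀ {w : Permutation′ (suc m)} {f} → IsGrothendieck w f → β ^ inv w * f ≈ pipeSum w
  grothendieck≈pipeSum {w} (longest w≈) = pipeSum-longest w w≈
  grothendieck≈pipeSum {v} (descend {w} {f} i G lt v≈) = ≈-trans
    (*-cong (R.reflexive (cong (β ^_) (inv-cong {w = v} {v = s i ∘ₚ w} v≈))) ≈-refl)
    (≈-trans
      -- A descent lowers `inv` by one, so the additional β turns the power for `s i ∘ₚ w` into the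
      -- one for `w`, to which the induction hypothesis applies.
      (β-cancel (cancel (inject₁ i) (suc i) (inject₁≢suc i) (begin
        d * (β * (β ^ inv (s i ∘ₚ w) * π i f))
          ≈⟨ solve 4 (λ d b c g → d :* (b :* (c :* g)) := (b :* c) :* (d :* g)) ≈-refl
               d β (β ^ inv (s i ∘ₚ w)) (π i f) ⟩
        β ^ suc (inv (s i ∘ₚ w)) * (d * π i f)
          ≈⟨ *-cong (R.reflexive (cong (β ^_) (sym (inversions-descent i (toℕ ∘ (w ⟨$⟩ʳ_)) lt))))
               (π-quotient i f) ⟩
        β ^ inv w * π-numerator i f
          ≈⟨ β^*π-numerator i (inv w) f ⟩
        π-numerator i (β ^ inv w * f)
          ≈⟨ +-cong (*-cong ≈-refl h) (-‿cong (*-cong ≈-refl (substX-cong (s i ⟨$⟩ʳ_) h))) ⟩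
        π-numerator i (pipeSum w)
          ≈⟨ pipeSum-exchange w i lt ⟩
        d * (β * pipeSum (s i ∘ₚ w)) ∎)))
      (partition-cong (λ k → cong toℕ (sym (v≈ k))) (λ k → β * x k) (λ j → β * y j)))
    where
    d : Poly (suc m)
    d = x (inject₁ i) - x (suc i)
    h : β ^ inv w * f ≈ pipeSum w
    h = grothendieck≈pipeSum G

corollary1p5 : (m : ℕ) (w : Permutation′ (ℕ.suc m)) (𝔊 : Poly (ℕ.suc m)) → IsGrothendieck w 𝔊 →
    𝔊 ≈ ∑ (MPipes w) (λ (P , S) →
    β ^ ((∣ D P ∣ ℕ.+ ∣ S ∣) ∸ ℓ w) *
    ∏ (elements (D P ∪ S)) (λ (i , j) → x i ⊕ y j))
corollary1p5 m w 𝔊 G = β^-cancel (ℓ w) (≈-trans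
  (subst (λ k → β ^ k * 𝔊 ≈ pipeSum w) (sym (ℓ≡inv w)) (grothendieck≈pipeSum G))
  (≈-sym (MPipes-∑ w (ℓ w) λ P pd → ℕ.≤-trans (ℕ.≤-reflexive (ℓ≡inv w)) (inv≤∣D∣ w P pd))))
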